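{- The following four identities hold in the ring $\mathbb{Z}[z,z^{ -1}][[q]]$ of formal power series in $q$ with coefficients that are Laurent polynomials in $z$. (1) $$(zq;q)_\infty (z^{ -1}q;q)_\infty (q;q)_\infty \sum_{n=0}^\infty \frac{q^{n^2}}{(zq;q)_n (z^{ -1}q;q)_n} = \frac12\sum_{n=0}^\infty\left(\sum_{j=0}^{\lfloor n/2\rfloor}(-1)^{n+j}(z^{n-3j}+z^{3j-n})\,q^{\frac12(n^2-3j^2)+\frac12(n-j)}+\sum_{j=1}^{\lfloor n/2\rfloor}(-1)^{n+j}(z^{n-3j+1}+z^{3j-n-1})\,q^{\frac12(n^2-3j^2)+\frac12(n+j)}\right).$$ (2) $$(1+z)(zq;q)_\infty (z^{ -1}q;q)_\infty (q;q)_\infty \sum_{n=0}^\infty \frac{(-1;q)_n\, q^{\frac12 n(n+1)}}{(zq;q)_n (z^{ -1}q;q)_n} = \sum_{n=0}^\infty\ \sum_{|m|\le \lfloor n/2\rfloor}(-1)^{n+m}(z^{n-2|m|+1}+z^{2|m|-n})\,q^{\frac12(n^2-2m^2)+\frac12 n}.$$ (3) $$(1+z)(zq;q)_\infty (z^{ -1}q;q)_\infty (q;q)_\infty \sum_{n=0}^\infty \frac{(-1;q)_n\, q^{\frac12 n(n+1)}}{(zq;q)_n (z^{ -1}q;q)_n} = \sum_{n=0}^\infty\ \sum_{|m|\le \lfloor n/3\rfloor}(-1)^{n}(z^{n+1-4|m|}+z^{4|m|-n})\,q^{\frac12(n^2-8m^2)+\frac12 n}.$$ (4) $$(zq^2;q^2)_\infty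 (z^{ -1}q^2;q^2)_\infty (q^2;q^2)_\infty \sum_{n=0}^\infty \frac{(-1)^n q^{n^2}(q;q^2)_n}{(zq^2;q^2)_n (z^{ -1}q^2;q^2)_n} = \sum_{n=0}^\infty\left(\sum_{m=0}^{n}(-1)^n z^{m-n}q^{\frac12(2n^2-m^2)+\frac12(2n-m)}+\sum_{m=1}^{n}(-1)^n z^{n-m+1}q^{\frac12(2n^2-m^2)+\frac12(2n+m)}\right).$$
   Context: Notation: $(a;q)_\infty=\prod_{k\ge 0}(1-aq^k)$ and $(a;q)_n=\prod_{k=0}^{n-1}(1-aq^k)$ for integers $n\ge0$; $(a;q^2)_\infty$ and $(a;q^2)_n$ are defined the same way with $q$ replaced by $q^2$. $\lfloor x\rfloor$ is the integer part of $x$. In (2) and (3), $m$ runs over all integers (positive, negative and zero) in the indicated range. All quotients make sense because each denominator is a power series in $q$ with constant term $1$. The three series $R(z,q)=\sum_{n\ge0} \frac{q^{n^2}}{(zq;q)_n(z^{ -1}q;q)_n}$, $H(z,q)=\sum_{n\ge0}\frac{(-1;q)_n q^{n(n+1)/2}}{(zq;q)_n(z^{ -1}q;q)_n}$ and $K(z,q)=\sum_{n\ge0}\frac{(-1)^n(q;q^2)_nq^{n^2}}{(zq^2;q^2)_n(z^{ -1}q^2;q^2)_n}$ are called universal mock theta functions. -}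

module Defs where

open import Algebra.Bundles using (CommutativeRing; Monoid; Semiring)
open import Data.Bool.Base using (if_then_else_; true; false)
open import Data.Fin.Base as Fin using (Fin; toℕ)
import Data.Fin.Properties as Fin
open import Data.Integer.Base as ℤ using (ℤ; +_; -[1+_]; ∣_∣)
import Data.Integer.Properties as ℤ
open import Data.Integer.Solver using (module +-*-Solver)
open import Data.List.Base using (List; []; _∷_; _++_; map; [_])
import Data.List.Properties as List
open import Data.Nat.Base as ℕ using (ℕ; zero; suc; NonZero; _∸_; _≤_; _<_; z≤n; s≤s)
open import Data.Nat.DivMod using (_/_; /-monoˡ-≤; m*n/n≡m; m/n/o≡m/[n*o]; m/n≤m; m/n*n≤m)
import Data.Nat.Properties as ℕ
open import Data.Product.Base using (∃; _×_; _,_; proj₁; proj₂)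
open import Data.Sum.Base using (inj₁; inj₂)
open import Level using (0ℓ; _⊔_)
open import Relation.Binary.Bundles using (Setoid)
open import Relation.Binary.Structures using (IsEquivalence)
open import Relation.Binary.PropositionalEquality as ≡ using (_≡_; refl; cong; cong₂)
open import Relation.Nullary.Decidable using (does; yes; no; dec-true; dec-false)
import Algebra.Consequences.Setoid as Consequences
import Algebra.Definitions.RawMonoid as RawMonoid
import Algebra.Definitions.RawSemiring as RawSemiring
import Algebra.Properties.Ring as RingProperties
import Relation.Binary.Reasoning.Setoid as SetoidReasoning

module LaurentPolynomial where

  -- The list [(c₁ , e₁) , … , (cᵣ , eᵣ)] stands for c₁ z^e₁ + ⋯ + cᵣ z^eᵣ;
  -- exponents may repeat and coefficients may vanish, so equality is
  -- equality of all coefficients.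
  Laurent : Set
  Laurent = List (ℤ × ℤ)

  coeff : Laurent → ℤ → ℤ
  coeff []            k = ℤ.0ℤ
  coeff ((c , e) ∷ p) k = (if does (e ℤ.≟ k) then c else ℤ.0ℤ) ℤ.+ coeff p k

  infix 4 _≈_
  record _≈_ (p q : Laurent) : Set where
    constructor mk≈
    field coeff≡ : ∀ k → coeff p k ≡ coeff q k
  open _≈_ public

  scale : ℤ × ℤ → Laurent → Laurent
  scale (c , e) = map (λ (d , f) → c ℤ.* d , e ℤ.+ f)

  infixl 7 _*_
  _*_ : Laurent → Laurent → Laurent
  []      * q = []
  (t ∷ p) * q = scale t q ++ p * q

  neg : Laurent → Laurent
  neg = map (λ (c , e) → ℤ.- c , e)

  private
    δ : ℤ × ℤ → ℤ → ℤ
    δ (c , e) k = if does (e ℤ.≟ k) then c else ℤ.0ℤ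

    coeff-++ : ∀ p q k → coeff (p ++ q) k ≡ coeff p k ℤ.+ coeff q k
    coeff-++ []      q k = ≡.sym (ℤ.+-identityˡ _)
    coeff-++ (t ∷ p) q k = ≡.trans (cong (λ x → δ t k ℤ.+ x) (coeff-++ p q k))
      (≡.sym (ℤ.+-assoc (δ t k) (coeff p k) (coeff q k)))

    coeff-neg : ∀ p k → coeff (neg p) k ≡ ℤ.- coeff p k
    coeff-neg []            k = refl
    coeff-neg ((c , e) ∷ p) k with does (e ℤ.≟ k)
    ... | true  = ≡.trans (cong (λ x → ℤ.- c ℤ.+ x) (coeff-neg p k))
                                   (≡.sym (ℤ.neg-distrib-+ c (coeff p k)))
    ... | false = ≡.trans (cong (λ x → ℤ.0ℤ ℤ.+ x) (coeff-neg p k))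
                                   (≡.sym (ℤ.neg-distrib-+ ℤ.0ℤ (coeff p k)))

    δ-scale : ∀ c e d f k → δ (c ℤ.* d , e ℤ.+ f) k ≡ c ℤ.* δ (d , f) (k ℤ.- e)
    δ-scale c e d f k with f ℤ.≟ k ℤ.- e
    ... | yes p = ≡.trans
          (cong (λ b → if b then c ℤ.* d else ℤ.0ℤ) (dec-true (e ℤ.+ f ℤ.≟ k) (≡.trans (cong (λ x → e ℤ.+ x) p) (cancel e k)))) refl
      where
      open +-*-Solver
      cancel : ∀ e k → e ℤ.+ (k ℤ.- e) ≡ k
      cancel = solve 2 (λ e k → e :+ (k :- e) := k) refl
    ... | no ¬p = ≡.trans
          (cong (λ b → if b then c ℤ.* d else ℤ.0ℤ) (dec-false (e ℤ.+ f ℤ.≟ k) (λ p → ¬p (≡.trans (cancel e f) (cong (λ x → x ℤ.- e) p)))))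
          (≡.sym (ℤ.*-zeroʳ c))
      where
      open +-*-Solver
      cancel : ∀ e f → f ≡ e ℤ.+ f ℤ.- e
      cancel = solve 2 (λ e f → f := e :+ f :- e) refl

    coeff-scale : ∀ c e q k → coeff (scale (c , e) q) k ≡ c ℤ.* coeff q (k ℤ.- e)
    coeff-scale c e []            k = ≡.sym (ℤ.*-zeroʳ c)
    coeff-scale c e ((d , f) ∷ q) k = ≡.trans
      (cong₂ ℤ._+_ (δ-scale c e d f k) (coeff-scale c e q k))
      (≡.sym (ℤ.*-distribˡ-+ c (δ (d , f) (k ℤ.- e)) (coeff q (k ℤ.- e))))

    ≈-refl : ∀ {p} → p ≈ p
    ≈-refl = mk≈ λ k → refl

    ≈-sym : ∀ {p q} → p ≈ q → q ≈ p
    ≈-sym (mk≈ h) = mk≈ λ k → ≡.sym (h k)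

    ≈-trans : ∀ {p q r} → p ≈ q → q ≈ r → p ≈ r
    ≈-trans (mk≈ h) (mk≈ h′) = mk≈ λ k → ≡.trans (h k) (h′ k)

    ≡⇒≈ : ∀ {p q} → p ≡ q → p ≈ q
    ≡⇒≈ refl = ≈-refl

    ++-cong : ∀ {p p′ q q′} → p ≈ p′ → q ≈ q′ → p ++ q ≈ p′ ++ q′
    ++-cong {p} {p′} {q} {q′} (mk≈ h) (mk≈ h′) = mk≈ λ k →
      ≡.trans (coeff-++ p q k) (≡.trans (cong₂ ℤ._+_ (h k) (h′ k)) (≡.sym (coeff-++ p′ q′ k)))

    ++-comm : ∀ p q → p ++ q ≈ q ++ p
    ++-comm p q = mk≈ λ k →
      ≡.trans (coeff-++ p q k) (≡.trans (ℤ.+-comm (coeff p k) (coeff q k)) (≡.sym (coeff-++ q p k)))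

    ++-assoc : ∀ p q r → (p ++ q) ++ r ≈ p ++ (q ++ r)
    ++-assoc p q r = ≡⇒≈ (List.++-assoc p q r)

    neg-cong : ∀ {p q} → p ≈ q → neg p ≈ neg q
    neg-cong {p} {q} (mk≈ h) = mk≈ λ k →
      ≡.trans (coeff-neg p k) (≡.trans (cong (λ x → ℤ.- x) (h k)) (≡.sym (coeff-neg q k)))

    neg-inverseˡ : ∀ p → neg p ++ p ≈ []
    neg-inverseˡ p = mk≈ λ k → ≡.trans (coeff-++ (neg p) p k)
      (≡.trans (cong (λ x → x ℤ.+ coeff p k) (coeff-neg p k)) (ℤ.+-inverseˡ (coeff p k)))

    scale-cong : ∀ t {p q} → p ≈ q → scale t p ≈ scale t q
    scale-cong (c , e) {p} {q} (mk≈ h) = mk≈ λ k →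
      ≡.trans (coeff-scale c e p k)
        (≡.trans (cong (λ x → c ℤ.* x) (h (k ℤ.- e))) (≡.sym (coeff-scale c e q k)))

    *-congˡ : ∀ p {q r} → q ≈ r → p * q ≈ p * r
    *-congˡ []      h = ≈-refl
    *-congˡ (t ∷ p) h = ++-cong (scale-cong t h) (*-congˡ p h)

    *-zeroʳ : ∀ p → p * [] ≡ []
    *-zeroʳ []      = refl
    *-zeroʳ (t ∷ p) = *-zeroʳ p

    ++-interchange : ∀ p q r s → (p ++ q) ++ (r ++ s) ≈ (p ++ r) ++ (q ++ s)
    ++-interchange p q r s =
      ≈-trans (++-assoc p q (r ++ s)) (≈-trans (++-cong (≈-refl {p}) (
        ≈-trans (≈-sym (++-assoc q r s)) (≈-trans (++-cong (++-comm q r) (≈-refl {s})) (++-assoc r q s))))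
      (≈-sym (++-assoc p r (q ++ s))))

    *-∷ʳ : ∀ p t q → p * (t ∷ q) ≈ scale t p ++ p * q
    *-∷ʳ []            t       q = ≈-refl
    *-∷ʳ ((c , e) ∷ p) (d , f) q =
      ≈-trans
        (++-cong {p = (c ℤ.* d , e ℤ.+ f) ∷ scale (c , e) q}
          (≡⇒≈ (cong₂ (λ x y → (x , y) ∷ scale (c , e) q) (ℤ.*-comm c d) (ℤ.+-comm e f)))
          (*-∷ʳ p (d , f) q))
        (++-interchange [ (d ℤ.* c , f ℤ.+ e) ] (scale (c , e) q) (scale (d , f) p) (p * q))

    *-comm : ∀ p q → p * q ≈ q * p
    *-comm []      q = ≡⇒≈ (≡.sym (*-zeroʳ q))
    *-comm (t ∷ p) q = ≈-trans (++-cong (≈-refl {scale t q}) (*-comm p q)) (≈-sym (*-∷ʳ q t p))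

    *-congʳ : ∀ {p q} r → p ≈ q → p * r ≈ q * r
    *-congʳ {p} {q} r h = ≈-trans (*-comm p r) (≈-trans (*-congˡ r h) (*-comm r q))

    *-distribʳ : ∀ r p q → (p ++ q) * r ≈ p * r ++ q * r
    *-distribʳ r []      q = ≈-refl
    *-distribʳ r (t ∷ p) q = ≈-trans (++-cong (≈-refl {scale t r}) (*-distribʳ r p q))
      (≈-sym (++-assoc (scale t r) (p * r) (q * r)))

    scale-++ : ∀ t p q → scale t (p ++ q) ≡ scale t p ++ scale t q
    scale-++ t p q = List.map-++ _ p q

    scale-scale : ∀ c e d f p → scale (c ℤ.* d , e ℤ.+ f) p ≡ scale (c , e) (scale (d , f) p)
    scale-scale c e d f []            = refl
    scale-scale c e d f ((a , b) ∷ p) = cong₂ _∷_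
      (cong₂ _,_ (ℤ.*-assoc c d a) (ℤ.+-assoc e f b)) (scale-scale c e d f p)

    scale-* : ∀ t p q → scale t p * q ≡ scale t (p * q)
    scale-* t       []            q = refl
    scale-* (c , e) ((d , f) ∷ p) q = ≡.trans
      (cong₂ _++_ (scale-scale c e d f q) (scale-* (c , e) p q))
      (≡.sym (scale-++ (c , e) (scale (d , f) q) (p * q)))

    *-assoc : ∀ p q r → (p * q) * r ≈ p * (q * r)
    *-assoc []      q r = ≈-refl
    *-assoc (t ∷ p) q r = ≈-trans (*-distribʳ r (scale t q) (p * q))
      (++-cong (≡⇒≈ (scale-* t q r)) (*-assoc p q r))

    1* : ∀ p → [ ℤ.1ℤ , ℤ.0ℤ ] * p ≡ p
    1* []            = refl
    1* ((c , e) ∷ p) = cong₂ _∷_ (cong₂ _,_ (ℤ.*-identityˡ c) (ℤ.+-identityˡ e)) (1* p)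

  ℤ[z,z⁻¹] : CommutativeRing 0ℓ 0ℓ
  ℤ[z,z⁻¹] = record
    { Carrier = Laurent
    ; _≈_     = _≈_
    ; _+_     = _++_
    ; _*_     = _*_
    ; -_      = neg
    ; 0#      = []
    ; 1#      = [ ℤ.1ℤ , ℤ.0ℤ ]
    ; isCommutativeRing = record
      { isRing = record
        { +-isAbelianGroup = record
          { isGroup = record
            { isMonoid = record
              { isSemigroup = record
                { isMagma = record { isEquivalence = ≈-equiv ; ∙-cong = ++-cong }
                ; assoc   = ++-assoc
                }
              ; identity = comm∧idˡ⇒id ++-comm (λ p → ≈-refl)
              }
            ; inverse = comm∧invˡ⇒inv ++-comm neg-inverseˡ
            ; ⁻¹-cong = neg-cong
            }
          ; comm = ++-comm
          }
        ; *-cong     = λ {p} {p′} {q} {q′} h h′ → ≈-trans (*-congʳ q h) (*-congˡ p′ h′)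
        ; *-assoc    = *-assoc
        ; *-identity = comm∧idˡ⇒id *-comm (λ p → ≡⇒≈ (1* p))
        ; distrib    = comm∧distrʳ⇒distr ++-cong *-comm *-distribʳ
        }
      ; *-comm = *-comm
      }
    }
    where
    ≈-equiv : IsEquivalence _≈_
    ≈-equiv = record { refl = ≈-refl ; sym = ≈-sym ; trans = ≈-trans }
    S : Setoid 0ℓ 0ℓ
    S = record { isEquivalence = ≈-equiv }
    open Consequences S

module _ {c ℓ} (M : Monoid c ℓ) where

  open Monoid M
  open RawMonoid rawMonoid using (sum)

  sum-snoc : ∀ (h : ℕ → Carrier) n →
             sum {suc n} (λ i → h (toℕ i)) ≈ sum {n} (λ i → h (toℕ i)) ∙ h n
  sum-snoc h zero    = trans (identityʳ (h 0)) (sym (identityˡ (h 0)))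
  sum-snoc h (suc n) = trans (∙-congˡ (sum-snoc (λ k → h (suc k)) n)) (sym (assoc _ _ _))

module PowerSeries {c ℓ} (R : CommutativeRing c ℓ) where

  private
    module R where
      open CommutativeRing R public
      open RawSemiring (Semiring.rawSemiring semiring) public using (sum)
      open RingProperties ring public using (-0#≈0#)
  open SetoidReasoning R.setoid

  -- The coefficient of q^n in f is coeff f n.
  record Series : Set c where
    no-eta-equality
    field coeff : ℕ → R.Carrier
  open Series public

  infix 4 _≈ˢ_
  record _≈ˢ_ (f g : Series) : Set ℓ where
    constructor mk≈
    field at : ∀ n → coeff f n R.≈ coeff g n
  open _≈ˢ_ public

  infixl 6 _+ˢ_
  infixl 7 _*ˢ_

  _+ˢ_ _*ˢ_ : Series → Series → Series
  coeff (f +ˢ g) n = coeff f n R.+ coeff g n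
  coeff (f *ˢ g) n = R.sum {suc n} (λ i → coeff f (toℕ i) R.* coeff g (n ∸ toℕ i))

  -ˢ_ : Series → Series
  coeff (-ˢ f) n = R.- coeff f n

  const : R.Carrier → Series
  coeff (const a) zero    = a
  coeff (const a) (suc n) = R.0#

  0ˢ 1ˢ : Series
  coeff 0ˢ n = R.0#
  1ˢ = const R.1#

  private
    tail : Series → Series
    coeff (tail f) n = coeff f (suc n)

    scale : R.Carrier → Series → Series
    coeff (scale a f) n = a R.* coeff f n

    *-suc : ∀ f g n → coeff (f *ˢ g) (suc n) ≡ coeff f 0 R.* coeff g (suc n) R.+ coeff (tail f *ˢ g) n
    *-suc f g n = refl

    *-cong : ∀ {f f′ g g′} → f ≈ˢ f′ → g ≈ˢ g′ → ∀ n → coeff (f *ˢ g) n R.≈ coeff (f′ *ˢ g′) n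
    *-cong p r zero    = R.+-congʳ (R.*-cong (at p 0) (at r 0))
    *-cong {f} {f′} p r (suc n) = R.+-cong (R.*-cong (at p 0) (at r (suc n)))
      (*-cong {tail f} {tail f′} (mk≈ λ k → at p (suc k)) r n)

    *-sucʳ : ∀ f g n → coeff (f *ˢ g) (suc n) R.≈ coeff (f *ˢ tail g) n R.+ coeff f (suc n) R.* coeff g 0
    *-sucʳ f g zero    = begin
      coeff f 0 R.* coeff g 1 R.+ (coeff f 1 R.* coeff g 0 R.+ R.0#)  ≈⟨ R.+-congˡ (R.+-identityʳ _) ⟩
      coeff f 0 R.* coeff g 1 R.+ coeff f 1 R.* coeff g 0             ≈⟨ R.+-congʳ (R.+-identityʳ _) ⟨
      coeff f 0 R.* coeff g 1 R.+ R.0# R.+ coeff f 1 R.* coeff g 0    ∎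
    *-sucʳ f g (suc n) = R.trans (R.+-congˡ (*-sucʳ (tail f) g n)) (R.sym (R.+-assoc _ _ _))

    *-comm : ∀ f g n → coeff (f *ˢ g) n R.≈ coeff (g *ˢ f) n
    *-comm f g zero    = R.+-congʳ (R.*-comm (coeff f 0) (coeff g 0))
    *-comm f g (suc n) = begin
      coeff f 0 R.* coeff g (suc n) R.+ coeff (tail f *ˢ g) n  ≈⟨ R.+-cong (R.*-comm _ _) (*-comm (tail f) g n) ⟩
      coeff g (suc n) R.* coeff f 0 R.+ coeff (g *ˢ tail f) n  ≈⟨ R.+-comm _ _ ⟩
      coeff (g *ˢ tail f) n R.+ coeff g (suc n) R.* coeff f 0  ≈⟨ *-sucʳ g f n ⟨
      coeff (g *ˢ f) (suc n)                       ∎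

    interchange : ∀ a b c d → (a R.+ b) R.+ (c R.+ d) R.≈ (a R.+ c) R.+ (b R.+ d)
    interchange = Consequences.comm∧assoc⇒middleFour R.setoid R.+-cong R.+-comm R.+-assoc

    *-distribʳ : ∀ h f g n → coeff ((f +ˢ g) *ˢ h) n R.≈ coeff (f *ˢ h) n R.+ coeff (g *ˢ h) n
    *-distribʳ h f g zero    = begin
      (coeff f 0 R.+ coeff g 0) R.* coeff h 0 R.+ R.0#                       ≈⟨ R.+-cong (R.distribʳ _ _ _) (R.sym (R.+-identityˡ _)) ⟩
      (coeff f 0 R.* coeff h 0 R.+ coeff g 0 R.* coeff h 0) R.+ (R.0# R.+ R.0#)    ≈⟨ interchange _ _ _ _ ⟩
      coeff (f *ˢ h) 0 R.+ coeff (g *ˢ h) 0                            ∎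
    *-distribʳ h f g (suc n) = R.trans
      (R.+-cong (R.distribʳ _ _ _) (*-distribʳ h (tail f) (tail g) n)) (interchange _ _ _ _)

    *-scale : ∀ a f g n → coeff (scale a f *ˢ g) n R.≈ a R.* coeff (f *ˢ g) n
    *-scale a f g zero    = begin
      (a R.* coeff f 0) R.* coeff g 0 R.+ R.0#      ≈⟨ R.+-cong (R.*-assoc _ _ _) (R.sym (R.zeroʳ a)) ⟩
      a R.* (coeff f 0 R.* coeff g 0) R.+ a R.* R.0# ≈⟨ R.distribˡ _ _ _ ⟨
      a R.* coeff (f *ˢ g) 0                  ∎
    *-scale a f g (suc n) = R.trans
      (R.+-cong (R.*-assoc _ _ _) (*-scale a (tail f) g n)) (R.sym (R.distribˡ _ _ _))

    *-assoc : ∀ f g h n → coeff ((f *ˢ g) *ˢ h) n R.≈ coeff (f *ˢ (g *ˢ h)) n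
    *-assoc f g h zero    = R.+-congʳ (begin
      (coeff f 0 R.* coeff g 0 R.+ R.0#) R.* coeff h 0   ≈⟨ R.*-congʳ (R.+-identityʳ _) ⟩
      coeff f 0 R.* coeff g 0 R.* coeff h 0              ≈⟨ R.*-assoc _ _ _ ⟩
      coeff f 0 R.* (coeff g 0 R.* coeff h 0)            ≈⟨ R.*-congˡ (R.+-identityʳ _) ⟨
      coeff f 0 R.* coeff (g *ˢ h) 0               ∎)
    *-assoc f g h (suc n) = begin
      coeff (f *ˢ g) 0 R.* coeff h (suc n) R.+ coeff (tail (f *ˢ g) *ˢ h) n
        ≈⟨ R.+-cong (R.*-congʳ (R.+-identityʳ _)) (R.trans
             (*-cong {tail (f *ˢ g)} {scale (coeff f 0) (tail g) +ˢ tail f *ˢ g} {h} {h} (mk≈ λ k → R.refl) (mk≈ λ k → R.refl) n)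
             (*-distribʳ h (scale (coeff f 0) (tail g)) (tail f *ˢ g) n)) ⟩
      coeff f 0 R.* coeff g 0 R.* coeff h (suc n) R.+ (coeff (scale (coeff f 0) (tail g) *ˢ h) n R.+ coeff ((tail f *ˢ g) *ˢ h) n)
        ≈⟨ R.+-cong (R.*-assoc _ _ _) (R.+-cong (*-scale (coeff f 0) (tail g) h n) (*-assoc (tail f) g h n)) ⟩
      coeff f 0 R.* (coeff g 0 R.* coeff h (suc n)) R.+ (coeff f 0 R.* coeff (tail g *ˢ h) n R.+ coeff (tail f *ˢ (g *ˢ h)) n)
        ≈⟨ R.+-assoc _ _ _ ⟨
      coeff f 0 R.* (coeff g 0 R.* coeff h (suc n)) R.+ coeff f 0 R.* coeff (tail g *ˢ h) n R.+ coeff (tail f *ˢ (g *ˢ h)) n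
        ≈⟨ R.+-congʳ (R.distribˡ _ _ _) ⟨
      coeff f 0 R.* coeff (g *ˢ h) (suc n) R.+ coeff (tail f *ˢ (g *ˢ h)) n ∎

    zero-* : ∀ f n → coeff (0ˢ *ˢ f) n R.≈ R.0#
    zero-* f zero    = R.trans (R.+-identityʳ _) (R.zeroˡ _)
    zero-* f (suc n) = R.trans (R.+-cong (R.zeroˡ _) (zero-* f n)) (R.+-identityʳ _)

    one-* : ∀ f n → coeff (1ˢ *ˢ f) n R.≈ coeff f n
    one-* f zero    = R.trans (R.+-identityʳ _) (R.*-identityˡ _)
    one-* f (suc n) = R.trans (R.+-cong (R.*-identityˡ _) (zero-* f n)) (R.+-identityʳ _)

    ≈ˢ-equiv : IsEquivalence _≈ˢ_
    ≈ˢ-equiv = record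
      { refl  = mk≈ λ n → R.refl
      ; sym   = λ p → mk≈ λ n → R.sym (at p n)
      ; trans = λ p r → mk≈ λ n → R.trans (at p n) (at r n)
      }

  ring⟦q⟧ : CommutativeRing c ℓ
  ring⟦q⟧ = record
    { Carrier = Series
    ; _≈_     = _≈ˢ_
    ; _+_     = _+ˢ_
    ; _*_     = _*ˢ_
    ; -_      = -ˢ_
    ; 0#      = 0ˢ
    ; 1#      = 1ˢ
    ; isCommutativeRing = record
      { isRing = record
        { +-isAbelianGroup = record
          { isGroup = record
            { isMonoid = record
              { isSemigroup = record
                { isMagma = record
                  { isEquivalence = ≈ˢ-equiv
                  ; ∙-cong = λ p r → mk≈ λ n → R.+-cong (at p n) (at r n)
                  }
                ; assoc = λ f g h → mk≈ λ n → R.+-assoc _ _ _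
                }
              ; identity = (λ f → mk≈ λ n → R.+-identityˡ _) , (λ f → mk≈ λ n → R.+-identityʳ _)
              }
            ; inverse = (λ f → mk≈ λ n → R.-‿inverseˡ _) , (λ f → mk≈ λ n → R.-‿inverseʳ _)
            ; ⁻¹-cong = λ p → mk≈ λ n → R.-‿cong (at p n)
            }
          ; comm = λ f g → mk≈ λ n → R.+-comm _ _
          }
        ; *-cong     = λ p r → mk≈ (*-cong p r)
        ; *-assoc    = λ f g h → mk≈ (*-assoc f g h)
        ; *-identity = comm∧idˡ⇒id *-comm′ (λ f → mk≈ (one-* f))
        ; distrib    = comm∧distrʳ⇒distr (λ p r → mk≈ λ n → R.+-cong (at p n) (at r n))
                         *-comm′ (λ h f g → mk≈ (*-distribʳ h f g))
        }
      ; *-comm = *-comm′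
      }
    }
    where
    *-comm′ : ∀ f g → f *ˢ g ≈ˢ g *ˢ f
    *-comm′ f g = mk≈ (*-comm f g)
    S : Setoid c ℓ
    S = record { isEquivalence = ≈ˢ-equiv }
    open Consequences S

  private
    module S where
      open CommutativeRing ring⟦q⟧ public
      open RawSemiring (Semiring.rawSemiring semiring) public using (sum; product; _^_)
      open RingProperties ring public using (-‿distribˡ-*; -‿distribʳ-*; -‿involutive; -‿+-comm)

  open S using (_-_)

  -- Convergence in the q-adic topology: every coefficient is eventually constant.
  infix 4 _⟶_
  _⟶_ : (ℕ → Series) → Series → Set ℓ
  s ⟶ f = ∀ N → ∃ λ M → ∀ n → M ≤ n → coeff (s n) N R.≈ coeff f N

  Convergent : (ℕ → Series) → Set (c ⊔ ℓ)
  Convergent s = ∃ λ f → s ⟶ f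

  lim : (s : ℕ → Series) → Convergent s → Series
  lim s = proj₁

  lim-unique : ∀ {s f g} → s ⟶ f → s ⟶ g → f S.≈ g
  lim-unique {s} {f} {g} p r = mk≈ λ N → R.trans
    (R.sym (proj₂ (p N) _ (ℕ.m≤m⊔n (proj₁ (p N)) (proj₁ (r N)))))
    (proj₂ (r N) _ (ℕ.m≤n⊔m (proj₁ (p N)) (proj₁ (r N))))

  partialSum : (ℕ → Series) → ℕ → Series
  partialSum f n = S.sum {n} (λ i → f (toℕ i))

  Summable : (ℕ → Series) → Set (c ⊔ ℓ)
  Summable f = Convergent (partialSum f)

  ∑∞ : (f : ℕ → Series) → Summable f → Series
  ∑∞ f = lim (partialSum f)

  -- f ∈q^ k says that f is divisible by qᵏ.
  infix 4 _∈q^_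
  record _∈q^_ (f : Series) (k : ℕ) : Set ℓ where
    constructor mk∈
    field vanish : ∀ i → i < k → coeff f i R.≈ R.0#
  open _∈q^_ public

  ∈q^-resp : ∀ {f g k} → f S.≈ g → f ∈q^ k → g ∈q^ k
  ∈q^-resp p h = mk∈ λ i i<k → R.trans (R.sym (at p i)) (vanish h i i<k)

  ∈q^-mono : ∀ {f j k} → j ≤ k → f ∈q^ k → f ∈q^ j
  ∈q^-mono j≤k h = mk∈ λ i i<j → vanish h i (ℕ.<-≤-trans i<j j≤k)

  ∈q^-1 : ∀ {f} → coeff f 0 R.≈ R.0# → f ∈q^ 1
  ∈q^-1 f0 = mk∈ λ { zero _ → f0 ; (suc i) (s≤s ()) }

  ∈q^-+ : ∀ {f g k} → f ∈q^ k → g ∈q^ k → f S.+ g ∈q^ k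
  ∈q^-+ p r = mk∈ λ i i<k → R.trans (R.+-cong (vanish p i i<k) (vanish r i i<k)) (R.+-identityʳ _)

  ∈q^-neg : ∀ {f k} → f ∈q^ k → S.- f ∈q^ k
  ∈q^-neg p = mk∈ λ i i<k → R.trans (R.-‿cong (vanish p i i<k)) R.-0#≈0#

  ∈q^-sum : ∀ {k} n (f : Fin n → Series) → (∀ i → f i ∈q^ k) → S.sum f ∈q^ k
  ∈q^-sum zero    f h = mk∈ λ i i<k → R.refl
  ∈q^-sum (suc n) f h = ∈q^-+ (h Fin.zero) (∈q^-sum n (λ i → f (Fin.suc i)) (λ i → h (Fin.suc i)))

  private
    *-vanish : ∀ (f g : Series) k → (∀ i → i < k → coeff f i R.≈ R.0#) → ∀ i → i < k → coeff (f *ˢ g) i R.≈ R.0#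
    *-vanish f g k       h zero    0<k       =
      R.trans (R.+-identityʳ _) (R.trans (R.*-congʳ (h 0 0<k)) (R.zeroˡ _))
    *-vanish f g (suc k) h (suc i) (s≤s i<k) = R.trans
      (R.+-cong (R.trans (R.*-congʳ (h 0 (s≤s z≤n))) (R.zeroˡ _))
                (*-vanish (tail f) g k (λ j j<k → h (suc j) (s≤s j<k)) i i<k))
      (R.+-identityʳ _)

  ∈q^-*ʳ : ∀ {f} g {k} → f ∈q^ k → f S.* g ∈q^ k
  ∈q^-*ʳ {f} g {k} h = mk∈ (*-vanish f g k (vanish h))

  ∈q^-*ˡ : ∀ f {g k} → g ∈q^ k → f S.* g ∈q^ k
  ∈q^-*ˡ f {g} h = ∈q^-resp (S.*-comm g f) (∈q^-*ʳ f h)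

  ∈q^-*-suc : ∀ {f g k} → f ∈q^ 1 → g ∈q^ k → f S.* g ∈q^ suc k
  ∈q^-*-suc {f} {g} {k} f∈ h = mk∈ go
    where
    f0 : coeff f 0 R.≈ R.0#
    f0 = vanish f∈ 0 (s≤s z≤n)
    go : ∀ i → i < suc k → coeff (f *ˢ g) i R.≈ R.0#
    go zero    _         = R.trans (R.+-identityʳ _) (R.trans (R.*-congʳ f0) (R.zeroˡ _))
    go (suc i) (s≤s i<k) = R.trans
      (R.+-cong (R.trans (R.*-congʳ f0) (R.zeroˡ _)) (vanish (∈q^-*ˡ (tail f) h) i i<k))
      (R.+-identityʳ _)

  ^-∈q^ : ∀ {f} → f ∈q^ 1 → ∀ k → f S.^ k ∈q^ k
  ^-∈q^ f∈ zero    = mk∈ λ i ()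
  ^-∈q^ f∈ (suc k) = ∈q^-*-suc f∈ (^-∈q^ f∈ k)

  stable⇒convergent : ∀ s (μ : ℕ → ℕ) →
                      (∀ N n → μ N ≤ n → coeff (s (suc n)) N R.≈ coeff (s n) N) → Convergent s
  stable⇒convergent s μ h = record { coeff = λ N → coeff (s (μ N)) N } , λ N → μ N , λ n μ≤n →
    ≡.subst (λ m → coeff (s m) N R.≈ coeff (s (μ N)) N) (ℕ.m∸n+n≡m μ≤n) (go N (n ∸ μ N))
    where
    go : ∀ N d → coeff (s (d ℕ.+ μ N)) N R.≈ coeff (s (μ N)) N
    go N zero    = R.refl
    go N (suc d) = R.trans (h N (d ℕ.+ μ N) (ℕ.m≤n+m (μ N) d)) (go N d)

  order⇒summable : ∀ f d .{{_ : NonZero d}} → (∀ n → f n ∈q^ n / d) → Summable f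
  order⇒summable f d h = stable⇒convergent (partialSum f) (λ N → suc N ℕ.* d) λ N n le → R.trans
    (at (sum-snoc S.+-monoid f n) N)
    (R.trans (R.+-congˡ (vanish (h n) N (≡.subst (_≤ n / d) (m*n/n≡m (suc N) d) (/-monoˡ-≤ d le)))) (R.+-identityʳ _))

  powers-summable : ∀ g → g ∈q^ 1 → Summable (λ k → g S.^ k)
  powers-summable g g0 = order⇒summable _ 1 λ n → ∈q^-mono (m/n≤m n 1) (^-∈q^ g0 n)

  1-unit : ∀ f → coeff f 0 R.≈ R.1# → S.1# - f ∈q^ 1
  1-unit f f0 = ∈q^-1 {S.1# - f} ( R.trans (R.+-congˡ (R.-‿cong f0)) (R.-‿inverseʳ _))

  inverse : ∀ f → coeff f 0 R.≈ R.1# → Series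
  inverse f f0 = ∑∞ (λ k → (S.1# - f) S.^ k) (powers-summable (S.1# - f) (1-unit f f0))

  infixl 7 _÷_⟨_⟩
  _÷_⟨_⟩ : Series → ∀ g → coeff g 0 R.≈ R.1# → Series
  f ÷ g ⟨ g0 ⟩ = f S.* inverse g g0

  private
    *-congˡ-upto : ∀ f g h N → (∀ i → i ≤ N → coeff g i R.≈ coeff h i) → coeff (f *ˢ g) N R.≈ coeff (f *ˢ h) N
    *-congˡ-upto f g h zero    p = R.+-congʳ (R.*-congˡ (p 0 z≤n))
    *-congˡ-upto f g h (suc N) p = R.+-cong (R.*-congˡ (p (suc N) ℕ.≤-refl))
      (*-congˡ-upto (tail f) g h N (λ i i≤N → p i (ℕ.m≤n⇒m≤1+n i≤N)))

    *-continuous : ∀ f {s g} → s ⟶ g → (λ n → f S.* s n) ⟶ f S.* g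
    *-continuous f {s} {g} p N = bound N , λ n le → *-congˡ-upto f (s n) g N (λ i i≤N →
        proj₂ (p i) n (ℕ.≤-trans (bound-≥ N i i≤N) le))
      where
      bound : ℕ → ℕ
      bound zero    = proj₁ (p 0)
      bound (suc N) = bound N ℕ.⊔ proj₁ (p (suc N))
      bound-≥ : ∀ N i → i ≤ N → proj₁ (p i) ≤ bound N
      bound-≥ zero    zero z≤n = ℕ.≤-refl
      bound-≥ (suc N) i    i≤N with ℕ.m≤n⇒m<n∨m≡n i≤N
      ... | inj₁ (s≤s i≤N′) = ℕ.≤-trans (bound-≥ N i i≤N′) (ℕ.m≤m⊔n _ _)
      ... | inj₂ refl       = ℕ.m≤n⊔m (bound N) _

    telescope : ∀ f n → f S.* partialSum (λ k → (S.1# - f) S.^ k) n S.≈ S.1# - (S.1# - f) S.^ n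
    telescope f zero    = S.trans (S.zeroʳ f) (S.sym (S.-‿inverseʳ S.1#))
    telescope f (suc n) = S.trans
      (S.*-congˡ {f} (sum-snoc S.+-monoid (λ k → u S.^ k) n))
      (S.trans (S.distribˡ f (partialSum (λ k → u S.^ k) n) w)
      (S.trans (S.+-congʳ (telescope f n))
      (S.trans (S.+-assoc S.1# (S.- w) (f S.* w)) (S.+-congˡ (S.sym -uw)))))
      where
      u = S.1# - f
      w = u S.^ n
      -uw : S.- (u S.* w) S.≈ S.- w S.+ f S.* w
      -uw = S.trans (S.-‿cong uw) (S.trans (S.sym (S.-‿+-comm w (S.- (f S.* w)))) (S.+-congˡ (S.-‿involutive (f S.* w))))
        where
        uw : u S.* w S.≈ w - f S.* w
        uw = S.trans (S.distribʳ w S.1# (S.- f)) (S.+-cong (S.*-identityˡ w) (S.sym (S.-‿distribˡ-* f w)))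

  *-inverse : ∀ f f0 → f S.* inverse f f0 S.≈ S.1#
  *-inverse f f0 = lim-unique {λ n → f S.* partialSum u^ n} {f S.* inverse f f0} {S.1#}
    (*-continuous f {partialSum u^} {inverse f f0} (proj₂ (powers-summable (S.1# - f) (1-unit f f0))))
    (λ N → suc N , λ n N<n → R.trans (at (telescope f n) N) (R.trans
      (R.+-congˡ (vanish (∈q^-neg (^-∈q^ (1-unit f f0) n)) N N<n)) (R.+-identityʳ _)))
    where
    u^ : ℕ → Series
    u^ k = (S.1# - f) S.^ k

  q : Series
  coeff q 1 = R.1#
  coeff q _ = R.0#

  q^-∈q^ : ∀ k → q S.^ k ∈q^ k
  q^-∈q^ = ^-∈q^ (∈q^-1 {q} R.refl)

  -- ⟨ a ⨾q^ d ⟩ n is (a; q^d)_n and ⟨ a ⨾q^ d ⟩∞ is (a; q^d)_∞.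
  ⟨_⨾q^_⟩_ : Series → ℕ → ℕ → Series
  ⟨ a ⨾q^ d ⟩ n = S.product {n} (λ k → S.1# - a S.* (q S.^ d) S.^ toℕ k)

  private
    q^d-0 : ∀ d .{{_ : NonZero d}} → q S.^ d ∈q^ 1
    q^d-0 (suc d) = ∈q^-mono (s≤s z≤n) (q^-∈q^ (suc d))

  pochhammer-convergent : ∀ a d .{{_ : NonZero d}} → Convergent (⟨ a ⨾q^ d ⟩_)
  pochhammer-convergent a d = stable⇒convergent (⟨ a ⨾q^ d ⟩_) suc λ N n N<n → R.trans
    (at (step n) N) (R.trans (R.+-congˡ (vanish (∈q^-*ˡ (⟨ a ⨾q^ d ⟩ n) (δ∈ n)) N N<n)) (R.+-identityʳ _))
    where
    δ : ℕ → Series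
    δ n = S.- (a S.* (q S.^ d) S.^ n)
    δ∈ : ∀ n → δ n ∈q^ n
    δ∈ n = ∈q^-neg (∈q^-*ˡ a (^-∈q^ (q^d-0 d) n))
    step : ∀ n → ⟨ a ⨾q^ d ⟩ (suc n) S.≈ ⟨ a ⨾q^ d ⟩ n S.+ ⟨ a ⨾q^ d ⟩ n S.* δ n
    step n = S.trans (sum-snoc S.*-monoid (λ k → S.1# - a S.* (q S.^ d) S.^ k) n)
      (S.trans (S.distribˡ (⟨ a ⨾q^ d ⟩ n) S.1# (δ n)) (S.+-congʳ (S.*-identityʳ (⟨ a ⨾q^ d ⟩ n))))

  ⟨_⨾q^_⟩∞ : Series → ∀ d .{{_ : NonZero d}} → Series
  ⟨ a ⨾q^ d ⟩∞ = lim (⟨ a ⨾q^ d ⟩_) (pochhammer-convergent a d)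

  unit-* : ∀ f g → coeff f 0 R.≈ R.1# → coeff g 0 R.≈ R.1# → coeff (f S.* g) 0 R.≈ R.1#
  unit-* f g p r = R.trans (R.+-identityʳ _) (R.trans (R.*-cong p r) (R.*-identityˡ _))

  pochhammer-unit : ∀ a d n → a ∈q^ 1 → coeff (⟨ a ⨾q^ d ⟩ n) 0 R.≈ R.1#
  pochhammer-unit a d n a∈ = go n (λ k → S.1# - a S.* (q S.^ d) S.^ toℕ k) λ k → R.trans
      (R.+-congˡ (vanish (∈q^-neg (∈q^-*ʳ ((q S.^ d) S.^ toℕ k) a∈)) 0 (s≤s z≤n))) (R.+-identityʳ _)
    where
    go : ∀ n (f : Fin n → Series) → (∀ i → coeff (f i) 0 R.≈ R.1#) → coeff (S.product f) 0 R.≈ R.1#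
    go zero    f h = R.refl
    go (suc n) f h = unit-* (f Fin.zero) (S.product (λ i → f (Fin.suc i)))
      (h Fin.zero) (go n (λ i → f (Fin.suc i)) (λ i → h (Fin.suc i)))

  infix 5 ∑-range ∑-symmetric

  ∑-range : ℕ → ℕ → (ℕ → Series) → Series
  ∑-range a b f = S.sum {suc b ∸ a} (λ i → f (a ℕ.+ toℕ i))

  -- The sum over all integers m with |m| ≤ b; the index is shifted by b.
  ∑-symmetric : ℕ → (ℤ → Series) → Series
  ∑-symmetric b f = S.sum {suc (2 ℕ.* b)} (λ i → f (+ toℕ i ℤ.- + b))

  syntax ∑-range a b (λ j → e) = ∑[ j ∈ a ⋯ b ] e
  syntax ∑-symmetric b (λ m → e) = ∑[ m ∈± b ] e

  ∈q^-∑-range : ∀ {k} a b f → (∀ j → j ≤ b → f j ∈q^ k) → ∑-range a b f ∈q^ k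
  ∈q^-∑-range a b f h = ∈q^-sum (suc b ∸ a) _ λ i → h (a ℕ.+ toℕ i) (ℕ.≤-pred (bound i))
    where
    bound : ∀ (i : Fin (suc b ∸ a)) → a ℕ.+ toℕ i < suc b
    bound i = +-<-∸ a (suc b) (Fin.toℕ<n i)
      where
      +-<-∸ : ∀ a c {i} → i < c ∸ a → a ℕ.+ i < c
      +-<-∸ zero    c       h = h
      +-<-∸ (suc a) (suc c) h = s≤s (+-<-∸ a c h)

  ∈q^-∑-symmetric : ∀ {k} b f → (∀ m → f m ∈q^ k) → ∑-symmetric b f ∈q^ k
  ∈q^-∑-symmetric b f h = ∈q^-sum (suc (2 ℕ.* b)) _ λ i → h (+ toℕ i ℤ.- + b)

open LaurentPolynomial public using (ℤ[z,z⁻¹])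
private module ℤ[z,z⁻¹] = CommutativeRing ℤ[z,z⁻¹]
open PowerSeries ℤ[z,z⁻¹] public
open CommutativeRing ring⟦q⟧ public using (_≈_; _+_; _*_; -_; 1#)
open RawSemiring (Semiring.rawSemiring (CommutativeRing.semiring ring⟦q⟧)) public using (_^_)

infix 9 z^_ -1^_

z^_ : ℤ → Series
z^ k = const [ ℤ.1ℤ , k ]

-1^_ : ℕ → Series
-1^ k = (- 1#) ^ k

zPochhammers : (d n : ℕ) → Series
zPochhammers d n = ⟨ z^ (+ 1) * q ^ d ⨾q^ d ⟩ n * ⟨ z^ -[1+ 0 ] * q ^ d ⨾q^ d ⟩ n

zPochhammers-unit : ∀ d .{{_ : NonZero d}} n → coeff (zPochhammers d n) 0 ℤ[z,z⁻¹].≈ ℤ[z,z⁻¹].1#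
zPochhammers-unit d@(suc _) n = unit-* (⟨ z^ (+ 1) * q ^ d ⨾q^ d ⟩ n) (⟨ z^ -[1+ 0 ] * q ^ d ⨾q^ d ⟩ n)
  (pochhammer-unit _ d n (zq∈ (+ 1))) (pochhammer-unit _ d n (zq∈ -[1+ 0 ]))
  where
  zq∈ : ∀ k → z^ k * q ^ d ∈q^ 1
  zq∈ k = ∈q^-*ˡ (z^ k) (∈q^-mono (s≤s z≤n) (q^-∈q^ d))

R-term H-term K-term : ℕ → Series
R-term n = q ^ (n ℕ.* n) ÷ zPochhammers 1 n ⟨ zPochhammers-unit 1 n ⟩
H-term n = (⟨ - 1# ⨾q^ 1 ⟩ n * q ^ (n ℕ.* suc n / 2)) ÷ zPochhammers 1 n ⟨ zPochhammers-unit 1 n ⟩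
K-term n = (-1^ n * ⟨ q ⨾q^ 2 ⟩ n * q ^ (n ℕ.* n)) ÷ zPochhammers 2 n ⟨ zPochhammers-unit 2 n ⟩

-- In the exponents of q below, _∸_ never truncates and _/ 2 is exact:
-- 3j² ≤ n² and j ≤ n for j ≤ n/2, 2m² ≤ n² for |m| ≤ n/2, 8m² ≤ n² for
-- |m| ≤ n/3, m² ≤ 2n² and m ≤ 2n for m ≤ n, and k² ± k is always even.

t₁ u₁ t₄ u₄ : ℕ → ℕ → Series
t₂ t₃ : ℕ → ℤ → Series

t₁ n j = -1^ (n ℕ.+ j)
       * (z^ (+ n ℤ.- + (3 ℕ.* j)) + z^ (+ (3 ℕ.* j) ℤ.- + n))
       * q ^ (((n ℕ.* n ∸ 3 ℕ.* (j ℕ.* j)) ℕ.+ (n ∸ j)) / 2)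

u₁ n j = -1^ (n ℕ.+ j)
       * (z^ (+ n ℤ.- + (3 ℕ.* j) ℤ.+ + 1) + z^ (+ (3 ℕ.* j) ℤ.- + n ℤ.- + 1))
       * q ^ (((n ℕ.* n ∸ 3 ℕ.* (j ℕ.* j)) ℕ.+ (n ℕ.+ j)) / 2)

-- For an integer k, (-1)^k = (-1)^|k|.
t₂ n m = -1^ ∣ + n ℤ.+ m ∣
       * (z^ (+ n ℤ.- + (2 ℕ.* ∣ m ∣) ℤ.+ + 1) + z^ (+ (2 ℕ.* ∣ m ∣) ℤ.- + n))
       * q ^ (((n ℕ.* n ∸ 2 ℕ.* (∣ m ∣ ℕ.* ∣ m ∣)) ℕ.+ n) / 2)

t₃ n m = -1^ n
       * (z^ (+ n ℤ.+ + 1 ℤ.- + (4 ℕ.* ∣ m ∣)) + z^ (+ (4 ℕ.* ∣ m ∣) ℤ.- + n))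
       * q ^ (((n ℕ.* n ∸ 8 ℕ.* (∣ m ∣ ℕ.* ∣ m ∣)) ℕ.+ n) / 2)

t₄ n m = -1^ n
       * z^ (+ m ℤ.- + n)
       * q ^ (((2 ℕ.* (n ℕ.* n) ∸ m ℕ.* m) ℕ.+ (2 ℕ.* n ∸ m)) / 2)

u₄ n m = -1^ n
       * z^ (+ n ℤ.- + m ℤ.+ + 1)
       * q ^ (((2 ℕ.* (n ℕ.* n) ∸ m ℕ.* m) ℕ.+ (2 ℕ.* n ℕ.+ m)) / 2)

hecke₁ hecke₂ hecke₃ hecke₄ : ℕ → Series
hecke₁ n = (∑[ j ∈ 0 ⋯ n / 2 ] t₁ n j) + (∑[ j ∈ 1 ⋯ n / 2 ] u₁ n j)
hecke₂ n = ∑[ m ∈± n / 2 ] t₂ n m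
hecke₃ n = ∑[ m ∈± n / 3 ] t₃ n m
hecke₄ n = (∑[ m ∈ 0 ⋯ n ] t₄ n m) + (∑[ m ∈ 1 ⋯ n ] u₄ n m)

private
  ∈q^-monomial : ∀ f {k e} → k ≤ e → f * q ^ e ∈q^ k
  ∈q^-monomial f {k} {e} k≤e = ∈q^-*ˡ f (∈q^-mono k≤e (q^-∈q^ e))

  quarter : ∀ n x {y} → n / 2 ≤ y → n / 4 ≤ (x ℕ.+ y) / 2
  quarter n x {y} h = ≡.subst (_≤ (x ℕ.+ y) / 2) (m/n/o≡m/[n*o] n 2 2)
    (/-monoˡ-≤ 2 (ℕ.≤-trans h (ℕ.m≤n+m y x)))

  n/4≤n² : ∀ n → n / 4 ≤ n ℕ.* n
  n/4≤n² zero    = z≤n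
  n/4≤n² (suc n) = ℕ.≤-trans (m/n≤m (suc n) 4) (ℕ.m≤m+n (suc n) (n ℕ.* suc n))

  n/4≤n[n+1]/2 : ∀ n → n / 4 ≤ n ℕ.* suc n / 2
  n/4≤n[n+1]/2 n = ≡.subst (λ e → n / 4 ≤ e / 2)
    (≡.trans (ℕ.+-comm (n ℕ.* n) n) (≡.sym (ℕ.*-suc n n))) (quarter n (n ℕ.* n) (m/n≤m n 2))

  n/2≤n∸j : ∀ n j → j ≤ n / 2 → n / 2 ≤ n ∸ j
  n/2≤n∸j n j j≤ = ℕ.m+n≤o⇒m≤o∸n (n / 2) (ℕ.≤-trans (ℕ.+-monoʳ-≤ (n / 2) j≤)
    (≡.subst (_≤ n) (≡.trans (ℕ.*-comm (n / 2) 2) (cong (λ x → n / 2 ℕ.+ x) (ℕ.+-identityʳ (n / 2)))) (m/n*n≤m n 2)))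

  n/2≤2n∸m : ∀ n m → m ≤ n → n / 2 ≤ 2 ℕ.* n ∸ m
  n/2≤2n∸m n m m≤n = ℕ.≤-trans (m/n≤m n 2) (ℕ.m+n≤o⇒m≤o∸n n
    (ℕ.+-monoʳ-≤ n (ℕ.≤-trans m≤n (ℕ.m≤m+n n 0))))

  n/2≤n+j : ∀ n j → n / 2 ≤ n ℕ.+ j
  n/2≤n+j n j = ℕ.≤-trans (m/n≤m n 2) (ℕ.m≤m+n n j)

  n/2≤2n+m : ∀ n m → n / 2 ≤ 2 ℕ.* n ℕ.+ m
  n/2≤2n+m n m = ℕ.≤-trans (n/2≤n+j n (n ℕ.+ 0)) (ℕ.m≤m+n (2 ℕ.* n) m)

R-summable : Summable R-term
R-summable = order⇒summable R-term 4 λ n → ∈q^-*ʳ _ (∈q^-mono (n/4≤n² n) (q^-∈q^ (n ℕ.* n)))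

H-summable : Summable H-term
H-summable = order⇒summable H-term 4 λ n → ∈q^-*ʳ _ (∈q^-monomial (⟨ - 1# ⨾q^ 1 ⟩ n) (n/4≤n[n+1]/2 n))

K-summable : Summable K-term
K-summable = order⇒summable K-term 4 λ n → ∈q^-*ʳ _ (∈q^-monomial (-1^ n * ⟨ q ⨾q^ 2 ⟩ n) (n/4≤n² n))

hecke₁-summable : Summable hecke₁
hecke₁-summable = order⇒summable hecke₁ 4 λ n → ∈q^-+
  (∈q^-∑-range 0 (n / 2) (t₁ n) λ j j≤ → ∈q^-monomial _ (quarter n (n ℕ.* n ∸ 3 ℕ.* (j ℕ.* j)) (n/2≤n∸j n j j≤)))
  (∈q^-∑-range 1 (n / 2) (u₁ n) λ j j≤ → ∈q^-monomial _ (quarter n (n ℕ.* n ∸ 3 ℕ.* (j ℕ.* j)) (n/2≤n+j n j)))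

hecke₂-summable : Summable hecke₂
hecke₂-summable = order⇒summable hecke₂ 4 λ n → ∈q^-∑-symmetric (n / 2) (t₂ n) λ m →
  ∈q^-monomial _ (quarter n (n ℕ.* n ∸ 2 ℕ.* (∣ m ∣ ℕ.* ∣ m ∣)) (m/n≤m n 2))

hecke₃-summable : Summable hecke₃
hecke₃-summable = order⇒summable hecke₃ 4 λ n → ∈q^-∑-symmetric (n / 3) (t₃ n) λ m →
  ∈q^-monomial _ (quarter n (n ℕ.* n ∸ 8 ℕ.* (∣ m ∣ ℕ.* ∣ m ∣)) (m/n≤m n 2))

hecke₄-summable : Summable hecke₄
hecke₄-summable = order⇒summable hecke₄ 4 λ n → ∈q^-+
  (∈q^-∑-range 0 n (t₄ n) λ m m≤n → ∈q^-monomial _ (quarter n (2 ℕ.* (n ℕ.* n) ∸ m ℕ.* m) (n/2≤2n∸m n m m≤n)))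
  (∈q^-∑-range 1 n (u₄ n) λ m m≤n → ∈q^-monomial _ (quarter n (2 ℕ.* (n ℕ.* n) ∸ m ℕ.* m) (n/2≤2n+m n m)))

-- The universal mock theta functions R(z, q), H(z, q) and K(z, q).
R H K : Series
R = ∑∞ R-term R-summable
H = ∑∞ H-term H-summable
K = ∑∞ K-term K-summable

{-# OPTIONS --safe #-}
-- In all four identities the left-hand side is F(z) = ∑ₙ wₙ (q)∞ (zqⁿ⁺¹)∞ (z⁻¹qⁿ⁺¹)∞, up to a factor 1 + z
-- for H and with q² in place of q for K. The sum a F(zq) - b F(z) telescopes for suitable a, b, c, giving the
-- functional equation a F(zq) - b F(z) = c (q)∞ (zq)∞ (z⁻¹)∞, whose right-hand side is known by the Jacobi
-- triple product. Comparing powers of z, the coefficient of z^k in F is a power of q times the coefficient of a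
-- higher power of z, plus two explicit terms. For k ≥ 0 this recurrence has a unique solution, and iterating it
-- gives the coefficient as a single alternating series in q; negative k follow from the symmetry z ↔ z⁻¹.
-- In the Hecke-type sum the terms contributing to a fixed power of z lie on a few lines in the (n , m)-plane,
-- along which the exponent of q is the same quadratic polynomial. Identities (2) and (3) have the same left-hand
-- side and differ only in how the exponents of even and odd index are spread over these lines.

module Submission where

open import Algebra.Bundles using (CommutativeRing)
import Algebra.Properties.Ring as RingProperties
import Algebra.Properties.Semiring.Exp as Exp
import Algebra.Solver.Ring as RingSolver
open import Algebra.Solver.Ring.AlmostCommutativeRing using (fromCommutativeRing; _-Raw-AlmostCommutative⟶_)
open import Data.Bool.Base using (if_then_else_; true; false)
open import Data.Empty using (⊥-elim)
open import Data.Integer.Base as ℤ using (ℤ; +_; -[1+_]; ∣_∣)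
import Data.Integer.Properties as ℤ
import Data.Integer.Tactic.RingSolver as ℤ-Solver
open import Data.List.Base using ([]; _∷_; _++_)
open import Data.Maybe.Base using (just; nothing; Maybe)
open import Data.Nat.Base as ℕ using (ℕ; zero; suc; NonZero; _∸_; _≤_; _<_; z≤n; s≤s)
open import Data.Nat.DivMod using (_/_; /-monoˡ-≤; m*n/n≡m; m/n*n≤m; n/1≡n)
import Data.Nat.Properties as ℕ
import Data.Nat.Tactic.RingSolver as ℕ-Solver
open import Data.Product.Base using (∃; _×_; _,_; proj₁; proj₂)
open import Data.Sum.Base using (_⊎_; inj₁; inj₂)
open import Function.Base using (_∘_)
open import Relation.Binary.Bundles using (Setoid)
open import Relation.Binary.PropositionalEquality as ≡ using (_≡_; _≢_; refl; cong; cong₂; module ≡-Reasoning)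
import Relation.Binary.Reasoning.Setoid as SetoidReasoning
open import Relation.Nullary.Decidable using (Dec; does; yes; no; dec-true; dec-false)
open import Defs

-- The coefficients a, b, c are forced. In each case the ratio of consecutive weights is a
-- polynomial in y = Q^n without constant term and with quadratic term Q y², the quadratic term of
-- (1 - z⁻¹ y)(1 - z Q y). The difference of the two is therefore linear in y, and writing it as a
-- combination of 1 - z⁻¹ y and 1 - z Q y determines a : b : c. The obstacle is that z ↦ zq does not
-- act on the ring: it sends z⁻¹ to z⁻¹ q⁻¹. It is therefore a relation between two given series,
-- stated coefficient by coefficient, and has to be established for every product to which it is
-- applied. A functional equation under z ↦ zQ fixes a theta function only up to a factor free of z.
-- For the triple product this factor is found from a finite version, whose constant term in z is a
-- central Gaussian binomial coefficient. For F no such freedom is left, since each step of its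
-- recurrence strictly lowers the index of q.

private
  module L = LaurentPolynomial
  module R = CommutativeRing ℤ[z,z⁻¹]
  module S where
    open CommutativeRing ring⟦q⟧ public
    open RingProperties ring public using (-‿distribˡ-*; -0#≈0#; -1*x≈-x)
    open Exp semiring public using (^-homo-*; ^-assocʳ)
  open S using (_-_; 0#)
  module ≈-Reasoning = SetoidReasoning S.setoid

-- Integer coefficients for the ring solver on series

module RingCoefficients where

  constant : ℤ → Series
  constant c = const ((c , ℤ.0ℤ) ∷ [])

  constant-+ : ∀ c d → constant (c ℤ.+ d) ≈ constant c + constant d
  constant-+ c d = mk≈ λ { zero → L.mk≈ lemma ; (suc n) → L.mk≈ λ k → refl }
    where
    lemma : ∀ k → L.coeff ((c ℤ.+ d , ℤ.0ℤ) ∷ []) k ≡ L.coeff ((c , ℤ.0ℤ) ∷ (d , ℤ.0ℤ) ∷ []) k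
    lemma k with does (ℤ.0ℤ ℤ.≟ k)
    ... | true  = ℤ.+-assoc c d ℤ.0ℤ
    ... | false = refl

  constant-0 : constant ℤ.0ℤ ≈ 0#
  constant-0 = mk≈ λ { zero → L.mk≈ lemma ; (suc n) → L.mk≈ λ k → refl }
    where
    lemma : ∀ k → L.coeff ((ℤ.0ℤ , ℤ.0ℤ) ∷ []) k ≡ ℤ.0ℤ
    lemma k with does (ℤ.0ℤ ℤ.≟ k)
    ... | true  = refl
    ... | false = refl

  constant-- : ∀ c → constant (ℤ.- c) ≈ - constant c
  constant-- c = mk≈ λ { zero → L.mk≈ λ k → refl ; (suc n) → L.mk≈ λ k → refl }

  zeros : ∀ f n → coeff (0# * f) n L.≈ []
  zeros f n = at (S.zeroˡ f) n

  const-* : ∀ a f n → coeff (const a * f) n L.≈ a L.* coeff f n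
  const-* a f zero    = L.mk≈ λ k → cong (λ p → L.coeff p k) (++-[] (a L.* coeff f 0))
    where
    ++-[] : ∀ p → p ++ [] ≡ p
    ++-[] []      = refl
    ++-[] (t ∷ p) = cong (t ∷_) (++-[] p)
  const-* a f (suc n) = L.mk≈ λ k → ≡.trans
    (L.coeff≡ (R.+-congˡ {a L.* coeff f (suc n)} (zeros f n)) k)
    (L.coeff≡ (R.+-identityʳ (a L.* coeff f (suc n))) k)

  constant-* : ∀ c d → constant (c ℤ.* d) ≈ constant c * constant d
  constant-* c d = mk≈ λ
    { zero    → L.mk≈ λ k → refl
    ; (suc n) → L.mk≈ λ k → ≡.sym (L.coeff≡ (const-* ((c , ℤ.0ℤ) ∷ []) (constant d) (suc n)) k)
    }

  morphism : ℤ.+-*-rawRing -Raw-AlmostCommutative⟶ fromCommutativeRing ring⟦q⟧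
  morphism = record
    { ⟦_⟧    = constant
    ; +-homo = constant-+
    ; *-homo = constant-*
    ; -‿homo = constant--
    ; 0-homo = constant-0
    ; 1-homo = S.refl
    }

  _≟_ : ∀ c d → Maybe (constant c ≈ constant d)
  c ≟ d with c ℤ.≟ d
  ... | yes refl = just S.refl
  ... | no  _    = nothing

private module Ring = RingSolver ℤ.+-*-rawRing (fromCommutativeRing ring⟦q⟧) RingCoefficients.morphism RingCoefficients._≟_
open Ring using (solve; _:=_; con) renaming (_:+_ to _⊕_; _:*_ to _⊛_; _:-_ to _⊖_; :-_ to ⊝_)

-- Coefficients of z^k q^N

L-coeff-++ : ∀ p p′ k → L.coeff (p ++ p′) k ≡ L.coeff p k ℤ.+ L.coeff p′ k
L-coeff-++ []            p′ k = ≡.sym (ℤ.+-identityˡ _)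
L-coeff-++ ((c , e) ∷ p) p′ k = ≡.trans
  (cong (λ x → δ ℤ.+ x) (L-coeff-++ p p′ k)) (≡.sym (ℤ.+-assoc δ (L.coeff p k) (L.coeff p′ k)))
  where δ = if does (e ℤ.≟ k) then c else ℤ.0ℤ

L-coeff-neg : ∀ p k → L.coeff (L.neg p) k ≡ ℤ.- L.coeff p k
L-coeff-neg []            k = refl
L-coeff-neg ((c , e) ∷ p) k with does (e ℤ.≟ k)
... | true  = ≡.trans (cong (λ x → ℤ.- c ℤ.+ x) (L-coeff-neg p k)) (≡.sym (ℤ.neg-distrib-+ c (L.coeff p k)))
... | false = ≡.trans (cong (λ x → ℤ.0ℤ ℤ.+ x) (L-coeff-neg p k)) (≡.sym (ℤ.neg-distrib-+ ℤ.0ℤ (L.coeff p k)))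

L-coeff-shift : ∀ j p k → L.coeff (L.scale (ℤ.1ℤ , j) p) k ≡ L.coeff p (k ℤ.- j)
L-coeff-shift j []            k = refl
L-coeff-shift j ((c , e) ∷ p) k = cong₂ ℤ._+_ head (L-coeff-shift j p k)
  where
  head : (if does (j ℤ.+ e ℤ.≟ k) then ℤ.1ℤ ℤ.* c else ℤ.0ℤ) ≡ (if does (e ℤ.≟ k ℤ.- j) then c else ℤ.0ℤ)
  head with e ℤ.≟ k ℤ.- j
  ... | yes refl = ≡.trans
    (cong (λ b → if b then ℤ.1ℤ ℤ.* c else ℤ.0ℤ) (dec-true (j ℤ.+ (k ℤ.- j) ℤ.≟ k) (cancel j k)))
    (ℤ.*-identityˡ c)
    where
    cancel : ∀ j k → j ℤ.+ (k ℤ.- j) ≡ k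
    cancel = ℤ-Solver.solve-∀
  ... | no e≢ = cong (λ b → if b then ℤ.1ℤ ℤ.* c else ℤ.0ℤ)
    (dec-false (j ℤ.+ e ℤ.≟ k) λ { refl → e≢ (cancel j e) })
    where
    cancel : ∀ j e → e ≡ j ℤ.+ e ℤ.- j
    cancel = ℤ-Solver.solve-∀

-- cf f k N is the coefficient of z^k q^N; it is defined for all integers N so that
-- multiplication by q and the substitution z ↦ zq are shifts of the index.
cf : Series → ℤ → ℤ → ℤ
cf f k (+ n)    = L.coeff (coeff f n) k
cf f k -[1+ _ ] = ℤ.0ℤ

cf-cong : ∀ {f g} → f ≈ g → ∀ k N → cf f k N ≡ cf g k N
cf-cong f≈g k (+ n)    = L.coeff≡ (at f≈g n) k
cf-cong f≈g k -[1+ _ ] = refl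

cf-ext : ∀ {f g} → (∀ k n → cf f k (+ n) ≡ cf g k (+ n)) → f ≈ g
cf-ext h = mk≈ λ n → L.mk≈ λ k → h k n

cf-0 : ∀ k N → cf 0# k N ≡ ℤ.0ℤ
cf-0 k (+ n)    = refl
cf-0 k -[1+ _ ] = refl

cf-+ : ∀ f g k N → cf (f + g) k N ≡ cf f k N ℤ.+ cf g k N
cf-+ f g k (+ n)    = L-coeff-++ (coeff f n) (coeff g n) k
cf-+ f g k -[1+ _ ] = refl

cf-neg : ∀ f k N → cf (- f) k N ≡ ℤ.- cf f k N
cf-neg f k (+ n)    = L-coeff-neg (coeff f n) k
cf-neg f k -[1+ _ ] = refl

cf-z : ∀ j f k N → cf (z^ j * f) k N ≡ cf f (k ℤ.- j) N
cf-z j f k (+ n) = ≡.trans (L.coeff≡ (RingCoefficients.const-* ((ℤ.1ℤ , j) ∷ []) f n) k)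
  (≡.trans (L-coeff-++ (L.scale (ℤ.1ℤ , j) (coeff f n)) [] k)
  (≡.trans (ℤ.+-identityʳ _) (L-coeff-shift j (coeff f n) k)))
cf-z j f k -[1+ _ ] = refl

cf-q : ∀ f k N → cf (q * f) k N ≡ cf f k (N ℤ.- + 1)
cf-q f k (+ zero)  = refl
cf-q f k (+ suc n) = L.coeff≡ (at (S.trans (S.*-congʳ {f} tail≈1) (S.*-identityˡ f)) n) k
  where
  tail : Series
  coeff tail n = coeff q (suc n)
  tail≈1 : tail ≈ 1#
  tail≈1 = mk≈ λ { zero → L.mk≈ λ k → refl ; (suc n) → L.mk≈ λ k → refl }
cf-q f k -[1+ _ ]  = refl

cf-- : ∀ f g k N → cf (f - g) k N ≡ cf f k N ℤ.- cf g k N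
cf-- f g k N = ≡.trans (cf-+ f (- g) k N) (cong (λ x → cf f k N ℤ.+ x) (cf-neg g k N))

cf-q^ : ∀ m f k N → cf (q ^ m * f) k N ≡ cf f k (N ℤ.- + m)
cf-q^ zero    f k N = ≡.trans (cf-cong (S.*-identityˡ f) k N) (cong (cf f k) (≡.sym (ℤ.+-identityʳ N)))
cf-q^ (suc m) f k N = ≡.trans (cf-cong (S.*-assoc q (q ^ m) f) k N) (≡.trans (cf-q (q ^ m * f) k N)
  (≡.trans (cf-q^ m f k (N ℤ.- + 1)) (cong (cf f k) (shift N (+ m)))))
  where
  shift : ∀ N m → N ℤ.- + 1 ℤ.- m ≡ N ℤ.- (+ 1 ℤ.+ m)
  shift = ℤ-Solver.solve-∀

-- Limits in the q-adic topology

cf-lim : ∀ {s f} → s ⟶ f → ∀ k N → ∃ λ M → ∀ n → M ≤ n → cf (s n) k N ≡ cf f k N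
cf-lim s⟶f k (+ N)    = proj₁ (s⟶f N) , λ n M≤n → L.coeff≡ (proj₂ (s⟶f N) n M≤n) k
cf-lim s⟶f k -[1+ _ ] = 0 , λ _ _ → refl

cf-lim-unique : ∀ {s f k N c} M → s ⟶ f → (∀ n → M ≤ n → cf (s n) k N ≡ c) → cf f k N ≡ c
cf-lim-unique {s} {f} {k} {N} M s⟶f h with cf-lim {s} {f} s⟶f k N
... | M′ , h′ = ≡.trans (≡.sym (h′ (M ℕ.⊔ M′) (ℕ.m≤n⊔m M M′))) (h (M ℕ.⊔ M′) (ℕ.m≤m⊔n M M′))

-- Convergence provides a threshold for each single coefficient. The maximum of the first N
-- thresholds makes the whole difference divisible by q^N, and in this form limits of sums and
-- products become arithmetic of ideals.
⟶⇒∈q^ : ∀ {s f} → s ⟶ f → ∀ N → ∃ λ M → ∀ n → M ≤ n → s n - f ∈q^ N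
⟶⇒∈q^ s⟶f zero = 0 , λ n _ → mk∈ λ i ()
⟶⇒∈q^ {s} {f} s⟶f (suc N) with ⟶⇒∈q^ {s} {f} s⟶f N | s⟶f N
... | M , h | M′ , h′ = M ℕ.⊔ M′ , λ n le → mk∈ λ i i<1+N →
  go n (h n (ℕ.≤-trans (ℕ.m≤m⊔n M M′) le)) (h′ n (ℕ.≤-trans (ℕ.m≤n⊔m M M′) le)) i (ℕ.m≤n⇒m<n∨m≡n (ℕ.≤-pred i<1+N))
  where
  go : ∀ n → s n - f ∈q^ N → coeff (s n) N R.≈ coeff f N →
       ∀ i → i < N ⊎ i ≡ N → coeff (s n - f) i R.≈ R.0#
  go n h e i (inj₁ i<N)  = vanish h i i<N
  go n h e i (inj₂ refl) = R.trans (R.+-congʳ { R.- coeff f N} e) (R.-‿inverseʳ (coeff f N))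

∈q^⇒⟶ : ∀ {s f} → (∀ N → ∃ λ M → ∀ n → M ≤ n → s n - f ∈q^ N) → s ⟶ f
-- Divisibility by q^(N+1), not only by q^N, is what reaches the coefficient of q^N.
∈q^⇒⟶ {s} {f} h N with h (suc N)
... | M , h′ = M , λ n M≤n → RingProperties.x∙y⁻¹≈ε⇒x≈y (CommutativeRing.ring ℤ[z,z⁻¹]) _ _ (vanish (h′ n M≤n) N ℕ.≤-refl)

⟶-const : ∀ f → (λ _ → f) ⟶ f
⟶-const f N = 0 , λ _ _ → R.refl

⟶-cong : ∀ {s t f} → (∀ n → s n ≈ t n) → s ⟶ f → t ⟶ f
⟶-cong s≈t s⟶f N = proj₁ (s⟶f N) , λ n M≤n → R.trans (R.sym (at (s≈t n) N)) (proj₂ (s⟶f N) n M≤n)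

⟶-congʳ : ∀ {s f g} → f ≈ g → s ⟶ f → s ⟶ g
⟶-congʳ f≈g s⟶f N = proj₁ (s⟶f N) , λ n M≤n → R.trans (proj₂ (s⟶f N) n M≤n) (at f≈g N)

⟶-subsequence : ∀ {s f} (φ : ℕ → ℕ) → (∀ n → n ≤ φ n) → s ⟶ f → s ∘ φ ⟶ f
⟶-subsequence φ n≤φn s⟶f N = proj₁ (s⟶f N) , λ n M≤n → proj₂ (s⟶f N) (φ n) (ℕ.≤-trans M≤n (n≤φn n))

∈q^⇒⟶0 : ∀ {s} → (∀ n → s n ∈q^ n) → s ⟶ 0#
∈q^⇒⟶0 h N = suc N , λ n N<n → vanish (h n) N N<n

private
  both : ∀ {s t f g} → s ⟶ f → t ⟶ g → ∀ N → ∃ λ M → ∀ n → M ≤ n → s n - f ∈q^ N × t n - g ∈q^ N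
  both {s} {t} {f} {g} s⟶f t⟶g N with ⟶⇒∈q^ {s} {f} s⟶f N | ⟶⇒∈q^ {t} {g} t⟶g N
  ... | M , h | M′ , h′ = M ℕ.⊔ M′ , λ n le →
    h n (ℕ.≤-trans (ℕ.m≤m⊔n M M′) le) , h′ n (ℕ.≤-trans (ℕ.m≤n⊔m M M′) le)

⟶-+ : ∀ {s t f g} → s ⟶ f → t ⟶ g → (λ n → s n + t n) ⟶ f + g
⟶-+ {s} {t} {f} {g} s⟶f t⟶g = ∈q^⇒⟶ λ N → proj₁ (both {s} {t} {f} {g} s⟶f t⟶g N) , λ n M≤n →
  let (h , h′) = proj₂ (both {s} {t} {f} {g} s⟶f t⟶g N) n M≤n
  in ∈q^-resp (regroup (s n) (t n) f g) (∈q^-+ h h′)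
  where
  regroup : ∀ a b c d → (a - c) + (b - d) ≈ (a + b) - (c + d)
  regroup = solve 4 (λ a b c d → (a ⊖ c) ⊕ (b ⊖ d) := (a ⊕ b) ⊖ (c ⊕ d)) S.refl

⟶-* : ∀ {s t f g} → s ⟶ f → t ⟶ g → (λ n → s n * t n) ⟶ f * g
⟶-* {s} {t} {f} {g} s⟶f t⟶g = ∈q^⇒⟶ λ N → proj₁ (both {s} {t} {f} {g} s⟶f t⟶g N) , λ n M≤n →
  let (h , h′) = proj₂ (both {s} {t} {f} {g} s⟶f t⟶g N) n M≤n
  in ∈q^-resp (regroup (s n) (t n) f g) (∈q^-+ (∈q^-*ʳ (t n) h) (∈q^-*ˡ f h′))
  where
  regroup : ∀ a b c d → (a - c) * b + c * (b - d) ≈ a * b - c * d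
  regroup = solve 4 (λ a b c d → (a ⊖ c) ⊛ b ⊕ c ⊛ (b ⊖ d) := a ⊛ b ⊖ c ⊛ d) S.refl

⟶-*ˡ : ∀ f {s g} → s ⟶ g → (λ n → f * s n) ⟶ f * g
⟶-*ˡ f {s} {g} = ⟶-* {λ _ → f} {s} {f} {g} (⟶-const f)

⟶-neg : ∀ {s f} → s ⟶ f → (λ n → - s n) ⟶ - f
⟶-neg s⟶f N = proj₁ (s⟶f N) , λ n M≤n → R.-‿cong (proj₂ (s⟶f N) n M≤n)

-- Partial sums and q-Pochhammer symbols

partialSum-suc : ∀ f n → partialSum f (suc n) ≈ partialSum f n + f n
partialSum-suc f n = sum-snoc S.+-monoid f n

*-partialSum : ∀ g f n → g * partialSum f n ≈ partialSum (λ i → g * f i) n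
*-partialSum g f zero    = S.zeroʳ g
*-partialSum g f (suc n) = S.trans (S.distribˡ g (f 0) (partialSum (f ∘ suc) n))
  (S.+-congˡ {g * f 0} (*-partialSum g (f ∘ suc) n))

partialSum-cong : ∀ {f g} n → (∀ i → f i ≈ g i) → partialSum f n ≈ partialSum g n
partialSum-cong zero    h = S.refl
partialSum-cong (suc n) h = S.+-cong (h 0) (partialSum-cong n (h ∘ suc))

^-∣* : ∀ x d m n → (x ^ d) ^ m * (x ^ d) ^ n ≈ x ^ (d ℕ.* (m ℕ.+ n))
^-∣* x d m n = S.trans (S.sym (S.^-homo-* (x ^ d) m n)) (S.^-assocʳ x d (m ℕ.+ n))

pochhammer-suc : ∀ x d n → ⟨ x ⨾q^ d ⟩ (suc n) ≈ ⟨ x ⨾q^ d ⟩ n * (1# - x * (q ^ d) ^ n)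
pochhammer-suc x d n = sum-snoc S.*-monoid (λ k → 1# - x * (q ^ d) ^ k) n

pochhammer-cong : ∀ {x y} d n → x ≈ y → ⟨ x ⨾q^ d ⟩ n ≈ ⟨ y ⨾q^ d ⟩ n
pochhammer-cong         d zero    x≈y = S.refl
pochhammer-cong {x} {y} d (suc n) x≈y = begin
  ⟨ x ⨾q^ d ⟩ (suc n)                       ≈⟨ pochhammer-suc x d n ⟩
  ⟨ x ⨾q^ d ⟩ n * (1# - x * (q ^ d) ^ n)    ≈⟨ S.*-cong (pochhammer-cong d n x≈y) (S.+-congˡ {1#} (S.-‿cong (S.*-congʳ {(q ^ d) ^ n} x≈y))) ⟩
  ⟨ y ⨾q^ d ⟩ n * (1# - y * (q ^ d) ^ n)    ≈⟨ pochhammer-suc y d n ⟨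
  ⟨ y ⨾q^ d ⟩ (suc n)                       ∎
  where open ≈-Reasoning

pochhammer-sucˡ : ∀ x d n → ⟨ x ⨾q^ d ⟩ (suc n) ≈ (1# - x) * ⟨ x * q ^ d ⨾q^ d ⟩ n
pochhammer-sucˡ x d zero    = S.*-congʳ {1#} (S.+-congˡ {1#} (S.-‿cong (S.*-identityʳ x)))
pochhammer-sucˡ x d (suc n) = begin
  ⟨ x ⨾q^ d ⟩ (suc (suc n))                                          ≈⟨ pochhammer-suc x d (suc n) ⟩
  ⟨ x ⨾q^ d ⟩ (suc n) * (1# - x * (q ^ d * (q ^ d) ^ n))             ≈⟨ S.*-cong (pochhammer-sucˡ x d n) (S.+-congˡ {1#} (S.-‿cong (S.sym (S.*-assoc x (q ^ d) ((q ^ d) ^ n))))) ⟩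
  (1# - x) * ⟨ x * q ^ d ⨾q^ d ⟩ n * (1# - x * q ^ d * (q ^ d) ^ n)  ≈⟨ S.*-assoc (1# - x) (⟨ x * q ^ d ⨾q^ d ⟩ n) (1# - x * q ^ d * (q ^ d) ^ n) ⟩
  (1# - x) * (⟨ x * q ^ d ⨾q^ d ⟩ n * (1# - x * q ^ d * (q ^ d) ^ n)) ≈⟨ S.*-congˡ {1# - x} (pochhammer-suc (x * q ^ d) d n) ⟨
  (1# - x) * ⟨ x * q ^ d ⨾q^ d ⟩ (suc n)                             ∎
  where open ≈-Reasoning

pochhammer⟶ : ∀ x d .{{_ : NonZero d}} → ⟨ x ⨾q^ d ⟩_ ⟶ ⟨ x ⨾q^ d ⟩∞
pochhammer⟶ x d = proj₂ (pochhammer-convergent x d)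

∞-cong : ∀ {x y} d .{{_ : NonZero d}} → x ≈ y → ⟨ x ⨾q^ d ⟩∞ ≈ ⟨ y ⨾q^ d ⟩∞
∞-cong {x} {y} d x≈y = lim-unique {⟨ y ⨾q^ d ⟩_}
  (⟶-cong {⟨ x ⨾q^ d ⟩_} {⟨ y ⨾q^ d ⟩_} {⟨ x ⨾q^ d ⟩∞} (λ n → pochhammer-cong d n x≈y) (pochhammer⟶ x d))
  (pochhammer⟶ y d)

∞-suc : ∀ x d .{{_ : NonZero d}} → ⟨ x ⨾q^ d ⟩∞ ≈ (1# - x) * ⟨ x * q ^ d ⨾q^ d ⟩∞
∞-suc x d = lim-unique {λ n → ⟨ x ⨾q^ d ⟩ (suc n)}
  (⟶-subsequence {⟨ x ⨾q^ d ⟩_} {⟨ x ⨾q^ d ⟩∞} suc ℕ.n≤1+n (pochhammer⟶ x d))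
  (⟶-cong {λ n → (1# - x) * ⟨ x * q ^ d ⨾q^ d ⟩ n} {λ n → ⟨ x ⨾q^ d ⟩ (suc n)} {(1# - x) * ⟨ x * q ^ d ⨾q^ d ⟩∞}
    (λ n → S.sym (pochhammer-sucˡ x d n))
    (⟶-*ˡ (1# - x) {⟨ x * q ^ d ⨾q^ d ⟩_} {⟨ x * q ^ d ⨾q^ d ⟩∞} (pochhammer⟶ (x * q ^ d) d)))

-- Rows, series free of z, and substitutions for z

-- As series in q, the coefficient of z^k′ in `g` is q^e times the coefficient of z^k in `f`. The
-- exponent `e` may be negative; this is why `cf` is defined at all integers.
Row : Series → ℤ → Series → ℤ → ℤ → Set
Row f k g k′ e = ∀ N → cf f k N ≡ cf g k′ (N ℤ.+ e)

Row-resp : ∀ {f f′ g g′ k k′ e} → f ≈ f′ → g ≈ g′ → Row f k g k′ e → Row f′ k g′ k′ e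
Row-resp {k = k} {k′} {e} f≈ g≈ h N = ≡.trans (≡.sym (cf-cong f≈ k N)) (≡.trans (h N) (cf-cong g≈ k′ (N ℤ.+ e)))

Row-+ : ∀ f₁ f₂ g₁ g₂ k k′ e → Row f₁ k g₁ k′ e → Row f₂ k g₂ k′ e → Row (f₁ + f₂) k (g₁ + g₂) k′ e
Row-+ f₁ f₂ g₁ g₂ k k′ e h₁ h₂ N = ≡.trans (cf-+ f₁ f₂ k N)
  (≡.trans (cong₂ ℤ._+_ (h₁ N) (h₂ N)) (≡.sym (cf-+ g₁ g₂ k′ (N ℤ.+ e))))

Row-neg : ∀ f g k k′ e → Row f k g k′ e → Row (- f) k (- g) k′ e
Row-neg f g k k′ e h N = ≡.trans (cf-neg f k N) (≡.trans (cong ℤ.-_ (h N)) (≡.sym (cf-neg g k′ (N ℤ.+ e))))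

Row-lim : ∀ {s t f g} k k′ e → s ⟶ f → t ⟶ g → (∀ n → Row (s n) k (t n) k′ e) → Row f k g k′ e
Row-lim {s} {t} {f} {g} k k′ e s⟶f t⟶g h N with cf-lim {t} {g} t⟶g k′ (N ℤ.+ e)
... | M , h′ = cf-lim-unique {s} {f} {k} {N} M s⟶f λ n M≤n → ≡.trans (h n N) (h′ n M≤n)

Row-q^ : ∀ m f g k k′ e → Row f k g k′ e → Row (q ^ m * f) k (q ^ m * g) k′ e
Row-q^ m f g k k′ e h N = ≡.trans (cf-q^ m f k N) (≡.trans (h (N ℤ.- + m))
  (≡.trans (cong (cf g k′) (shift N (+ m) e)) (≡.sym (cf-q^ m g k′ (N ℤ.+ e)))))
  where
  shift : ∀ N m e → N ℤ.- m ℤ.+ e ≡ N ℤ.+ e ℤ.- m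
  shift = ℤ-Solver.solve-∀

-- The series that do not involve z, characterised by how they act on rows.
record ZFree (w : Series) : Set where
  constructor mkZFree
  field act : ∀ f g k k′ e → Row f k g k′ e → Row (w * f) k (w * g) k′ e
open ZFree public

zfree-resp : ∀ {w w′} → w ≈ w′ → ZFree w → ZFree w′
zfree-resp w≈ h = mkZFree λ f g k k′ e r → Row-resp (S.*-congʳ {f} w≈) (S.*-congʳ {g} w≈) (act h f g k k′ e r)

zfree-q^ : ∀ m → ZFree (q ^ m)
zfree-q^ m = mkZFree (Row-q^ m)

zfree-1 : ZFree 1#
zfree-1 = zfree-q^ 0

zfree-neg : ∀ {w} → ZFree w → ZFree (- w)
zfree-neg {w} h = mkZFree λ f g k k′ e r → Row-resp (S.-‿distribˡ-* w f) (S.-‿distribˡ-* w g)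
  (Row-neg (w * f) (w * g) k k′ e (act h f g k k′ e r))

zfree-+ : ∀ {v w} → ZFree v → ZFree w → ZFree (v + w)
zfree-+ {v} {w} h h′ = mkZFree λ f g k k′ e r → Row-resp (S.sym (S.distribʳ f v w)) (S.sym (S.distribʳ g v w))
  (Row-+ (v * f) (w * f) (v * g) (w * g) k k′ e (act h f g k k′ e r) (act h′ f g k k′ e r))

zfree-* : ∀ {v w} → ZFree v → ZFree w → ZFree (v * w)
zfree-* {v} {w} h h′ = mkZFree λ f g k k′ e r → Row-resp (S.sym (S.*-assoc v w f)) (S.sym (S.*-assoc v w g))
  (act h (w * f) (w * g) k k′ e (act h′ f g k k′ e r))

zfree-^ : ∀ {w} → ZFree w → ∀ n → ZFree (w ^ n)
zfree-^ h zero    = zfree-1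
zfree-^ h (suc n) = zfree-* h (zfree-^ h n)

zfree-0 : ZFree 0#
zfree-0 = zfree-resp (S.-‿inverseʳ 1#) (zfree-+ zfree-1 (zfree-neg zfree-1))

zfree-lim : ∀ {s w} → s ⟶ w → (∀ n → ZFree (s n)) → ZFree w
zfree-lim {s} {w} s⟶w h = mkZFree λ f g k k′ e r →
  Row-lim {λ n → s n * f} {λ n → s n * g} {w * f} {w * g} k k′ e
    (⟶-* {s} {λ _ → f} {w} {f} s⟶w (⟶-const f)) (⟶-* {s} {λ _ → g} {w} {g} s⟶w (⟶-const g))
    (λ n → act (h n) f g k k′ e r)

zfree-partialSum : ∀ {f} → (∀ i → ZFree (f i)) → ∀ n → ZFree (partialSum f n)
zfree-partialSum h zero    = zfree-0
zfree-partialSum h (suc n) = zfree-+ (h 0) (zfree-partialSum (h ∘ suc) n)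

zfree-pochhammer : ∀ {x} d n → ZFree x → ZFree (⟨ x ⨾q^ d ⟩ n)
zfree-pochhammer     d zero    h = zfree-1
zfree-pochhammer {x} d (suc n) h = zfree-resp (S.sym (pochhammer-suc x d n))
  (zfree-* (zfree-pochhammer d n h) (zfree-+ zfree-1 (zfree-neg (zfree-* h (zfree-^ (zfree-q^ d) n)))))

zfree-∞ : ∀ {x} d .{{_ : NonZero d}} → ZFree x → ZFree ⟨ x ⨾q^ d ⟩∞
zfree-∞ {x} d h = zfree-lim {⟨ x ⨾q^ d ⟩_} (pochhammer⟶ x d) λ n → zfree-pochhammer d n h

zfree-inverse : ∀ f f0 → ZFree f → ZFree (inverse f f0)
zfree-inverse f f0 h = zfree-lim {partialSum (λ k → (1# - f) ^ k)} (proj₂ (powers-summable (1# - f) (1-unit f f0)))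
  (zfree-partialSum (zfree-^ (zfree-+ zfree-1 (zfree-neg h))))

-- Substitution a c f g: g is obtained from f by z ↦ z^a q^c.
record Substitution (a c : ℤ) (f g : Series) : Set where
  constructor mkSubstitution
  field row : ∀ k → Row f k g (a ℤ.* k) (c ℤ.* k)
open Substitution public

module _ {a c : ℤ} where

  subst-resp : ∀ {f f′ g g′} → f ≈ f′ → g ≈ g′ → Substitution a c f g → Substitution a c f′ g′
  subst-resp f≈ g≈ h = mkSubstitution λ k → Row-resp f≈ g≈ (row h k)

  subst-+ : ∀ {f₁ f₂ g₁ g₂} → Substitution a c f₁ g₁ → Substitution a c f₂ g₂ → Substitution a c (f₁ + f₂) (g₁ + g₂)
  subst-+ {f₁} {f₂} {g₁} {g₂} h₁ h₂ = mkSubstitution λ k →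
    Row-+ f₁ f₂ g₁ g₂ k (a ℤ.* k) (c ℤ.* k) (row h₁ k) (row h₂ k)

  subst-neg : ∀ {f g} → Substitution a c f g → Substitution a c (- f) (- g)
  subst-neg {f} {g} h = mkSubstitution λ k → Row-neg f g k (a ℤ.* k) (c ℤ.* k) (row h k)

  subst-zfree : ∀ {w f g} → ZFree w → Substitution a c f g → Substitution a c (w * f) (w * g)
  subst-zfree {w} {f} {g} w-free h = mkSubstitution λ k → act w-free f g k (a ℤ.* k) (c ℤ.* k) (row h k)

  subst-lim : ∀ {s t f g} → s ⟶ f → t ⟶ g → (∀ n → Substitution a c (s n) (t n)) → Substitution a c f g
  subst-lim {s} {t} {f} {g} s⟶f t⟶g h = mkSubstitution λ k →
    Row-lim {s} {t} {f} {g} k (a ℤ.* k) (c ℤ.* k) s⟶f t⟶g λ n → row (h n) k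

  subst-partialSum : ∀ {f g} → (∀ i → Substitution a c (f i) (g i)) → ∀ n → Substitution a c (partialSum f n) (partialSum g n)
  subst-partialSum h zero    = mkSubstitution λ k N → ≡.trans (cf-0 k N) (≡.sym (cf-0 (a ℤ.* k) (N ℤ.+ c ℤ.* k)))
  subst-partialSum h (suc n) = subst-+ (h 0) (subst-partialSum (h ∘ suc) n)

  -- The monomial z^j q^e becomes z^(aj) q^(e+cj). The new power of q must again be a natural
  -- number, so `e′` is given together with the equation it satisfies.
  subst-monomial : ∀ {f g} j e e′ → + e′ ≡ + e ℤ.+ c ℤ.* j → Substitution a c f g →
                   Substitution a c (z^ j * (q ^ e * f)) (z^ (a ℤ.* j) * (q ^ e′ * g))
  subst-monomial {f} {g} j e e′ e′≡ h = mkSubstitution λ k N → begin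
    cf (z^ j * (q ^ e * f)) k N
      ≡⟨ ≡.trans (cf-z j (q ^ e * f) k N) (cf-q^ e f (k ℤ.- j) N) ⟩
    cf f (k ℤ.- j) (N ℤ.- + e)
      ≡⟨ row h (k ℤ.- j) (N ℤ.- + e) ⟩
    cf g (a ℤ.* (k ℤ.- j)) (N ℤ.- + e ℤ.+ c ℤ.* (k ℤ.- j))
      ≡⟨ cong₂ (cf g) (shift a k j) (≡.trans (shift′ N (+ e) c k j) (cong (λ x → N ℤ.+ c ℤ.* k ℤ.- x) (≡.sym e′≡))) ⟩
    cf g (a ℤ.* k ℤ.- a ℤ.* j) (N ℤ.+ c ℤ.* k ℤ.- + e′)
      ≡⟨ ≡.trans (cf-z (a ℤ.* j) (q ^ e′ * g) (a ℤ.* k) (N ℤ.+ c ℤ.* k)) (cf-q^ e′ g (a ℤ.* k ℤ.- a ℤ.* j) (N ℤ.+ c ℤ.* k)) ⟨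
    cf (z^ (a ℤ.* j) * (q ^ e′ * g)) (a ℤ.* k) (N ℤ.+ c ℤ.* k) ∎
    where
    open ≡-Reasoning
    shift : ∀ a k j → a ℤ.* (k ℤ.- j) ≡ a ℤ.* k ℤ.- a ℤ.* j
    shift = ℤ-Solver.solve-∀
    shift′ : ∀ N e c k j → N ℤ.- e ℤ.+ c ℤ.* (k ℤ.- j) ≡ N ℤ.+ c ℤ.* k ℤ.- (e ℤ.+ c ℤ.* j)
    shift′ = ℤ-Solver.solve-∀

  module _ (d : ℕ) (j : ℤ) (m m′ : ℕ) (m′≡ : + (d ℕ.* m′) ≡ + (d ℕ.* m) ℤ.+ c ℤ.* j) where

    private
      factor : ∀ j m n f → f - z^ j * (q ^ (d ℕ.* (m ℕ.+ n)) * f) ≈ (1# - z^ j * (q ^ d) ^ m * (q ^ d) ^ n) * f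
      factor j m n f = S.trans (S.+-congˡ {f} (S.-‿cong (S.*-congˡ {z^ j} (S.*-congʳ {f} (S.sym (^-∣* q d m n))))))
        (solve 4 (λ z Q Q′ f → f ⊖ z ⊛ (Q ⊛ Q′ ⊛ f) := (con (+ 1) ⊖ z ⊛ Q ⊛ Q′) ⊛ f) S.refl (z^ j) ((q ^ d) ^ m) ((q ^ d) ^ n) f)

    -- The arbitrary series `f` and `g` behind the product let the induction push the last factor
    -- into them. One such factor is a difference of two monomials, which `subst-monomial` covers.
    subst-pochhammer : ∀ n {f g} → Substitution a c f g →
      Substitution a c (⟨ z^ j * (q ^ d) ^ m ⨾q^ d ⟩ n * f) (⟨ z^ (a ℤ.* j) * (q ^ d) ^ m′ ⨾q^ d ⟩ n * g)
    subst-pochhammer zero    {f} {g} h = subst-resp (S.sym (S.*-identityˡ f)) (S.sym (S.*-identityˡ g)) h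
    subst-pochhammer (suc n) {f} {g} h = subst-resp (regroup (z^ j * (q ^ d) ^ m) f) (regroup (z^ (a ℤ.* j) * (q ^ d) ^ m′) g)
      (subst-pochhammer n (subst-resp (factor j m n f) (factor (a ℤ.* j) m′ n g)
        (subst-+ h (subst-neg (subst-monomial j (d ℕ.* (m ℕ.+ n)) (d ℕ.* (m′ ℕ.+ n)) exponent h)))))
      where
      regroup : ∀ x f → ⟨ x ⨾q^ d ⟩ n * ((1# - x * (q ^ d) ^ n) * f) ≈ ⟨ x ⨾q^ d ⟩ (suc n) * f
      regroup x f = S.trans (S.sym (S.*-assoc (⟨ x ⨾q^ d ⟩ n) (1# - x * (q ^ d) ^ n) f))
        (S.*-congʳ {f} (S.sym (pochhammer-suc x d n)))
      exponent : + (d ℕ.* (m′ ℕ.+ n)) ≡ + (d ℕ.* (m ℕ.+ n)) ℤ.+ c ℤ.* j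
      exponent = begin
        + (d ℕ.* (m′ ℕ.+ n))                       ≡⟨ cong +_ (ℕ.*-distribˡ-+ d m′ n) ⟩
        + (d ℕ.* m′) ℤ.+ + (d ℕ.* n)               ≡⟨ cong (λ x → x ℤ.+ + (d ℕ.* n)) m′≡ ⟩
        + (d ℕ.* m) ℤ.+ c ℤ.* j ℤ.+ + (d ℕ.* n)    ≡⟨ swap (+ (d ℕ.* m)) (c ℤ.* j) (+ (d ℕ.* n)) ⟩
        + (d ℕ.* m) ℤ.+ + (d ℕ.* n) ℤ.+ c ℤ.* j    ≡⟨ cong (λ x → + x ℤ.+ c ℤ.* j) (ℕ.*-distribˡ-+ d m n) ⟨
        + (d ℕ.* (m ℕ.+ n)) ℤ.+ c ℤ.* j            ∎
        where
        open ≡-Reasoning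
        swap : ∀ x y z → x ℤ.+ y ℤ.+ z ≡ x ℤ.+ z ℤ.+ y
        swap = ℤ-Solver.solve-∀

    subst-∞ : .{{_ : NonZero d}} → ∀ {f g} → Substitution a c f g →
      Substitution a c (⟨ z^ j * (q ^ d) ^ m ⨾q^ d ⟩∞ * f) (⟨ z^ (a ℤ.* j) * (q ^ d) ^ m′ ⨾q^ d ⟩∞ * g)
    subst-∞ {f} {g} h = subst-lim {λ n → ⟨ x ⨾q^ d ⟩ n * f} {λ n → ⟨ x′ ⨾q^ d ⟩ n * g}
      {⟨ x ⨾q^ d ⟩∞ * f} {⟨ x′ ⨾q^ d ⟩∞ * g}
      (⟶-* {⟨ x ⨾q^ d ⟩_} {λ _ → f} {⟨ x ⨾q^ d ⟩∞} {f} (pochhammer⟶ x d) (⟶-const f))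
      (⟶-* {⟨ x′ ⨾q^ d ⟩_} {λ _ → g} {⟨ x′ ⨾q^ d ⟩∞} {g} (pochhammer⟶ x′ d) (⟶-const g))
      (λ n → subst-pochhammer n h)
      where
      x x′ : Series
      x = z^ j * (q ^ d) ^ m
      x′ = z^ (a ℤ.* j) * (q ^ d) ^ m′

-- Rows of 1, of series free of z, and of signed monomials

cf-1-≢0 : ∀ k N → k ≢ ℤ.0ℤ → cf 1# k N ≡ ℤ.0ℤ
cf-1-≢0 k (+ zero)  k≢0 = cong (λ b → (if b then ℤ.1ℤ else ℤ.0ℤ) ℤ.+ ℤ.0ℤ) (dec-false (ℤ.0ℤ ℤ.≟ k) (k≢0 ∘ ≡.sym))
cf-1-≢0 k (+ suc _) k≢0 = refl
cf-1-≢0 k -[1+ _ ]  k≢0 = refl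

-- In a row k ≠ 0 the series 1 and 0 agree, and `w` acts alike on rows that agree; so w · 1 and w ·
-- 0 agree there.
zfree-row-≢0 : ∀ {w} → ZFree w → ∀ k N → k ≢ ℤ.0ℤ → cf w k N ≡ ℤ.0ℤ
zfree-row-≢0 {w} w-free k N k≢0 = begin
  cf w k N                            ≡⟨ cf-cong (S.*-identityʳ w) k N ⟨
  cf (w * 1#) k N                     ≡⟨ act w-free 1# 0# k k (+ 0) (λ N → ≡.trans (cf-1-≢0 k N k≢0) (≡.sym (cf-0 k (N ℤ.+ + 0)))) N ⟩
  cf (w * 0#) k (N ℤ.+ + 0)           ≡⟨ cf-cong (S.zeroʳ w) k (N ℤ.+ + 0) ⟩
  cf 0# k (N ℤ.+ + 0)                 ≡⟨ cf-0 k (N ℤ.+ + 0) ⟩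
  ℤ.0ℤ                                ∎
  where open ≡-Reasoning

-- The only nonzero row of 1 is that of z^0, and a k = 0 forces k = 0 because `a` is nonzero.
subst-1 : ∀ a c .{{_ : ℤ.NonZero a}} → Substitution a c 1# 1#
subst-1 a c = mkSubstitution λ k N → go k N (k ℤ.≟ ℤ.0ℤ)
  where
  go : ∀ k N → Dec (k ≡ ℤ.0ℤ) → cf 1# k N ≡ cf 1# (a ℤ.* k) (N ℤ.+ c ℤ.* k)
  go k N (yes refl) = ≡.sym (cong₂ (cf 1#) (ℤ.*-zeroʳ a) (≡.trans (cong (λ x → N ℤ.+ x) (ℤ.*-zeroʳ c)) (ℤ.+-identityʳ N)))
  go k N (no k≢0)   = ≡.trans (cf-1-≢0 k N k≢0) (≡.sym (cf-1-≢0 (a ℤ.* k) (N ℤ.+ c ℤ.* k) a*k≢0))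
    where
    a*k≢0 : a ℤ.* k ≢ ℤ.0ℤ
    a*k≢0 a*k≡0 = k≢0 (ℤ.*-cancelˡ-≡ a k ℤ.0ℤ (≡.trans a*k≡0 (≡.sym (ℤ.*-zeroʳ a))))

z^-+ : ∀ i j → z^ i * z^ j ≈ z^ (i ℤ.+ j)
z^-+ i j = mk≈ λ
  { zero    → L.mk≈ λ k → refl
  ; (suc n) → L.mk≈ λ k → L.coeff≡ (RingCoefficients.const-* ((ℤ.1ℤ , i) ∷ []) (z^ j) (suc n)) k
  }

z⁻ : ℤ
z⁻ = -[1+ 0 ]

z*z⁻≈1 : z^ (+ 1) * z^ z⁻ ≈ 1#
z*z⁻≈1 = z^-+ (+ 1) z⁻

-- The row of z^0 is the only nonzero one of (-1)^s q^e, so fixing the power of z loses nothing.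
mono : ℕ → ℕ → ℤ → ℤ
mono s e N = cf (-1^ s * q ^ e) ℤ.0ℤ N

-1*-cf : ∀ f k N → cf ((- 1#) * f) k N ≡ ℤ.- cf f k N
-1*-cf f k N = ≡.trans (cf-cong (S.-1*x≈-x f) k N) (cf-neg f k N)

-1^-suc-cf : ∀ s f k N → cf (-1^ (suc s) * f) k N ≡ ℤ.- cf (-1^ s * f) k N
-1^-suc-cf s f k N = ≡.trans (cf-cong (S.*-assoc (- 1#) (-1^ s) f) k N) (-1*-cf (-1^ s * f) k N)

mono-suc : ∀ s e N → mono (suc s) e N ≡ ℤ.- mono s e N
mono-suc s e N = -1^-suc-cf s (q ^ e) ℤ.0ℤ N

mono-2+ : ∀ s e N → mono (suc (suc s)) e N ≡ mono s e N
mono-2+ s e N = ≡.trans (mono-suc (suc s) e N) (≡.trans (cong ℤ.-_ (mono-suc s e N)) (ℤ.neg-involutive _))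

mono-even : ∀ m s e N → mono (m ℕ.* 2 ℕ.+ s) e N ≡ mono s e N
mono-even zero    s e N = refl
mono-even (suc m) s e N = ≡.trans (mono-2+ (m ℕ.* 2 ℕ.+ s) e N) (mono-even m s e N)

q^*-swap : ∀ s m e → -1^ s * q ^ (m ℕ.+ e) ≈ q ^ m * (-1^ s * q ^ e)
q^*-swap s m e = S.trans (S.*-congˡ { -1^ s} (S.^-homo-* q m e))
  (solve 3 (λ x y z → x ⊛ (y ⊛ z) := y ⊛ (x ⊛ z)) S.refl (-1^ s) (q ^ m) (q ^ e))

mono-shift : ∀ s m e N → mono s (m ℕ.+ e) N ≡ mono s e (N ℤ.- + m)
mono-shift s m e N = ≡.trans (cf-cong (q^*-swap s m e) ℤ.0ℤ N) (cf-q^ m (-1^ s * q ^ e) ℤ.0ℤ N)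

cf-<0 : ∀ f k {N} → N ℤ.< ℤ.0ℤ → cf f k N ≡ ℤ.0ℤ
cf-<0 f k ℤ.-<+ = refl
cf-<0 f k (ℤ.+<+ ())

mono-< : ∀ s e {N} → N ℤ.< + e → mono s e N ≡ ℤ.0ℤ
mono-< s e {N} N<e = ≡.trans (cong (λ e → mono s e N) (≡.sym (ℕ.+-identityʳ e)))
  (≡.trans (mono-shift s e 0 N) (cf-<0 (-1^ s * q ^ 0) ℤ.0ℤ N-e<0))
  where
  N-e<0 : N ℤ.- + e ℤ.< ℤ.0ℤ
  N-e<0 = ≡.subst (N ℤ.- + e ℤ.<_) (ℤ.+-inverseʳ (+ e)) (ℤ.+-monoˡ-< (ℤ.- + e) N<e)

zfree--1^ : ∀ s → ZFree (-1^ s)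
zfree--1^ = zfree-^ (zfree-neg zfree-1)

-- Equality of constant terms in z. Such equations may be multiplied by series free of z (`≈₀-*`),
-- and the normalisation of the triple product is computed within this restriction.
record _≈₀_ (f g : Series) : Set where
  constructor mk≈₀
  field row₀ : ∀ N → cf f ℤ.0ℤ N ≡ cf g ℤ.0ℤ N
open _≈₀_ public

≈₀-setoid : Setoid _ _
≈₀-setoid = record
  { _≈_ = _≈₀_
  ; isEquivalence = record
    { refl  = mk≈₀ λ N → refl
    ; sym   = λ p → mk≈₀ λ N → ≡.sym (row₀ p N)
    ; trans = λ p r → mk≈₀ λ N → ≡.trans (row₀ p N) (row₀ r N)
    }
  }

module ≈₀-Reasoning = SetoidReasoning ≈₀-setoid

≈⇒≈₀ : ∀ {f g} → f ≈ g → f ≈₀ g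
≈⇒≈₀ f≈g = mk≈₀ (cf-cong f≈g ℤ.0ℤ)

≈₀-+ : ∀ {f₁ f₂ g₁ g₂} → f₁ ≈₀ g₁ → f₂ ≈₀ g₂ → (f₁ + f₂) ≈₀ (g₁ + g₂)
≈₀-+ {f₁} {f₂} {g₁} {g₂} h₁ h₂ = mk≈₀ λ N → ≡.trans (cf-+ f₁ f₂ ℤ.0ℤ N)
  (≡.trans (cong₂ ℤ._+_ (row₀ h₁ N) (row₀ h₂ N)) (≡.sym (cf-+ g₁ g₂ ℤ.0ℤ N)))

Row⇒≈₀ : ∀ {f g} → Row f ℤ.0ℤ g ℤ.0ℤ ℤ.0ℤ → f ≈₀ g
Row⇒≈₀ {f} {g} h = mk≈₀ λ N → ≡.trans (h N) (cong (cf g ℤ.0ℤ) (ℤ.+-identityʳ N))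

≈₀⇒Row : ∀ {f g} → f ≈₀ g → Row f ℤ.0ℤ g ℤ.0ℤ ℤ.0ℤ
≈₀⇒Row {f} {g} h N = ≡.trans (row₀ h N) (cong (cf g ℤ.0ℤ) (≡.sym (ℤ.+-identityʳ N)))

≈₀-* : ∀ {w f g} → ZFree w → f ≈₀ g → (w * f) ≈₀ (w * g)
≈₀-* {w} {f} {g} w-free h = Row⇒≈₀ (act w-free f g ℤ.0ℤ ℤ.0ℤ ℤ.0ℤ (≈₀⇒Row h))

-- Reduces by two constructors at a time, so that a finite product of length `double (suc n)`
-- unfolds into two more factors.
double : ℕ → ℕ
double zero    = zero
double (suc n) = suc (suc (double n))

n≤double : ∀ n → n ≤ double n
n≤double zero    = z≤n
n≤double (suc n) = s≤s (ℕ.m≤n⇒m≤1+n (n≤double n))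

^-double : ∀ x n → x ^ double n ≈ x ^ n * x ^ n
^-double x zero    = S.sym (S.*-identityˡ 1#)
^-double x (suc n) = S.trans (S.*-congˡ {x} (S.*-congˡ {x} (^-double x n)))
  (solve 2 (λ x y → x ⊛ (x ⊛ (y ⊛ y)) := (x ⊛ y) ⊛ (x ⊛ y)) S.refl x (x ^ n))

tri : ℕ → ℕ
tri zero    = zero
tri (suc n) = suc n ℕ.+ tri n

-- The Jacobi triple product

module TripleProduct (d : ℕ) .{{_ : NonZero d}} where

  Q Z Z⁻ C : Series
  Q = q ^ d
  Z = z^ (+ 1)
  Z⁻ = z^ z⁻
  C = ⟨ Q ⨾q^ d ⟩∞

  A : ℤ → ℕ → Series
  A j m = ⟨ z^ j * Q ^ m ⨾q^ d ⟩∞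

  A-suc : ∀ j m → A j m ≈ (1# - z^ j * Q ^ m) * A j (suc m)
  A-suc j m = S.trans (∞-suc (z^ j * Q ^ m) d) (S.*-congˡ {1# - z^ j * Q ^ m} (∞-cong d
    (solve 3 (λ x y z → x ⊛ y ⊛ z := x ⊛ (z ⊛ y)) S.refl (z^ j) (Q ^ m) Q)))

  zfree-C : ZFree C
  zfree-C = zfree-∞ d (zfree-q^ d)

  shift-exponent : ∀ m j m′ → + m′ ≡ + m ℤ.+ j → + (d ℕ.* m′) ≡ + (d ℕ.* m) ℤ.+ + d ℤ.* j
  shift-exponent m j m′ m′≡ = begin
    + (d ℕ.* m′)                   ≡⟨ ℤ.pos-* d m′ ⟩
    + d ℤ.* + m′                   ≡⟨ cong (λ x → + d ℤ.* x) m′≡ ⟩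
    + d ℤ.* (+ m ℤ.+ j)            ≡⟨ ℤ.*-distribˡ-+ (+ d) (+ m) j ⟩
    + d ℤ.* + m ℤ.+ + d ℤ.* j      ≡⟨ cong (λ x → x ℤ.+ + d ℤ.* j) (ℤ.pos-* d m) ⟨
    + (d ℕ.* m) ℤ.+ + d ℤ.* j      ∎
    where open ≡-Reasoning

  suc-exponent : ∀ m → + (d ℕ.* suc m) ≡ + (d ℕ.* m) ℤ.+ + d ℤ.* + 1
  suc-exponent m = shift-exponent m (+ 1) (suc m) (cong +_ (ℕ.+-comm 1 m))

  pred-exponent : ∀ m → + (d ℕ.* m) ≡ + (d ℕ.* suc m) ℤ.+ + d ℤ.* z⁻
  pred-exponent m = shift-exponent (suc m) z⁻ m refl

  -- Under z ↦ zQ the factor (z Q^m)∞ gains a power of Q and the factor with z⁻¹ loses one; the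
  -- index `suc n` leaves room for the loss.
  AA-shift : ∀ m n → Substitution (+ 1) (+ d) (C * (A (+ 1) m * A z⁻ (suc n))) (C * (A (+ 1) (suc m) * A z⁻ n))
  AA-shift m n = subst-zfree zfree-C
    (subst-∞ d (+ 1) m (suc m) (suc-exponent m)
      (subst-resp (S.*-identityʳ (A z⁻ (suc n))) (S.*-identityʳ (A z⁻ n))
        (subst-∞ d z⁻ (suc n) n (pred-exponent n) (subst-1 (+ 1) (+ d)))))

  AA-invert : ∀ m n → Substitution z⁻ (+ 0) (C * (A (+ 1) m * A z⁻ n)) (C * (A (+ 1) n * A z⁻ m))
  AA-invert m n = subst-resp S.refl (S.*-congˡ {C} (S.*-comm (A z⁻ m) (A (+ 1) n)))
    (subst-zfree zfree-C (subst-∞ d (+ 1) m m (≡.sym (ℤ.+-identityʳ _))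
      (subst-resp (S.*-identityʳ (A z⁻ n)) (S.*-identityʳ (A (+ 1) n))
        (subst-∞ d z⁻ n n (≡.sym (ℤ.+-identityʳ _)) (subst-1 z⁻ (+ 0))))))

  -- `Φ 0` is the theta function (Q)∞ (zQ)∞ (z⁻¹)∞ of the triple product. The others serve as the
  -- end terms of the telescoping sums.
  Φ : ℕ → Series
  Φ n = C * (A (+ 1) (suc n) * A z⁻ n)

  -- P n and M n are the finite analogues of Φ 0 and of its shift by z ↦ z / Q.
  P M D : ℕ → Series
  P n = ⟨ Z * Q ^ 1 ⨾q^ d ⟩ n * ⟨ Z⁻ * Q ^ 0 ⨾q^ d ⟩ n
  M n = ⟨ Z * Q ^ 0 ⨾q^ d ⟩ n * ⟨ Z⁻ * Q ^ 1 ⨾q^ d ⟩ n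
  D n = ⟨ Q ⨾q^ d ⟩ n

  P-suc : ∀ n → P (suc n) ≈ ((1# - Z * Q * Q ^ n) * (1# - Z⁻ * Q ^ n)) * P n
  P-suc n = S.trans (S.*-cong (pochhammer-suc (Z * Q ^ 1) d n) (pochhammer-suc (Z⁻ * Q ^ 0) d n))
    (solve 6 (λ a b z z′ Q y → a ⊛ (con (+ 1) ⊖ z ⊛ (Q ⊛ con (+ 1)) ⊛ y) ⊛ (b ⊛ (con (+ 1) ⊖ z′ ⊛ con (+ 1) ⊛ y))
        := (con (+ 1) ⊖ z ⊛ Q ⊛ y) ⊛ (con (+ 1) ⊖ z′ ⊛ y) ⊛ (a ⊛ b)) S.refl
      (⟨ Z * Q ^ 1 ⨾q^ d ⟩ n) (⟨ Z⁻ * Q ^ 0 ⨾q^ d ⟩ n) Z Z⁻ Q (Q ^ n))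

  M-suc : ∀ n → M (suc n) ≈ ((1# - Z * Q ^ n) * (1# - Z⁻ * Q * Q ^ n)) * M n
  M-suc n = S.trans (S.*-cong (pochhammer-suc (Z * Q ^ 0) d n) (pochhammer-suc (Z⁻ * Q ^ 1) d n))
    (solve 6 (λ a b z z′ Q y → a ⊛ (con (+ 1) ⊖ z ⊛ con (+ 1) ⊛ y) ⊛ (b ⊛ (con (+ 1) ⊖ z′ ⊛ (Q ⊛ con (+ 1)) ⊛ y))
        := (con (+ 1) ⊖ z ⊛ y) ⊛ (con (+ 1) ⊖ z′ ⊛ Q ⊛ y) ⊛ (a ⊛ b)) S.refl
      (⟨ Z * Q ^ 0 ⨾q^ d ⟩ n) (⟨ Z⁻ * Q ^ 1 ⨾q^ d ⟩ n) Z Z⁻ Q (Q ^ n))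

  M-P-shift : ∀ n → Substitution (+ 1) (+ d) (M n) (P n)
  M-P-shift n = subst-pochhammer d (+ 1) 0 1 (suc-exponent 0) n
    (subst-resp (S.*-identityʳ (⟨ Z⁻ * Q ^ 1 ⨾q^ d ⟩ n)) (S.*-identityʳ (⟨ Z⁻ * Q ^ 0 ⨾q^ d ⟩ n))
      (subst-pochhammer d z⁻ 1 0 (pred-exponent 0) n (subst-1 (+ 1) (+ d))))

  -- After cancellation M / P is (1 - z)(1 - z⁻¹ Q^n) / ((1 - z Q^n)(1 - z⁻¹)), and (1 - z) / (1 -
  -- z⁻¹) = -z. Since `M-P-shift` relates `M n` to `P n` by z ↦ zQ, this is a functional equation
  -- for `P n` alone.
  M≈P : ∀ n → (1# - Z * Q ^ n) * M n ≈ (Q ^ n - Z) * P n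
  M≈P zero    = solve 1 (λ z → (con (+ 1) ⊖ z ⊛ con (+ 1)) ⊛ (con (+ 1) ⊛ con (+ 1)) := (con (+ 1) ⊖ z) ⊛ (con (+ 1) ⊛ con (+ 1))) S.refl Z
  M≈P (suc n) = begin
    (1# - Z * (Q * y)) * M (suc n)
      ≈⟨ S.*-congˡ {1# - Z * (Q * y)} (M-suc n) ⟩
    (1# - Z * (Q * y)) * (((1# - Z * y) * (1# - Z⁻ * Q * y)) * M n)
      ≈⟨ solve 5 (λ z z′ Q y m → (con (+ 1) ⊖ z ⊛ (Q ⊛ y)) ⊛ ((con (+ 1) ⊖ z ⊛ y) ⊛ (con (+ 1) ⊖ z′ ⊛ Q ⊛ y) ⊛ m)
          := (con (+ 1) ⊖ z ⊛ (Q ⊛ y)) ⊛ (con (+ 1) ⊖ z′ ⊛ Q ⊛ y) ⊛ ((con (+ 1) ⊖ z ⊛ y) ⊛ m)) S.refl Z Z⁻ Q y (M n) ⟩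
    (1# - Z * (Q * y)) * (1# - Z⁻ * Q * y) * ((1# - Z * y) * M n)
      ≈⟨ S.*-congˡ {(1# - Z * (Q * y)) * (1# - Z⁻ * Q * y)} (M≈P n) ⟩
    (1# - Z * (Q * y)) * (1# - Z⁻ * Q * y) * ((y - Z) * P n)
      ≈⟨ solve 5 (λ z z′ Q y p → (con (+ 1) ⊖ z ⊛ (Q ⊛ y)) ⊛ (con (+ 1) ⊖ z′ ⊛ Q ⊛ y) ⊛ ((y ⊖ z) ⊛ p)
          := (con (+ 1) ⊖ z ⊛ (Q ⊛ y)) ⊛ ((y ⊖ z ⊖ Q ⊛ y ⊛ z′ ⊛ y ⊕ (z ⊛ z′) ⊛ (Q ⊛ y)) ⊛ p)) S.refl Z Z⁻ Q y (P n) ⟩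
    (1# - Z * (Q * y)) * ((y - Z - Q * y * Z⁻ * y + (Z * Z⁻) * (Q * y)) * P n)
      -- The solver does not know z z⁻¹ = 1. The product z z⁻¹ is removed from z z⁻¹ Q y, and z z⁻¹
      -- y - y = 0 is inserted, after which both sides agree as polynomials.
      ≈⟨ S.*-congˡ {1# - Z * (Q * y)} (S.*-congʳ {P n} (S.+-congˡ {y - Z - Q * y * Z⁻ * y}
           (S.trans (S.*-congʳ {Q * y} z*z⁻≈1) (S.trans (S.*-identityˡ (Q * y)) (S.sym (unit (Q * y) y)))))) ⟩
    (1# - Z * (Q * y)) * ((y - Z - Q * y * Z⁻ * y + (Q * y + ((Z * Z⁻) * y - y))) * P n)
      ≈⟨ solve 5 (λ z z′ Q y p → (con (+ 1) ⊖ z ⊛ (Q ⊛ y)) ⊛ ((y ⊖ z ⊖ Q ⊛ y ⊛ z′ ⊛ y ⊕ (Q ⊛ y ⊕ (z ⊛ z′ ⊛ y ⊖ y))) ⊛ p)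
          := (Q ⊛ y ⊖ z) ⊛ ((con (+ 1) ⊖ z ⊛ Q ⊛ y) ⊛ (con (+ 1) ⊖ z′ ⊛ y) ⊛ p)) S.refl Z Z⁻ Q y (P n) ⟩
    (Q * y - Z) * (((1# - Z * Q * y) * (1# - Z⁻ * y)) * P n)
      ≈⟨ S.*-congˡ {Q * y - Z} (P-suc n) ⟨
    (Q * y - Z) * P (suc n) ∎
    where
    open ≈-Reasoning
    y : Series
    y = Q ^ n
    unit : ∀ a y → a + ((Z * Z⁻) * y - y) ≈ a
    unit a y = S.trans (S.+-congˡ {a} (S.trans (S.+-congʳ { - y} (S.trans (S.*-congʳ {y} z*z⁻≈1) (S.*-identityˡ y))) (S.-‿inverseʳ y)))
      (S.+-identityʳ a)

  private
    -- As `P n` arises from `M n` by z ↦ zQ, its coefficient of z^k is Q^k times that of `M n`. This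
    -- lemma and the two following ones are the cases k = -1, 0, 1, each moved to the constant term.
    zM : ∀ n → (Z * M n) ≈₀ (Q * (Z * P n))
    zM n = mk≈₀ λ N → begin
      cf (Z * M n) ℤ.0ℤ N                      ≡⟨ cf-z (+ 1) (M n) ℤ.0ℤ N ⟩
      cf (M n) z⁻ N                            ≡⟨ row (M-P-shift n) z⁻ N ⟩
      cf (P n) z⁻ (N ℤ.+ + d ℤ.* z⁻)           ≡⟨ cong (cf (P n) z⁻) (shift N (+ d)) ⟩
      cf (P n) z⁻ (N ℤ.- + d)                  ≡⟨ cf-z (+ 1) (P n) ℤ.0ℤ (N ℤ.- + d) ⟨
      cf (Z * P n) ℤ.0ℤ (N ℤ.- + d)            ≡⟨ cf-q^ d (Z * P n) ℤ.0ℤ N ⟨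
      cf (Q * (Z * P n)) ℤ.0ℤ N                ∎
      where
      open ≡-Reasoning
      shift : ∀ N d → N ℤ.+ d ℤ.* -[1+ 0 ] ≡ N ℤ.- d
      shift = ℤ-Solver.solve-∀

    M≈₀P : ∀ n → M n ≈₀ P n
    M≈₀P n = mk≈₀ λ N → ≡.trans (row (M-P-shift n) ℤ.0ℤ N)
      (cong (cf (P n) ℤ.0ℤ) (≡.trans (cong (λ x → N ℤ.+ x) (ℤ.*-zeroʳ (+ d))) (ℤ.+-identityʳ N)))

    z⁻M : ∀ n → (Q * (Z⁻ * M n)) ≈₀ (Z⁻ * P n)
    z⁻M n = mk≈₀ λ N → begin
      cf (Q * (Z⁻ * M n)) ℤ.0ℤ N                     ≡⟨ cf-q^ d (Z⁻ * M n) ℤ.0ℤ N ⟩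
      cf (Z⁻ * M n) ℤ.0ℤ (N ℤ.- + d)                 ≡⟨ cf-z z⁻ (M n) ℤ.0ℤ (N ℤ.- + d) ⟩
      cf (M n) (+ 1) (N ℤ.- + d)                     ≡⟨ row (M-P-shift n) (+ 1) (N ℤ.- + d) ⟩
      cf (P n) (+ 1) (N ℤ.- + d ℤ.+ + d ℤ.* + 1)     ≡⟨ cong (cf (P n) (+ 1)) (shift N (+ d)) ⟩
      cf (P n) (+ 1) N                               ≡⟨ cf-z z⁻ (P n) ℤ.0ℤ N ⟨
      cf (Z⁻ * P n) ℤ.0ℤ N                           ∎
      where
      open ≡-Reasoning
      shift : ∀ N d → N ℤ.- d ℤ.+ d ℤ.* + 1 ≡ N
      shift = ℤ-Solver.solve-∀

    zfree-Q : ZFree Q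
    zfree-Q = zfree-q^ d

    zfree-Q^ : ∀ n → ZFree (Q ^ n)
    zfree-Q^ = zfree-^ zfree-Q

    zfree-1- : ∀ {w} → ZFree w → ZFree (1# - w)
    zfree-1- h = zfree-+ zfree-1 (zfree-neg h)

    ≈₀-neg : ∀ {f g} → f ≈₀ g → (- f) ≈₀ (- g)
    ≈₀-neg {f} {g} h = mk≈₀ λ N → ≡.trans (cf-neg f ℤ.0ℤ N) (≡.trans (cong ℤ.-_ (row₀ h N)) (≡.sym (cf-neg g ℤ.0ℤ N)))

    -- The constant term of `M≈P`, with the coefficients of `M n` replaced by those of `P n`. It
    -- expresses the coefficient of z⁻¹ in `P n` by the constant term of `P n`.
    zP : ∀ n → ((1# - Q * Q ^ n) * (Z * P n)) ≈₀ (- ((1# - Q ^ n) * P n))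
    zP n = begin
      (1# - Q * y) * (Z * p)
        ≈⟨ ≈⇒≈₀ (solve 4 (λ z Q y p → (con (+ 1) ⊖ Q ⊛ y) ⊛ (z ⊛ p) := (p ⊖ y ⊛ (Q ⊛ (z ⊛ p))) ⊖ (con (+ 1) ⊖ z) ⊛ p) S.refl Z Q y p) ⟩
      (p - y * (Q * (Z * p))) - (1# - Z) * p
        ≈⟨ ≈₀-+ (≈₀-+ (M≈₀P n) (≈₀-neg (≈₀-* (zfree-Q^ n) (zM n)))) (≈⇒≈₀ (S.refl {x = - ((1# - Z) * p)})) ⟨
      (M n - y * (Z * M n)) - (1# - Z) * p
        ≈⟨ ≈⇒≈₀ (S.+-congʳ { - ((1# - Z) * p)} (S.trans
             (solve 3 (λ z y m → m ⊖ y ⊛ (z ⊛ m) := (con (+ 1) ⊖ z ⊛ y) ⊛ m) S.refl Z y (M n)) (M≈P n))) ⟩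
      (y - Z) * p - (1# - Z) * p
        ≈⟨ ≈⇒≈₀ (solve 3 (λ z y p → (y ⊖ z) ⊛ p ⊖ (con (+ 1) ⊖ z) ⊛ p := ⊝ ((con (+ 1) ⊖ y) ⊛ p)) S.refl Z y p) ⟩
      - ((1# - y) * p) ∎
      where
      open ≈₀-Reasoning
      y p : Series
      y = Q ^ n
      p = P n

    -- As for `zP`, but `M≈P` is multiplied by Q z⁻¹ first, so that the coefficient of z in `P n` is
    -- obtained.
    z⁻P : ∀ n → ((1# - Q * Q ^ n) * (Z⁻ * P n)) ≈₀ (- ((Q - Q * Q ^ n) * P n))
    z⁻P n = begin
      (1# - Q * y) * (Z⁻ * p)
        ≈⟨ ≈⇒≈₀ (solve 4 (λ z Q y p → (con (+ 1) ⊖ Q ⊛ y) ⊛ (z ⊛ p) := (z ⊛ p ⊖ (Q ⊛ y) ⊛ p) ⊖ (Q ⊛ y ⊛ z ⊖ Q ⊛ y) ⊛ p) S.refl Z⁻ Q y p) ⟩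
      (Z⁻ * p - (Q * y) * p) - (Q * y * Z⁻ - Q * y) * p
        ≈⟨ ≈₀-+ (≈₀-+ (z⁻M n) (≈₀-neg (≈₀-* (zfree-* zfree-Q (zfree-Q^ n)) (M≈₀P n)))) (≈⇒≈₀ (S.refl {x = - ((Q * y * Z⁻ - Q * y) * p)})) ⟨
      (Q * (Z⁻ * m) - (Q * y) * m) - (Q * y * Z⁻ - Q * y) * p
        ≈⟨ ≈⇒≈₀ (S.+-congʳ { - ((Q * y * Z⁻ - Q * y) * p)} (S.+-congˡ {Q * (Z⁻ * m)} (S.-‿cong (S.sym (one ((Q * y) * m)))))) ⟩
      (Q * (Z⁻ * m) - (Z * Z⁻) * ((Q * y) * m)) - (Q * y * Z⁻ - Q * y) * p
        ≈⟨ ≈⇒≈₀ (S.+-congʳ { - ((Q * y * Z⁻ - Q * y) * p)} (S.trans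
             (solve 5 (λ z z′ Q y m → Q ⊛ (z′ ⊛ m) ⊖ (z ⊛ z′) ⊛ ((Q ⊛ y) ⊛ m) := Q ⊛ z′ ⊛ ((con (+ 1) ⊖ z ⊛ y) ⊛ m)) S.refl Z Z⁻ Q y m)
             (S.*-congˡ {Q * Z⁻} (M≈P n)))) ⟩
      Q * Z⁻ * ((y - Z) * p) - (Q * y * Z⁻ - Q * y) * p
        ≈⟨ ≈⇒≈₀ (solve 5 (λ z z′ Q y p → Q ⊛ z′ ⊛ ((y ⊖ z) ⊛ p) ⊖ (Q ⊛ y ⊛ z′ ⊖ Q ⊛ y) ⊛ p := Q ⊛ y ⊛ p ⊖ (z ⊛ z′) ⊛ (Q ⊛ p)) S.refl Z Z⁻ Q y p) ⟩
      Q * y * p - (Z * Z⁻) * (Q * p)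
        ≈⟨ ≈⇒≈₀ (S.+-congˡ {Q * y * p} (S.-‿cong (one (Q * p)))) ⟩
      Q * y * p - Q * p
        ≈⟨ ≈⇒≈₀ (solve 3 (λ Q y p → Q ⊛ y ⊛ p ⊖ Q ⊛ p := ⊝ ((Q ⊖ Q ⊛ y) ⊛ p)) S.refl Q y p) ⟩
      - ((Q - Q * y) * p) ∎
      where
      open ≈₀-Reasoning
      y p m : Series
      y = Q ^ n
      p = P n
      m = M n
      one : ∀ x → (Z * Z⁻) * x ≈ x
      one x = S.trans (S.*-congʳ {x} z*z⁻≈1) (S.*-identityˡ x)

    -- The new factor (1 - z Q y)(1 - z⁻¹ y) with y = Q^n mixes the constant term with the
    -- coefficients of z and z⁻¹. By `zP` and `z⁻P` these are multiples of the constant term, up to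
    -- the factor 1 - Q y carried along on the left.
    P-suc₀ : ∀ n → ((1# - Q * Q ^ n) * P (suc n)) ≈₀ ((1# + Q * Q ^ n) * (1# - Q * (Q ^ n * Q ^ n)) * P n)
    P-suc₀ n = begin
      u * P (suc n)
        ≈⟨ ≈⇒≈₀ (S.*-congˡ {u} (P-suc n)) ⟩
      u * (((1# - Z * Q * y) * (1# - Z⁻ * y)) * p)
        ≈⟨ ≈⇒≈₀ (solve 6 (λ z z′ Q y p u → u ⊛ ((con (+ 1) ⊖ z ⊛ Q ⊛ y) ⊛ (con (+ 1) ⊖ z′ ⊛ y) ⊛ p)
             := u ⊛ (con (+ 1) ⊕ (z ⊛ z′) ⊛ (Q ⊛ y ⊛ y)) ⊛ p ⊕ (⊝ ((Q ⊛ y) ⊛ (u ⊛ (z ⊛ p))) ⊕ ⊝ (y ⊛ (u ⊛ (z′ ⊛ p))))) S.refl Z Z⁻ Q y p u) ⟩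
      u * (1# + (Z * Z⁻) * (Q * y * y)) * p + (- ((Q * y) * (u * (Z * p))) + - (y * (u * (Z⁻ * p))))
        ≈⟨ ≈₀-+ (≈⇒≈₀ (S.*-congʳ {p} (S.*-congˡ {u} (S.+-congˡ {1#} (S.trans (S.*-congʳ {Q * y * y} z*z⁻≈1) (S.*-identityˡ (Q * y * y)))))))
             (≈₀-+ (≈₀-neg (≈₀-* (zfree-* zfree-Q (zfree-Q^ n)) (zP n))) (≈₀-neg (≈₀-* (zfree-Q^ n) (z⁻P n)))) ⟩
      u * (1# + Q * y * y) * p + (- ((Q * y) * (- ((1# - y) * p))) + - (y * (- ((Q - Q * y) * p))))
        ≈⟨ ≈⇒≈₀ (solve 3 (λ Q y p → (con (+ 1) ⊖ Q ⊛ y) ⊛ (con (+ 1) ⊕ Q ⊛ y ⊛ y) ⊛ p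
               ⊕ (⊝ ((Q ⊛ y) ⊛ (⊝ ((con (+ 1) ⊖ y) ⊛ p))) ⊕ ⊝ (y ⊛ (⊝ ((Q ⊖ Q ⊛ y) ⊛ p))))
             := (con (+ 1) ⊕ Q ⊛ y) ⊛ (con (+ 1) ⊖ Q ⊛ (y ⊛ y)) ⊛ p) S.refl Q y p) ⟩
      (1# + Q * y) * (1# - Q * (y * y)) * p ∎
      where
      open ≈₀-Reasoning
      y p u : Series
      y = Q ^ n
      p = P n
      u = 1# - Q * y

    zfree-D : ∀ n → ZFree (D n)
    zfree-D n = zfree-pochhammer d n zfree-Q

    -- The constant term of `P n` is the central Gaussian binomial coefficient (Q)_{2n} / (Q)_n²,
    -- because both satisfy the recurrence `P-suc₀`. It is stated without denominators.
    DDP : ∀ n → (D n * D n * P n) ≈₀ (D (double n))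
    DDP zero    = ≈⇒≈₀ (solve 0 (con (+ 1) ⊛ con (+ 1) ⊛ (con (+ 1) ⊛ con (+ 1)) := con (+ 1)) S.refl)
    DDP (suc n) = begin
      D (suc n) * D (suc n) * P (suc n)
        ≈⟨ ≈⇒≈₀ (S.*-congʳ {P (suc n)} (S.*-cong (pochhammer-suc Q d n) (pochhammer-suc Q d n))) ⟩
      D n * u * (D n * u) * P (suc n)
        ≈⟨ ≈⇒≈₀ (solve 3 (λ D u p → D ⊛ u ⊛ (D ⊛ u) ⊛ p := D ⊛ D ⊛ u ⊛ (u ⊛ p)) S.refl (D n) u (P (suc n))) ⟩
      D n * D n * u * (u * P (suc n))
        ≈⟨ ≈₀-* (zfree-* (zfree-* (zfree-D n) (zfree-D n)) (zfree-1- (zfree-* zfree-Q (zfree-Q^ n)))) (P-suc₀ n) ⟩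
      D n * D n * u * ((1# + Q * y) * (1# - Q * (y * y)) * P n)
        ≈⟨ ≈⇒≈₀ (solve 4 (λ D Q y p → D ⊛ D ⊛ (con (+ 1) ⊖ Q ⊛ y) ⊛ ((con (+ 1) ⊕ Q ⊛ y) ⊛ (con (+ 1) ⊖ Q ⊛ (y ⊛ y)) ⊛ p)
             := (con (+ 1) ⊖ Q ⊛ (y ⊛ y)) ⊛ (con (+ 1) ⊖ Q ⊛ (Q ⊛ (y ⊛ y))) ⊛ (D ⊛ D ⊛ p)) S.refl (D n) Q y (P n)) ⟩
      (1# - Q * (y * y)) * (1# - Q * (Q * (y * y))) * (D n * D n * P n)
        ≈⟨ ≈₀-* (zfree-* (zfree-1- (zfree-* zfree-Q yy)) (zfree-1- (zfree-* zfree-Q (zfree-* zfree-Q yy)))) (DDP n) ⟩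
      (1# - Q * (y * y)) * (1# - Q * (Q * (y * y))) * D (double n)
        ≈⟨ ≈⇒≈₀ (S.sym (S.trans (pochhammer-suc Q d (suc (double n))) (S.trans (S.*-congʳ (pochhammer-suc Q d (double n)))
             (S.trans (S.*-cong (S.*-congˡ {D (double n)} (S.+-congˡ {1#} (S.-‿cong (S.*-congˡ {Q} (^-double Q n)))))
                                (S.+-congˡ {1#} (S.-‿cong (S.*-congˡ {Q} (S.*-congˡ {Q} (^-double Q n))))))
               (solve 3 (λ a b D → D ⊛ a ⊛ b := a ⊛ b ⊛ D) S.refl (1# - Q * (y * y)) (1# - Q * (Q * (y * y))) (D (double n))))))) ⟩
      D (double (suc n)) ∎
      where
      open ≈₀-Reasoning
      y u : Series
      y = Q ^ n
      u = 1# - Q * y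
      yy = zfree-* (zfree-Q^ n) (zfree-Q^ n)

    P⟶ : P ⟶ A (+ 1) 1 * A z⁻ 0
    P⟶ = ⟶-* {⟨ Z * Q ^ 1 ⨾q^ d ⟩_} {⟨ Z⁻ * Q ^ 0 ⨾q^ d ⟩_} {A (+ 1) 1} {A z⁻ 0} (pochhammer⟶ (Z * Q ^ 1) d) (pochhammer⟶ (Z⁻ * Q ^ 0) d)

    CCP : (C * C * (A (+ 1) 1 * A z⁻ 0)) ≈₀ C
    CCP = Row⇒≈₀ (Row-lim {λ n → D n * D n * P n} {D ∘ double} {C * C * (A (+ 1) 1 * A z⁻ 0)} {C} ℤ.0ℤ ℤ.0ℤ ℤ.0ℤ
      (⟶-* {λ n → D n * D n} {P} {C * C} {A (+ 1) 1 * A z⁻ 0} (⟶-* {D} {D} {C} {C} (pochhammer⟶ Q d) (pochhammer⟶ Q d)) P⟶)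
      (⟶-subsequence {D} {C} double n≤double (pochhammer⟶ Q d))
      (λ n → ≈₀⇒Row (DDP n)))

    Q∈ : ∀ d .{{_ : NonZero d}} → q ^ d ∈q^ 1
    Q∈ (suc d) = ∈q^-mono (s≤s z≤n) (q^-∈q^ (suc d))

    C-unit : coeff C 0 R.≈ R.1#
    C-unit = R.trans (R.sym (proj₂ (pochhammer⟶ Q d 0) M₀ ℕ.≤-refl)) (pochhammer-unit Q d M₀ (Q∈ d))
      where M₀ = proj₁ (pochhammer⟶ Q d 0)

  -- For n → ∞, `DDP` says that C · `Φ 0` and C have the same constant term in z. As C is free of z
  -- with constant term 1 in q, so is its inverse, and C can be cancelled.
  Φ₀≈₀1 : Φ 0 ≈₀ 1#
  Φ₀≈₀1 = begin
    Φ 0                                  ≈⟨ ≈⇒≈₀ (S.sym (S.trans (S.*-congʳ {Φ 0} inverse-C) (S.*-identityˡ (Φ 0)))) ⟩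
    (I * C) * Φ 0                        ≈⟨ ≈⇒≈₀ (solve 3 (λ i c x → i ⊛ c ⊛ (c ⊛ x) := i ⊛ (c ⊛ c ⊛ x)) S.refl I C (A (+ 1) 1 * A z⁻ 0)) ⟩
    I * (C * C * (A (+ 1) 1 * A z⁻ 0))   ≈⟨ ≈₀-* (zfree-inverse C C-unit zfree-C) CCP ⟩
    I * C                                ≈⟨ ≈⇒≈₀ inverse-C ⟩
    1#                                   ∎
    where
    open ≈₀-Reasoning
    I : Series
    I = inverse C C-unit
    inverse-C : I * C ≈ 1#
    inverse-C = S.trans (S.*-comm I C) (*-inverse C C-unit)

  private
    -- By 1 - z = -z (1 - z⁻¹). The left-hand side is `Φ 0` with z replaced by z / Q
    -- (`AA-shift 0 0`), so this is the quasi-periodicity of the theta function.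
    AA≈-zΦ : C * (A (+ 1) 0 * A z⁻ 1) ≈ - (Z * Φ 0)
    AA≈-zΦ = begin
      C * (A (+ 1) 0 * A z⁻ 1)
        ≈⟨ S.*-congˡ {C} (S.*-congʳ {A z⁻ 1} (A-suc (+ 1) 0)) ⟩
      C * ((1# - Z * 1#) * A (+ 1) 1 * A z⁻ 1)
        ≈⟨ solve 4 (λ c z a b → c ⊛ ((con (+ 1) ⊖ z ⊛ con (+ 1)) ⊛ a ⊛ b) := ⊝ ((z ⊖ con (+ 1)) ⊛ (c ⊛ (a ⊛ b)))) S.refl C Z (A (+ 1) 1) (A z⁻ 1) ⟩
      - ((Z - 1#) * (C * (A (+ 1) 1 * A z⁻ 1)))
        ≈⟨ S.-‿cong (S.*-congʳ {C * (A (+ 1) 1 * A z⁻ 1)} (S.+-congˡ {Z} (S.-‿cong (S.sym z*z⁻≈1)))) ⟩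
      - ((Z - Z * Z⁻) * (C * (A (+ 1) 1 * A z⁻ 1)))
        ≈⟨ solve 5 (λ c z z′ a b → ⊝ ((z ⊖ z ⊛ z′) ⊛ (c ⊛ (a ⊛ b))) := ⊝ (z ⊛ (c ⊛ (a ⊛ ((con (+ 1) ⊖ z′ ⊛ con (+ 1)) ⊛ b))))) S.refl C Z Z⁻ (A (+ 1) 1) (A z⁻ 1) ⟩
      - (Z * (C * (A (+ 1) 1 * ((1# - Z⁻ * 1#) * A z⁻ 1))))
        ≈⟨ S.-‿cong (S.*-congˡ {Z} (S.*-congˡ {C} (S.*-congˡ {A (+ 1) 1} (A-suc z⁻ 0)))) ⟨
      - (Z * Φ 0) ∎
      where open ≈-Reasoning

  -- The Jacobi triple product for k ≥ 0: quasi-periodicity leads from z^k to z^(k+1), starting from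
  -- the constant term `Φ₀≈₀1`. The recurrences below involve no negative powers of z.
  cf-Φ₀ : ∀ k N → cf (Φ 0) (+ k) N ≡ mono k (d ℕ.* tri k) N
  cf-Φ₀ zero    N = begin
    cf (Φ 0) (+ 0) N               ≡⟨ row₀ Φ₀≈₀1 N ⟩
    cf 1# (+ 0) N                  ≡⟨ cf-cong (S.*-identityˡ 1#) (+ 0) N ⟨
    mono 0 0 N                     ≡⟨ cong (λ e → mono 0 e N) (≡.sym (ℕ.*-zeroʳ d)) ⟩
    mono 0 (d ℕ.* 0) N             ∎
    where open ≡-Reasoning
  cf-Φ₀ (suc k) N = begin
    cf (Φ 0) (+ suc k) N                                      ≡⟨ cong₂ (cf (Φ 0)) (ℤ.*-identityˡ (+ suc k)) N≡ ⟨
    cf (Φ 0) (+ 1 ℤ.* + suc k) (N′ ℤ.+ + d ℤ.* + suc k)       ≡⟨ row (AA-shift 0 0) (+ suc k) N′ ⟨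
    cf (C * (A (+ 1) 0 * A z⁻ 1)) (+ suc k) N′                ≡⟨ cf-cong AA≈-zΦ (+ suc k) N′ ⟩
    cf (- (Z * Φ 0)) (+ suc k) N′                             ≡⟨ ≡.trans (cf-neg (Z * Φ 0) (+ suc k) N′) (cong ℤ.-_ (cf-z (+ 1) (Φ 0) (+ suc k) N′)) ⟩
    ℤ.- cf (Φ 0) (+ suc k ℤ.- + 1) N′                         ≡⟨⟩
    ℤ.- cf (Φ 0) (+ k) N′                                     ≡⟨ cong ℤ.-_ (cf-Φ₀ k N′) ⟩
    ℤ.- mono k (d ℕ.* tri k) N′                               ≡⟨ mono-suc k (d ℕ.* tri k) N′ ⟨
    mono (suc k) (d ℕ.* tri k) N′                             ≡⟨ cong (λ x → mono (suc k) (d ℕ.* tri k) (N ℤ.- x)) (ℤ.pos-* d (suc k)) ⟨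
    mono (suc k) (d ℕ.* tri k) (N ℤ.- + (d ℕ.* suc k))        ≡⟨ mono-shift (suc k) (d ℕ.* suc k) (d ℕ.* tri k) N ⟨
    mono (suc k) (d ℕ.* suc k ℕ.+ d ℕ.* tri k) N              ≡⟨ cong (λ e → mono (suc k) e N) (ℕ.*-distribˡ-+ d (suc k) (tri k)) ⟨
    mono (suc k) (d ℕ.* tri (suc k)) N                        ∎
    where
    open ≡-Reasoning
    N′ : ℤ
    N′ = N ℤ.- + d ℤ.* + suc k
    N≡ : N′ ℤ.+ + d ℤ.* + suc k ≡ N
    N≡ = cancel N (+ d ℤ.* + suc k)
      where
      cancel : ∀ N x → N ℤ.- x ℤ.+ x ≡ N
      cancel = ℤ-Solver.solve-∀

-- Weighted sums of theta products and their functional equations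

*-∑∞ : ∀ x {f g} (f-sum : Summable f) (g-sum : Summable g) → (∀ n → x * f n ≈ g n) → x * ∑∞ f f-sum ≈ ∑∞ g g-sum
*-∑∞ x {f} {g} f-sum g-sum h = lim-unique {partialSum g}
  (⟶-cong {λ n → x * partialSum f n} {partialSum g} {x * ∑∞ f f-sum}
    (λ n → S.trans (*-partialSum x f n) (partialSum-cong n h))
    (⟶-*ˡ x {partialSum f} {∑∞ f f-sum} (proj₂ f-sum)))
  (proj₂ g-sum)

-- The common frame of the three cases: `w n` is the numerator of the n-th summand, and Q is q for R
-- and H and q² for K. The order of `w n` ensures convergence; being free of z, it passes through
-- every substitution.
module Weighted (d : ℕ) .{{_ : NonZero d}} (w : ℕ → Series) (w-order : ∀ n → w n ∈q^ n) (w-free : ∀ n → ZFree (w n)) where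

  open TripleProduct d

  -- `Θ n` is what remains of the infinite products after division by the n-th denominator, and
  -- `Θ′ n` is its image under z ↦ zQ. With u = 1 - z Q^(n+1) and v = 1 - z⁻¹ Q^n, the series `Θ n`,
  -- `Θ′ n` and `Φ n` are u, v and u v times `Φ (suc n)`.
  Θ Θ′ : ℕ → Series
  Θ n = C * (A (+ 1) (suc n) * A z⁻ (suc n))
  Θ′ n = C * (A (+ 1) (suc (suc n)) * A z⁻ n)

  private
    weighted-summable : ∀ (f : ℕ → Series) → Summable (λ n → w n * f n)
    weighted-summable f = order⇒summable (λ n → w n * f n) 1 λ n →
      ≡.subst (λ m → w n * f n ∈q^ m) (≡.sym (n/1≡n n)) (∈q^-*ʳ (f n) (w-order n))

  F F′ : Series
  F = ∑∞ (λ n → w n * Θ n) (weighted-summable Θ)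
  F′ = ∑∞ (λ n → w n * Θ′ n) (weighted-summable Θ′)

  F-shift : Substitution (+ 1) (+ d) F F′
  F-shift = subst-lim {s = partialSum (λ n → w n * Θ n)} {partialSum (λ n → w n * Θ′ n)} {F} {F′}
    (proj₂ (weighted-summable Θ)) (proj₂ (weighted-summable Θ′))
    (subst-partialSum λ i → subst-zfree (w-free i) (AA-shift (suc i) i))

  F-invert : Substitution z⁻ (+ 0) F F
  F-invert = subst-lim {s = partialSum (λ n → w n * Θ n)} {partialSum (λ n → w n * Θ n)} {F} {F}
    (proj₂ (weighted-summable Θ)) (proj₂ (weighted-summable Θ))
    (subst-partialSum λ i → subst-zfree (w-free i) (AA-invert (suc i) (suc i)))

  F-symmetric : ∀ k N → cf F (ℤ.- k) N ≡ cf F k N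
  F-symmetric k N = ≡.sym (≡.trans (row F-invert k N) (cong₂ (cf F) (ℤ.-1*i≡-i k) (ℤ.+-identityʳ N)))

  module _ (a b c : Series) (w0≈1 : w 0 ≈ 1#)
    (telescope : ∀ n → w n * (a * (1# - Z⁻ * Q ^ n) - b * (1# - Z * (Q * Q ^ n)))
      ≈ c * (w n * ((1# - Z⁻ * Q ^ n) * (1# - Z * (Q * Q ^ n))) - w (suc n)))
    where

    private
      Θs Θ′s : ℕ → Series
      Θs = partialSum (λ n → w n * Θ n)
      Θ′s = partialSum (λ n → w n * Θ′ n)

      -- Once everything is written as a multiple of `Φ (suc n)`, the hypothesis `telescope` says
      -- that the n-th summand of the left-hand side is c (w n · Φ n - w (suc n) · Φ (suc n)).
      finite : ∀ n → a * Θ′s n - b * Θs n ≈ c * (w 0 * Φ 0 - w n * Φ n)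
      finite zero    = begin
        a * 0# - b * 0#                      ≈⟨ S.+-cong (S.zeroʳ a) (S.-‿cong (S.zeroʳ b)) ⟩
        0# - 0#                              ≈⟨ S.-‿inverseʳ 0# ⟩
        0#                                   ≈⟨ S.zeroʳ c ⟨
        c * 0#                               ≈⟨ S.*-congˡ {c} (S.-‿inverseʳ (w 0 * Φ 0)) ⟨
        c * (w 0 * Φ 0 - w 0 * Φ 0)          ∎
        where open ≈-Reasoning
      finite (suc n) = begin
        a * Θ′s (suc n) - b * Θs (suc n)
          ≈⟨ S.+-cong (S.*-congˡ {a} (partialSum-suc (λ n → w n * Θ′ n) n)) (S.-‿cong (S.*-congˡ {b} (partialSum-suc (λ n → w n * Θ n) n))) ⟩
        a * (Θ′s n + w n * Θ′ n) - b * (Θs n + w n * Θ n)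
          ≈⟨ S.+-cong (S.*-congˡ {a} (S.+-congˡ {Θ′s n} (S.*-congˡ {w n} (S.*-congˡ {C} (S.*-congˡ {A (+ 1) (suc (suc n))} (A-suc z⁻ n))))))
               (S.-‿cong (S.*-congˡ {b} (S.+-congˡ {Θs n} (S.*-congˡ {w n} (S.*-congˡ {C} (S.*-congʳ {A z⁻ (suc n)} (A-suc (+ 1) (suc n)))))))) ⟩
        a * (Θ′s n + w n * (C * (A₊ * (v * A₋)))) - b * (Θs n + w n * (C * (u * A₊ * A₋)))
          ≈⟨ solve 10 (λ a b s s′ w C p m u v → a ⊛ (s′ ⊕ w ⊛ (C ⊛ (p ⊛ (v ⊛ m)))) ⊖ b ⊛ (s ⊕ w ⊛ (C ⊛ (u ⊛ p ⊛ m)))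
               := (a ⊛ s′ ⊖ b ⊛ s) ⊕ (w ⊛ (a ⊛ v ⊖ b ⊛ u)) ⊛ (C ⊛ (p ⊛ m))) S.refl a b (Θs n) (Θ′s n) (w n) C A₊ A₋ u v ⟩
        (a * Θ′s n - b * Θs n) + (w n * (a * v - b * u)) * Φ (suc n)
          ≈⟨ S.+-cong (finite n) (S.*-congʳ {Φ (suc n)} (telescope n)) ⟩
        c * (w 0 * Φ 0 - w n * Φ n) + (c * (w n * (v * u) - w (suc n))) * Φ (suc n)
          ≈⟨ S.+-congʳ {(c * (w n * (v * u) - w (suc n))) * Φ (suc n)} (S.*-congˡ {c} (S.+-congˡ {w 0 * Φ 0} (S.-‿cong (S.*-congˡ {w n}
               (S.*-congˡ {C} (S.*-cong (A-suc (+ 1) (suc n)) (A-suc z⁻ n))))))) ⟩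
        c * (w 0 * Φ 0 - w n * (C * (u * A₊ * (v * A₋)))) + (c * (w n * (v * u) - w (suc n))) * Φ (suc n)
          ≈⟨ solve 9 (λ c x w w′ C p m u v → c ⊛ (x ⊖ w ⊛ (C ⊛ (u ⊛ p ⊛ (v ⊛ m)))) ⊕ (c ⊛ (w ⊛ (v ⊛ u) ⊖ w′)) ⊛ (C ⊛ (p ⊛ m))
               := c ⊛ (x ⊖ w′ ⊛ (C ⊛ (p ⊛ m)))) S.refl c (w 0 * Φ 0) (w n) (w (suc n)) C A₊ A₋ u v ⟩
        c * (w 0 * Φ 0 - w (suc n) * Φ (suc n)) ∎
        where
        open ≈-Reasoning
        A₊ A₋ u v : Series
        A₊ = A (+ 1) (suc (suc n))
        A₋ = A z⁻ (suc n)
        u = 1# - Z * (Q * Q ^ n)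
        v = 1# - Z⁻ * Q ^ n

    -- The limit of `finite`; the end term w n · Φ n tends to 0 because `w n` is divisible by q^n.
    functional-equation : a * F′ - b * F ≈ c * Φ 0
    functional-equation = lim-unique {λ n → a * Θ′s n - b * Θs n}
      (⟶-+ {λ n → a * Θ′s n} {λ n → - (b * Θs n)} {a * F′} { - (b * F)}
        (⟶-*ˡ a {Θ′s} {F′} (proj₂ (weighted-summable Θ′)))
        (⟶-neg {λ n → b * Θs n} {b * F} (⟶-*ˡ b {Θs} {F} (proj₂ (weighted-summable Θ)))))
      (⟶-cong {λ n → c * (w 0 * Φ 0 - w n * Φ n)} {λ n → a * Θ′s n - b * Θs n} {c * Φ 0} (λ n → S.sym (finite n))
        (⟶-congʳ {λ n → c * (w 0 * Φ 0 - w n * Φ n)} {c * (w 0 * Φ 0 - 0#)} {c * Φ 0} limit≈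
          (⟶-*ˡ c {λ n → w 0 * Φ 0 - w n * Φ n} {w 0 * Φ 0 - 0#}
            (⟶-+ {λ _ → w 0 * Φ 0} {λ n → - (w n * Φ n)} {w 0 * Φ 0} { - 0#} (⟶-const (w 0 * Φ 0))
              (⟶-neg {λ n → w n * Φ n} {0#} (∈q^⇒⟶0 {λ n → w n * Φ n} λ n → ∈q^-*ʳ (Φ n) (w-order n)))))))
      where
      limit≈ : c * (w 0 * Φ 0 - 0#) ≈ c * Φ 0
      limit≈ = S.*-congˡ {c} (S.trans (S.+-congˡ {w 0 * Φ 0} S.-0#≈0#) (S.trans (S.+-identityʳ (w 0 * Φ 0))
        (S.trans (S.*-congʳ {Φ 0} w0≈1) (S.*-identityˡ (Φ 0)))))

  private
    ∞-split : ∀ j n → ⟨ z^ j * q ^ d ⨾q^ d ⟩∞ ≈ ⟨ z^ j * q ^ d ⨾q^ d ⟩ n * A j (suc n)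
    ∞-split j zero    = S.trans (∞-cong d (S.*-congˡ {z^ j} (S.sym (S.*-identityʳ Q)))) (S.sym (S.*-identityˡ (A j 1)))
    ∞-split j (suc n) = begin
      ⟨ z^ j * Q ⨾q^ d ⟩∞
        ≈⟨ ∞-split j n ⟩
      p * A j (suc n)
        ≈⟨ S.*-congˡ {p} (A-suc j (suc n)) ⟩
      p * ((1# - z^ j * (Q * Q ^ n)) * A j (suc (suc n)))
        ≈⟨ solve 5 (λ p z Q y a → p ⊛ ((con (+ 1) ⊖ z ⊛ (Q ⊛ y)) ⊛ a) := p ⊛ (con (+ 1) ⊖ z ⊛ Q ⊛ y) ⊛ a) S.refl p (z^ j) Q (Q ^ n) (A j (suc (suc n))) ⟩
      p * (1# - z^ j * Q * Q ^ n) * A j (suc (suc n))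
        ≈⟨ S.*-congʳ {A j (suc (suc n))} (pochhammer-suc (z^ j * Q) d n) ⟨
      ⟨ z^ j * Q ⨾q^ d ⟩ (suc n) * A j (suc (suc n)) ∎
      where
      open ≈-Reasoning
      p : Series
      p = ⟨ z^ j * Q ⨾q^ d ⟩ n

  -- The n-th denominator cancels against the first n factors of the two infinite products that
  -- contain z.
  product≈F : ∀ (summable : Summable (λ n → w n ÷ zPochhammers d n ⟨ zPochhammers-unit d n ⟩)) →
    ⟨ Z * q ^ d ⨾q^ d ⟩∞ * ⟨ Z⁻ * q ^ d ⨾q^ d ⟩∞ * C * ∑∞ (λ n → w n ÷ zPochhammers d n ⟨ zPochhammers-unit d n ⟩) summable ≈ F
  product≈F summable = *-∑∞ (⟨ Z * q ^ d ⨾q^ d ⟩∞ * ⟨ Z⁻ * q ^ d ⨾q^ d ⟩∞ * C) summable (weighted-summable Θ) λ n → begin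
    ⟨ Z * q ^ d ⨾q^ d ⟩∞ * ⟨ Z⁻ * q ^ d ⨾q^ d ⟩∞ * C * (w n * I n)
      ≈⟨ S.*-congʳ {w n * I n} (S.*-congʳ {C} (S.*-cong (∞-split (+ 1) n) (∞-split z⁻ n))) ⟩
    (p n * A (+ 1) (suc n)) * (m n * A z⁻ (suc n)) * C * (w n * I n)
      ≈⟨ solve 7 (λ p a m b c w i → (p ⊛ a) ⊛ (m ⊛ b) ⊛ c ⊛ (w ⊛ i) := (p ⊛ m ⊛ i) ⊛ (w ⊛ (c ⊛ (a ⊛ b)))) S.refl
           (p n) (A (+ 1) (suc n)) (m n) (A z⁻ (suc n)) C (w n) (I n) ⟩
    (zPochhammers d n * I n) * (w n * Θ n)
      ≈⟨ S.trans (S.*-congʳ {w n * Θ n} (*-inverse (zPochhammers d n) (zPochhammers-unit d n))) (S.*-identityˡ (w n * Θ n)) ⟩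
    w n * Θ n ∎
    where
    open ≈-Reasoning
    I p m : ℕ → Series
    I n = inverse (zPochhammers d n) (zPochhammers-unit d n)
    p n = ⟨ Z * q ^ d ⨾q^ d ⟩ n
    m n = ⟨ Z⁻ * q ^ d ⨾q^ d ⟩ n

-- Triangular numbers and squares as exponents of q

tri-*2 : ∀ n → tri n ℕ.* 2 ≡ n ℕ.* suc n
tri-*2 zero    = refl
tri-*2 (suc n) = ≡.trans (ℕ.*-distribʳ-+ 2 (suc n) (tri n)) (≡.trans (cong (λ x → suc n ℕ.* 2 ℕ.+ x) (tri-*2 n)) (expand n))
  where
  expand : ∀ n → suc n ℕ.* 2 ℕ.+ n ℕ.* suc n ≡ suc n ℕ.* suc (suc n)
  expand = ℕ-Solver.solve-∀

tri-/2 : ∀ n → n ℕ.* suc n / 2 ≡ tri n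
tri-/2 n = ≡.trans (cong (_/ 2) (≡.sym (tri-*2 n))) (m*n/n≡m (tri n) 2)

n≤tri : ∀ n → n ≤ tri n
n≤tri zero    = z≤n
n≤tri (suc n) = ℕ.m≤m+n (suc n) (tri n)

n≤n*n : ∀ n → n ≤ n ℕ.* n
n≤n*n zero    = z≤n
n≤n*n (suc n) = ℕ.m≤m+n (suc n) (n ℕ.* suc n)

q^1^ : ∀ n → (q ^ 1) ^ n ≈ q ^ n
q^1^ n = S.trans (S.^-assocʳ q 1 n) (S.reflexive (cong (q ^_) (ℕ.*-identityˡ n)))

q^2^ : ∀ n → (q ^ 2) ^ n ≈ q ^ n * q ^ n
q^2^ n = S.trans (S.^-assocʳ q 2 n) (S.trans (S.reflexive (cong (q ^_) (cong (λ x → n ℕ.+ x) (ℕ.+-identityʳ n)))) (S.^-homo-* q n n))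

q^-square : ∀ n → q ^ (suc n ℕ.* suc n) ≈ q ^ (n ℕ.* n) * (q * (q ^ n * q ^ n))
q^-square n = begin
  q ^ (suc n ℕ.* suc n)                     ≡⟨ cong (q ^_) (expand n) ⟩
  q ^ (n ℕ.* n ℕ.+ suc (n ℕ.+ n))           ≈⟨ S.^-homo-* q (n ℕ.* n) (suc (n ℕ.+ n)) ⟩
  q ^ (n ℕ.* n) * (q * q ^ (n ℕ.+ n))       ≈⟨ S.*-congˡ {q ^ (n ℕ.* n)} (S.*-congˡ {q} (S.^-homo-* q n n)) ⟩
  q ^ (n ℕ.* n) * (q * (q ^ n * q ^ n))     ∎
  where
  open ≈-Reasoning
  expand : ∀ n → suc n ℕ.* suc n ≡ n ℕ.* n ℕ.+ suc (n ℕ.+ n)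
  expand = ℕ-Solver.solve-∀

private
  -- The sides of the identities `telescope` below agree only modulo z z⁻¹ - 1; g is the cofactor.
  +zz⁻-1 : ∀ x g → x + (z^ (+ 1) * z^ z⁻ - 1#) * g ≈ x
  +zz⁻-1 x g = S.trans (S.+-congˡ {x} (S.trans (S.*-congʳ {g} (S.trans (S.+-congʳ { - 1#} z*z⁻≈1) (S.-‿inverseʳ 1#))) (S.zeroˡ g)))
    (S.+-identityʳ x)

  z : Series
  z = z^ (+ 1)

-- From functional equations to recurrences

subst-row : ∀ {d f g} → Substitution (+ 1) (+ d) f g → ∀ k N → cf g k N ≡ cf f k (N ℤ.- + d ℤ.* k)
subst-row {d} {f} {g} h k N = ≡.sym (≡.trans (row h k (N ℤ.- + d ℤ.* k))
  (cong₂ (cf g) (ℤ.*-identityˡ k) (cancel N (+ d ℤ.* k))))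
  where
  cancel : ∀ N x → N ℤ.- x ℤ.+ x ≡ N
  cancel = ℤ-Solver.solve-∀

cf-zzq : ∀ f k N → cf (z * z * q ^ 1 * f) k N ≡ cf f (k ℤ.- + 1 ℤ.- + 1) (N ℤ.- + 1)
cf-zzq f k N = ≡.trans (cf-cong (solve 3 (λ z q f → z ⊛ z ⊛ q ⊛ f := z ⊛ (z ⊛ (q ⊛ f))) S.refl z (q ^ 1) f) k N)
  (≡.trans (cf-z (+ 1) (z * (q ^ 1 * f)) k N) (≡.trans (cf-z (+ 1) (q ^ 1 * f) (k ℤ.- + 1) N) (cf-q^ 1 f (k ℤ.- + 1 ℤ.- + 1) N)))

cf-zq : ∀ f k N → cf (z * q ^ 1 * f) k N ≡ cf f (k ℤ.- + 1) (N ℤ.- + 1)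
cf-zq f k N = ≡.trans (cf-cong (S.*-assoc z (q ^ 1) f) k N)
  (≡.trans (cf-z (+ 1) (q ^ 1 * f) k N) (cf-q^ 1 f (k ℤ.- + 1) N))

-- The inhomogeneous term of the recurrences for R and for H.
boundary : ℕ → ℤ → ℤ
boundary k N = mono k (tri k) N ℤ.- mono k (suc k ℕ.+ tri (suc k)) N

private
  module J₁ = TripleProduct 1

  -- The factor z² q moves the indices by 2 and 1, so at z^(k+2) q^(N+1) the second term is read at
  -- z^k q^N. The two signs from the triple product agree, as k and k + 2 have the same parity.
  1-zzq-row : ∀ k N → cf ((1# - z * z * q ^ 1) * J₁.Φ 0) (+ suc (suc k)) (N ℤ.+ + 1) ≡ ℤ.- boundary k N
  1-zzq-row k N = begin
    cf ((1# - z * z * q ^ 1) * Φ₀) k₂ (N ℤ.+ + 1)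
      ≡⟨ cf-cong (solve 2 (λ x f → (con (+ 1) ⊖ x) ⊛ f := f ⊖ x ⊛ f) S.refl (z * z * q ^ 1) Φ₀) k₂ (N ℤ.+ + 1) ⟩
    cf (Φ₀ - z * z * q ^ 1 * Φ₀) k₂ (N ℤ.+ + 1)
      ≡⟨ ≡.trans (cf-- Φ₀ (z * z * q ^ 1 * Φ₀) k₂ (N ℤ.+ + 1)) (cong (λ x → cf Φ₀ k₂ (N ℤ.+ + 1) ℤ.- x) (cf-zzq Φ₀ k₂ (N ℤ.+ + 1))) ⟩
    cf Φ₀ k₂ (N ℤ.+ + 1) ℤ.- cf Φ₀ (+ k) (N ℤ.+ + 1 ℤ.- + 1)
      ≡⟨ cong₂ (λ x y → x ℤ.- y) (J₁.cf-Φ₀ (suc (suc k)) (N ℤ.+ + 1)) (J₁.cf-Φ₀ k (N ℤ.+ + 1 ℤ.- + 1)) ⟩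
    mono (suc (suc k)) (1 ℕ.* tri (suc (suc k))) (N ℤ.+ + 1) ℤ.- mono k (1 ℕ.* tri k) (N ℤ.+ + 1 ℤ.- + 1)
      ≡⟨ cong₂ (λ x y → x ℤ.- y)
           (≡.trans (mono-2+ k (1 ℕ.* tri (suc (suc k))) (N ℤ.+ + 1)) (cong (λ e → mono k e (N ℤ.+ + 1)) (ℕ.*-identityˡ (tri (suc (suc k))))))
           (cong₂ (mono k) (ℕ.*-identityˡ (tri k)) (cancel N)) ⟩
    mono k (1 ℕ.+ (suc k ℕ.+ tri (suc k))) (N ℤ.+ + 1) ℤ.- mono k (tri k) N
      ≡⟨ cong (λ x → x ℤ.- mono k (tri k) N) (≡.trans (mono-shift k 1 (suc k ℕ.+ tri (suc k)) (N ℤ.+ + 1)) (cong (mono k (suc k ℕ.+ tri (suc k))) (cancel N))) ⟩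
    mono k (suc k ℕ.+ tri (suc k)) N ℤ.- mono k (tri k) N
      ≡⟨ swap (mono k (suc k ℕ.+ tri (suc k)) N) (mono k (tri k) N) ⟩
    ℤ.- boundary k N ∎
    where
    open ≡-Reasoning
    Φ₀ : Series
    Φ₀ = J₁.Φ 0
    k₂ : ℤ
    k₂ = + suc (suc k)
    cancel : ∀ N → N ℤ.+ + 1 ℤ.- + 1 ≡ N
    cancel = ℤ-Solver.solve-∀
    swap : ∀ x y → x ℤ.- y ≡ ℤ.- (y ℤ.- x)
    swap = ℤ-Solver.solve-∀

  solve-for : ∀ x y b → x ℤ.- y ≡ ℤ.- b → y ≡ x ℤ.+ b
  solve-for x y b h = ≡.trans (rearrange x y) (≡.trans (cong (λ t → x ℤ.- t) h) (cong (λ t → x ℤ.+ t) (ℤ.neg-involutive b)))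
    where
    rearrange : ∀ x y → y ≡ x ℤ.- (x ℤ.- y)
    rearrange = ℤ-Solver.solve-∀

  step-back : ∀ N k → N ℤ.+ + 1 ℤ.- + 1 ℤ.* (+ 2 ℤ.+ k) ≡ N ℤ.- (+ 1 ℤ.+ k)
  step-back = ℤ-Solver.solve-∀

  step-back′ : ∀ N → N ℤ.+ + 1 ℤ.- + 1 ≡ N
  step-back′ = ℤ-Solver.solve-∀

-- The recurrence for R

module R-function where

  w : ℕ → Series
  w n = q ^ (n ℕ.* n)

  private
    module W = Weighted 1 w (λ n → ∈q^-mono (n≤n*n n) (q^-∈q^ (n ℕ.* n))) (λ n → zfree-q^ (n ℕ.* n))
    open J₁

    ratio : ∀ n → w (suc n) ≈ w n * (Q * (Q ^ n * Q ^ n))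
    ratio n = S.trans (q^-square n) (S.*-congˡ {w n} (S.sym (S.*-cong (S.*-identityʳ q) (S.*-cong (q^1^ n) (q^1^ n)))))

    telescope : ∀ n → w n * (1# * (1# - Z⁻ * Q ^ n) - Z * Z * Q * (1# - Z * (Q * Q ^ n)))
      ≈ (1# - Z * Z * Q) * (w n * ((1# - Z⁻ * Q ^ n) * (1# - Z * (Q * Q ^ n))) - w (suc n))
    telescope n = S.trans
      (S.*-congˡ {w n} (S.sym (+zz⁻-1 (1# * (1# - Z⁻ * y) - Z * Z * Q * (1# - Z * (Q * y))) ((1# - Z * Z * Q) * (Q * y * y) + Z * (Q * y)))))
      (S.trans
        (solve 5 (λ z z′ Q y w →
            w ⊛ (con (+ 1) ⊛ (con (+ 1) ⊖ z′ ⊛ y) ⊖ z ⊛ z ⊛ Q ⊛ (con (+ 1) ⊖ z ⊛ (Q ⊛ y))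
              ⊕ (z ⊛ z′ ⊖ con (+ 1)) ⊛ ((con (+ 1) ⊖ z ⊛ z ⊛ Q) ⊛ (Q ⊛ y ⊛ y) ⊕ z ⊛ (Q ⊛ y)))
            := (con (+ 1) ⊖ z ⊛ z ⊛ Q) ⊛ (w ⊛ ((con (+ 1) ⊖ z′ ⊛ y) ⊛ (con (+ 1) ⊖ z ⊛ (Q ⊛ y))) ⊖ w ⊛ (Q ⊛ (y ⊛ y))))
          S.refl Z Z⁻ Q y (w n))
        (S.*-congˡ {1# - Z * Z * Q} (S.+-congˡ {w n * ((1# - Z⁻ * y) * (1# - Z * (Q * y)))} (S.-‿cong (S.sym (ratio n))))))
      where
      y : Series
      y = Q ^ n

  open W public using (F; F-symmetric; product≈F)

  -- The coefficient of z^(k+2) q^(N+1) in F(zq) - z² q F(z) = (1 - z² q) `Φ 0`. In F(zq) the index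
  -- of q is lowered by k + 2, which leaves N - (k + 1).
  recurrence : ∀ k N → cf F (+ k) N ≡ cf F (+ suc (suc k)) (N ℤ.- + suc k) ℤ.+ boundary k N
  recurrence k N = solve-for (cf F k₂ (N ℤ.- + suc k)) (cf F (+ k) N) (boundary k N) (begin
    cf F k₂ (N ℤ.- + suc k) ℤ.- cf F (+ k) N
      ≡⟨ cong₂ (λ x y → x ℤ.- y) (≡.trans (cf-cong (S.*-identityˡ W.F′) k₂ N′) (≡.trans (subst-row W.F-shift k₂ N′) (cong (cf F k₂) (step-back N (+ k)))))
           (≡.trans (cf-zzq F k₂ N′) (cong (cf F (+ k)) (step-back′ N))) ⟨
    cf (1# * W.F′) k₂ N′ ℤ.- cf (Z * Z * Q * F) k₂ N′
      ≡⟨ cf-- (1# * W.F′) (Z * Z * Q * F) k₂ N′ ⟨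
    cf (1# * W.F′ - Z * Z * Q * F) k₂ N′
      ≡⟨ cf-cong (W.functional-equation 1# (Z * Z * Q) (1# - Z * Z * Q) S.refl telescope) k₂ N′ ⟩
    cf ((1# - Z * Z * Q) * Φ 0) k₂ N′
      ≡⟨ 1-zzq-row k N ⟩
    ℤ.- boundary k N ∎)
    where
    open ≡-Reasoning
    k₂ N′ : ℤ
    k₂ = + suc (suc k)
    N′ = N ℤ.+ + 1

-- The recurrence for H

module H-function where

  w : ℕ → Series
  w n = ⟨ - 1# ⨾q^ 1 ⟩ n * q ^ (n ℕ.* suc n / 2)

  private
    n≤n[n+1]/2 : ∀ n → n ≤ n ℕ.* suc n / 2
    n≤n[n+1]/2 n = ≡.subst (n ≤_) (≡.sym (tri-/2 n)) (n≤tri n)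

    module W = Weighted 1 w (λ n → ∈q^-*ˡ (⟨ - 1# ⨾q^ 1 ⟩ n) (∈q^-mono (n≤n[n+1]/2 n) (q^-∈q^ (n ℕ.* suc n / 2))))
      (λ n → zfree-* (zfree-pochhammer 1 n (zfree-neg zfree-1)) (zfree-q^ (n ℕ.* suc n / 2)))
    open J₁

    ratio : ∀ n → w (suc n) ≈ w n * ((1# + Q ^ n) * (Q * Q ^ n))
    ratio n = begin
      ⟨ - 1# ⨾q^ 1 ⟩ (suc n) * q ^ (suc n ℕ.* suc (suc n) / 2)
        ≈⟨ S.*-cong (pochhammer-suc (- 1#) 1 n) (S.trans (S.reflexive (cong (q ^_) exponent)) (S.^-homo-* q (suc n) (n ℕ.* suc n / 2))) ⟩
      p * (1# - (- 1#) * Q ^ n) * (q * q ^ n * t)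
        ≈⟨ S.*-congˡ {p * (1# - (- 1#) * Q ^ n)} (S.*-congʳ {t} (S.sym (S.*-cong (S.*-identityʳ q) (q^1^ n)))) ⟩
      p * (1# - (- 1#) * Q ^ n) * (Q * Q ^ n * t)
        ≈⟨ solve 4 (λ p y Q t → p ⊛ (con (+ 1) ⊖ (⊝ con (+ 1)) ⊛ y) ⊛ (Q ⊛ y ⊛ t) := p ⊛ t ⊛ ((con (+ 1) ⊕ y) ⊛ (Q ⊛ y))) S.refl p (Q ^ n) Q t ⟩
      p * t * ((1# + Q ^ n) * (Q * Q ^ n)) ∎
      where
      open ≈-Reasoning
      p t : Series
      p = ⟨ - 1# ⨾q^ 1 ⟩ n
      t = q ^ (n ℕ.* suc n / 2)
      exponent : suc n ℕ.* suc (suc n) / 2 ≡ suc n ℕ.+ n ℕ.* suc n / 2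
      exponent = ≡.trans (tri-/2 (suc n)) (cong (λ x → suc n ℕ.+ x) (≡.sym (tri-/2 n)))

    telescope : ∀ n → w n * ((1# + Z * Q) * (1# - Z⁻ * Q ^ n) - Z * Q * (1# + Z) * (1# - Z * (Q * Q ^ n)))
      ≈ (1# - Z * Z * Q) * (w n * ((1# - Z⁻ * Q ^ n) * (1# - Z * (Q * Q ^ n))) - w (suc n))
    telescope n = S.trans
      (S.*-congˡ {w n} (S.sym (+zz⁻-1 ((1# + Z * Q) * (1# - Z⁻ * y) - Z * Q * (1# + Z) * (1# - Z * (Q * y)))
        ((1# - Z * Z * Q) * (Q * y * y) + Z * (Q * y) + Q * y))))
      (S.trans
        (solve 5 (λ z z′ Q y w →
            w ⊛ ((con (+ 1) ⊕ z ⊛ Q) ⊛ (con (+ 1) ⊖ z′ ⊛ y) ⊖ z ⊛ Q ⊛ (con (+ 1) ⊕ z) ⊛ (con (+ 1) ⊖ z ⊛ (Q ⊛ y))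
              ⊕ (z ⊛ z′ ⊖ con (+ 1)) ⊛ ((con (+ 1) ⊖ z ⊛ z ⊛ Q) ⊛ (Q ⊛ y ⊛ y) ⊕ z ⊛ (Q ⊛ y) ⊕ Q ⊛ y))
            := (con (+ 1) ⊖ z ⊛ z ⊛ Q) ⊛ (w ⊛ ((con (+ 1) ⊖ z′ ⊛ y) ⊛ (con (+ 1) ⊖ z ⊛ (Q ⊛ y))) ⊖ w ⊛ ((con (+ 1) ⊕ y) ⊛ (Q ⊛ y))))
          S.refl Z Z⁻ Q y (w n))
        (S.*-congˡ {1# - Z * Z * Q} (S.+-congˡ {w n * ((1# - Z⁻ * y) * (1# - Z * (Q * y)))} (S.-‿cong (S.sym (ratio n))))))
      where
      y : Series
      y = Q ^ n

    w0≈1 : w 0 ≈ 1#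
    w0≈1 = S.*-identityˡ 1#

    F′ : Series
    F′ = (1# + Z * Q) * W.F′

  open W public using (product≈F)

  -- For `W.F` the functional equation has the coefficients 1 + zq and zq (1 + z). Multiplication by
  -- 1 + z, which becomes 1 + zq under z ↦ zq, absorbs them and leaves 1 and zq, hence a recurrence
  -- with a single further coefficient.
  F : Series
  F = (1# + Z) * W.F

  private
    F≈ : F ≈ W.F + Z * W.F
    F≈ = S.trans (S.distribʳ W.F 1# Z) (S.+-congʳ {Z * W.F} (S.*-identityˡ W.F))

    F-shift : Substitution (+ 1) (+ 1) F F′
    F-shift = subst-resp
      (S.trans (S.+-congˡ {W.F} (S.*-congˡ {Z} (S.*-identityˡ W.F))) (S.sym F≈))
      (solve 3 (λ z Q f → f ⊕ z ⊛ (Q ⊛ f) := (con (+ 1) ⊕ z ⊛ Q) ⊛ f) S.refl Z Q W.F′)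
      (subst-+ W.F-shift (subst-monomial (+ 1) 0 1 refl W.F-shift))

    cf-F : ∀ k N → cf F k N ≡ cf W.F k N ℤ.+ cf W.F (k ℤ.- + 1) N
    cf-F k N = ≡.trans (cf-cong F≈ k N) (≡.trans (cf-+ W.F (Z * W.F) k N) (cong (λ x → cf W.F k N ℤ.+ x) (cf-z (+ 1) W.F k N)))

  -- Since 1 + z = z (1 + z⁻¹), the symmetry z ↔ z⁻¹ of `W.F` turns into one with centre 1/2.
  F-symmetric : ∀ k N → cf F (+ 1 ℤ.- k) N ≡ cf F k N
  F-symmetric k N = begin
    cf F (+ 1 ℤ.- k) N
      ≡⟨ cf-F (+ 1 ℤ.- k) N ⟩
    cf W.F (+ 1 ℤ.- k) N ℤ.+ cf W.F (+ 1 ℤ.- k ℤ.- + 1) N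
      ≡⟨ cong₂ (λ x y → cf W.F x N ℤ.+ cf W.F y N) (flip k) (flip′ k) ⟩
    cf W.F (ℤ.- (k ℤ.- + 1)) N ℤ.+ cf W.F (ℤ.- k) N
      ≡⟨ cong₂ ℤ._+_ (W.F-symmetric (k ℤ.- + 1) N) (W.F-symmetric k N) ⟩
    cf W.F (k ℤ.- + 1) N ℤ.+ cf W.F k N
      ≡⟨ ℤ.+-comm (cf W.F (k ℤ.- + 1) N) (cf W.F k N) ⟩
    cf W.F k N ℤ.+ cf W.F (k ℤ.- + 1) N
      ≡⟨ cf-F k N ⟨
    cf F k N ∎
    where
    open ≡-Reasoning
    flip : ∀ k → + 1 ℤ.- k ≡ ℤ.- (k ℤ.- + 1)
    flip = ℤ-Solver.solve-∀
    flip′ : ∀ k → + 1 ℤ.- k ℤ.- + 1 ≡ ℤ.- k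
    flip′ = ℤ-Solver.solve-∀

  -- The coefficient of z^(k+2) q^(N+1) in F(zq) - zq F(z) = (1 - z² q) `Φ 0`. The rows start at
  -- z^1: a step from z^0 would not lower the index of q, and `F-symmetric` recovers z^0 from z^1.
  recurrence : ∀ k N → cf F (+ suc k) N ≡ cf F (+ suc (suc k)) (N ℤ.- + suc k) ℤ.+ boundary k N
  recurrence k N = solve-for (cf F k₂ (N ℤ.- + suc k)) (cf F (+ suc k) N) (boundary k N) (begin
    cf F k₂ (N ℤ.- + suc k) ℤ.- cf F (+ suc k) N
      ≡⟨ cong₂ (λ x y → x ℤ.- y) (≡.trans (subst-row F-shift k₂ N′) (cong (cf F k₂) (step-back N (+ k))))
           (≡.trans (cf-zq F k₂ N′) (cong (cf F (+ suc k)) (step-back′ N))) ⟨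
    cf F′ k₂ N′ ℤ.- cf (Z * Q * F) k₂ N′
      ≡⟨ cf-- F′ (Z * Q * F) k₂ N′ ⟨
    cf (F′ - Z * Q * F) k₂ N′
      ≡⟨ cf-cong (S.+-congˡ {F′} (S.-‿cong (S.*-assoc (Z * Q) (1# + Z) W.F))) k₂ N′ ⟨
    cf (F′ - Z * Q * (1# + Z) * W.F) k₂ N′
      ≡⟨ cf-cong (W.functional-equation (1# + Z * Q) (Z * Q * (1# + Z)) (1# - Z * Z * Q) w0≈1 telescope) k₂ N′ ⟩
    cf ((1# - Z * Z * Q) * Φ 0) k₂ N′
      ≡⟨ 1-zzq-row k N ⟩
    ℤ.- boundary k N ∎)
    where
    open ≡-Reasoning
    k₂ N′ : ℤ
    k₂ = + suc (suc k)
    N′ = N ℤ.+ + 1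

-- The inhomogeneous term of the recurrence for K.
boundary₂ : ℕ → ℤ → ℤ
boundary₂ k N = mono k (2 ℕ.* tri k) N ℤ.- mono k (suc (2 ℕ.* k) ℕ.+ 2 ℕ.* tri k) N

-- The recurrence for K

module K-function where

  w : ℕ → Series
  w n = -1^ n * ⟨ q ⨾q^ 2 ⟩ n * q ^ (n ℕ.* n)

  private
    module W = Weighted 2 w (λ n → ∈q^-*ˡ (-1^ n * ⟨ q ⨾q^ 2 ⟩ n) (∈q^-mono (n≤n*n n) (q^-∈q^ (n ℕ.* n))))
      (λ n → zfree-* (zfree-* (zfree--1^ n) (zfree-pochhammer 2 n (zfree-resp (S.*-identityʳ q) (zfree-q^ 1)))) (zfree-q^ (n ℕ.* n)))
    open TripleProduct 2

    ratio : ∀ n → w (suc n) ≈ w n * (- (q * Q ^ n * (1# - q * Q ^ n)))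
    ratio n = begin
      (- 1#) * -1^ n * ⟨ q ⨾q^ 2 ⟩ (suc n) * q ^ (suc n ℕ.* suc n)
        ≈⟨ S.*-cong (S.*-congˡ {(- 1#) * -1^ n} (pochhammer-suc q 2 n)) (S.trans (q^-square n) (S.*-congˡ {q ^ (n ℕ.* n)} (S.*-congˡ {q} (S.sym (q^2^ n))))) ⟩
      (- 1#) * -1^ n * (p * (1# - q * Q ^ n)) * (q ^ (n ℕ.* n) * (q * Q ^ n))
        ≈⟨ solve 5 (λ s p q y t → (⊝ con (+ 1)) ⊛ s ⊛ (p ⊛ (con (+ 1) ⊖ q ⊛ y)) ⊛ (t ⊛ (q ⊛ y))
             := s ⊛ p ⊛ t ⊛ (⊝ (q ⊛ y ⊛ (con (+ 1) ⊖ q ⊛ y)))) S.refl (-1^ n) p q (Q ^ n) (q ^ (n ℕ.* n)) ⟩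
      -1^ n * p * q ^ (n ℕ.* n) * (- (q * Q ^ n * (1# - q * Q ^ n))) ∎
      where
      open ≈-Reasoning
      p : Series
      p = ⟨ q ⨾q^ 2 ⟩ n

    telescope : ∀ n → w n * (1# * (1# - Z⁻ * Q ^ n) - (- (Z * q)) * (1# - Z * (Q * Q ^ n)))
      ≈ (1# + Z * q) * (w n * ((1# - Z⁻ * Q ^ n) * (1# - Z * (Q * Q ^ n))) - w (suc n))
    telescope n = S.trans
      (S.*-congˡ {w n} (S.sym (+zz⁻-1 (1# * (1# - Z⁻ * y) - (- (Z * q)) * (1# - Z * (Q * y)))
        ((1# + Z * q) * (Q * y * y) - q * y))))
      (S.trans
        -- The identity depends on Q = q², so Q is unfolded here instead of being a variable of its
        -- own.
        (solve 5 (λ z z′ q y w → let Q = q ⊛ (q ⊛ con (+ 1)) in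
            w ⊛ (con (+ 1) ⊛ (con (+ 1) ⊖ z′ ⊛ y) ⊖ (⊝ (z ⊛ q)) ⊛ (con (+ 1) ⊖ z ⊛ (Q ⊛ y))
              ⊕ (z ⊛ z′ ⊖ con (+ 1)) ⊛ ((con (+ 1) ⊕ z ⊛ q) ⊛ (Q ⊛ y ⊛ y) ⊖ q ⊛ y))
            := (con (+ 1) ⊕ z ⊛ q) ⊛ (w ⊛ ((con (+ 1) ⊖ z′ ⊛ y) ⊛ (con (+ 1) ⊖ z ⊛ (Q ⊛ y))) ⊖ w ⊛ (⊝ (q ⊛ y ⊛ (con (+ 1) ⊖ q ⊛ y)))))
          S.refl Z Z⁻ q y (w n))
        (S.*-congˡ {1# + Z * q} (S.+-congˡ {w n * ((1# - Z⁻ * y) * (1# - Z * (Q * y)))} (S.-‿cong (S.sym (ratio n))))))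
      where
      y : Series
      y = Q ^ n

    w0≈1 : w 0 ≈ 1#
    w0≈1 = S.trans (S.*-identityʳ (1# * 1#)) (S.*-identityˡ 1#)

    cf-zq′ : ∀ f k N → cf (Z * q * f) k N ≡ cf f (k ℤ.- + 1) (N ℤ.- + 1)
    cf-zq′ f k N = ≡.trans (cf-cong (S.*-congʳ {f} (S.*-congˡ {Z} (S.sym (S.*-identityʳ q)))) k N) (cf-zq f k N)

  open W public using (F; F-symmetric; product≈F)

  -- The coefficient of z^(k+1) q^(N+1) in F(zq²) + zq F(z) = (1 + zq) `Φ 0`; the shift 2k + 1 is 2
  -- (k + 1) - 1.
  recurrence : ∀ k N → cf F (+ k) N ≡ ℤ.- cf F (+ suc k) (N ℤ.- + suc (2 ℕ.* k)) ℤ.+ boundary₂ k N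
  recurrence k N = isolate (cf F k₁ (N ℤ.- + suc (2 ℕ.* k))) (cf F (+ k) N) (mono k (2 ℕ.* tri k) N) (mono k (suc (2 ℕ.* k) ℕ.+ 2 ℕ.* tri k) N) (begin
    cf F k₁ (N ℤ.- + suc (2 ℕ.* k)) ℤ.+ cf F (+ k) N
      ≡⟨ cong₂ ℤ._+_ (≡.trans (subst-row W.F-shift k₁ N′) (cong (cf F k₁) (≡.trans (back N (+ k)) (cong (λ x → N ℤ.- (+ 1 ℤ.+ x)) (≡.sym (ℤ.pos-* 2 k))))))
           (≡.trans (cf-zq′ F k₁ N′) (cong (cf F (+ k)) (step-back′ N))) ⟨
    cf W.F′ k₁ N′ ℤ.+ cf (Z * q * F) k₁ N′
      ≡⟨ cf-+ W.F′ (Z * q * F) k₁ N′ ⟨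
    cf (W.F′ + Z * q * F) k₁ N′
      ≡⟨ cf-cong (solve 4 (λ z q f f′ → f′ ⊕ z ⊛ q ⊛ f := con (+ 1) ⊛ f′ ⊖ (⊝ (z ⊛ q)) ⊛ f) S.refl Z q F W.F′) k₁ N′ ⟩
    cf (1# * W.F′ - (- (Z * q)) * F) k₁ N′
      ≡⟨ cf-cong (W.functional-equation 1# (- (Z * q)) (1# + Z * q) w0≈1 telescope) k₁ N′ ⟩
    cf ((1# + Z * q) * Φ 0) k₁ N′
      ≡⟨ cf-cong (S.trans (S.distribʳ (Φ 0) 1# (Z * q)) (S.+-congʳ {Z * q * Φ 0} (S.*-identityˡ (Φ 0)))) k₁ N′ ⟩
    cf (Φ 0 + Z * q * Φ 0) k₁ N′
      ≡⟨ ≡.trans (cf-+ (Φ 0) (Z * q * Φ 0) k₁ N′) (cong₂ ℤ._+_ (cf-Φ₀ (suc k) N′)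
           (≡.trans (cf-zq′ (Φ 0) k₁ N′) (≡.trans (cong (cf (Φ 0) (+ k)) (step-back′ N)) (cf-Φ₀ k N)))) ⟩
    mono (suc k) (2 ℕ.* tri (suc k)) N′ ℤ.+ mono k (2 ℕ.* tri k) N
      ≡⟨ cong (λ x → x ℤ.+ mono k (2 ℕ.* tri k) N) (≡.trans (mono-suc k (2 ℕ.* tri (suc k)) N′)
           (cong ℤ.-_ (≡.trans (cong (λ e → mono k e N′) (expand k (tri k)))
             (≡.trans (mono-shift k 1 (suc (2 ℕ.* k) ℕ.+ 2 ℕ.* tri k) N′) (cong (mono k (suc (2 ℕ.* k) ℕ.+ 2 ℕ.* tri k)) (step-back′ N)))))) ⟩
    ℤ.- mono k (suc (2 ℕ.* k) ℕ.+ 2 ℕ.* tri k) N ℤ.+ mono k (2 ℕ.* tri k) N ∎)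
    where
    open ≡-Reasoning
    k₁ N′ : ℤ
    k₁ = + suc k
    N′ = N ℤ.+ + 1
    back : ∀ N k → N ℤ.+ + 1 ℤ.- + 2 ℤ.* (+ 1 ℤ.+ k) ≡ N ℤ.- (+ 1 ℤ.+ + 2 ℤ.* k)
    back = ℤ-Solver.solve-∀
    expand : ∀ k t → 2 ℕ.* (suc k ℕ.+ t) ≡ 1 ℕ.+ (suc (2 ℕ.* k) ℕ.+ 2 ℕ.* t)
    expand = ℕ-Solver.solve-∀
    isolate : ∀ x y a b → x ℤ.+ y ≡ ℤ.- b ℤ.+ a → y ≡ ℤ.- x ℤ.+ (a ℤ.- b)
    isolate x y a b h = ≡.trans (rearrange x y) (≡.trans (cong (λ t → ℤ.- x ℤ.+ t) h) (cong (λ t → ℤ.- x ℤ.+ t) (ℤ.+-comm (ℤ.- b) a)))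
      where
      rearrange : ∀ x y → y ≡ ℤ.- x ℤ.+ (x ℤ.+ y)
      rearrange = ℤ-Solver.solve-∀

-- Finite sums of integers

∑< : ℕ → (ℕ → ℤ) → ℤ
∑< zero    g = ℤ.0ℤ
∑< (suc n) g = g 0 ℤ.+ ∑< n (g ∘ suc)

∑<-cong : ∀ n {f g : ℕ → ℤ} → (∀ i → i < n → f i ≡ g i) → ∑< n f ≡ ∑< n g
∑<-cong zero    h = refl
∑<-cong (suc n) h = cong₂ ℤ._+_ (h 0 (s≤s z≤n)) (∑<-cong n λ i i<n → h (suc i) (s≤s i<n))

∑<-zero : ∀ n {f : ℕ → ℤ} → (∀ i → i < n → f i ≡ ℤ.0ℤ) → ∑< n f ≡ ℤ.0ℤ
∑<-zero zero    h = refl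
∑<-zero (suc n) h = cong₂ ℤ._+_ (h 0 (s≤s z≤n)) (∑<-zero n λ i i<n → h (suc i) (s≤s i<n))

∑<-+ : ∀ n (f g : ℕ → ℤ) → ∑< n (λ i → f i ℤ.+ g i) ≡ ∑< n f ℤ.+ ∑< n g
∑<-+ zero    f g = refl
∑<-+ (suc n) f g = ≡.trans (cong (λ x → f 0 ℤ.+ g 0 ℤ.+ x) (∑<-+ n (f ∘ suc) (g ∘ suc))) (interchange (f 0) (g 0) (∑< n (f ∘ suc)) (∑< n (g ∘ suc)))
  where
  interchange : ∀ a b c d → a ℤ.+ b ℤ.+ (c ℤ.+ d) ≡ a ℤ.+ c ℤ.+ (b ℤ.+ d)
  interchange = ℤ-Solver.solve-∀

∑<-neg : ∀ n (f : ℕ → ℤ) → ∑< n (λ i → ℤ.- f i) ≡ ℤ.- ∑< n f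
∑<-neg zero    f = refl
∑<-neg (suc n) f = ≡.trans (cong (λ x → ℤ.- f 0 ℤ.+ x) (∑<-neg n (f ∘ suc))) (≡.sym (ℤ.neg-distrib-+ (f 0) (∑< n (f ∘ suc))))

∑<-suc : ∀ n (f : ℕ → ℤ) → ∑< (suc n) f ≡ ∑< n f ℤ.+ f n
∑<-suc zero    f = ℤ.+-comm (f 0) ℤ.0ℤ
∑<-suc (suc n) f = ≡.trans (cong (λ x → f 0 ℤ.+ x) (∑<-suc n (f ∘ suc))) (≡.sym (ℤ.+-assoc (f 0) (∑< n (f ∘ suc)) (f (suc n))))

∑<-split : ∀ m n (f : ℕ → ℤ) → ∑< (m ℕ.+ n) f ≡ ∑< m f ℤ.+ ∑< n (λ i → f (m ℕ.+ i))
∑<-split zero    n f = ≡.sym (ℤ.+-identityˡ _)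
∑<-split (suc m) n f = ≡.trans (cong (λ x → f 0 ℤ.+ x) (∑<-split m n (f ∘ suc))) (≡.sym (ℤ.+-assoc (f 0) _ _))

∑<-reverse : ∀ n (f : ℕ → ℤ) → ∑< n (λ i → f (n ∸ i)) ≡ ∑< n (f ∘ suc)
∑<-reverse zero    f = refl
∑<-reverse (suc n) f = ≡.trans (cong (λ x → f (suc n) ℤ.+ x) (∑<-reverse n f))
  (≡.trans (ℤ.+-comm (f (suc n)) (∑< n (f ∘ suc))) (≡.sym (∑<-suc n (f ∘ suc))))

∑<-pairs : ∀ n (f : ℕ → ℤ) → ∑< (n ℕ.* 2) f ≡ ∑< n (λ i → f (i ℕ.* 2) ℤ.+ f (suc (i ℕ.* 2)))
∑<-pairs zero    f = refl
∑<-pairs (suc n) f = ≡.trans (≡.sym (ℤ.+-assoc (f 0) (f 1) _)) (cong (λ x → f 0 ℤ.+ f 1 ℤ.+ x) (∑<-pairs n (f ∘ suc ∘ suc)))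

∑<-single : ∀ n m (f : ℕ → ℤ) → m < n → (∀ i → i < n → i ≢ m → f i ≡ ℤ.0ℤ) → ∑< n f ≡ f m
∑<-single (suc n) zero    f m<n       h = ≡.trans (cong (λ x → f 0 ℤ.+ x) (∑<-zero n λ i i<n → h (suc i) (s≤s i<n) λ ())) (ℤ.+-identityʳ (f 0))
∑<-single (suc n) (suc m) f (s≤s m<n) h = ≡.trans
  (cong₂ ℤ._+_ (h 0 (s≤s z≤n) λ ()) (∑<-single n m (f ∘ suc) m<n λ i i<n i≢m → h (suc i) (s≤s i<n) (i≢m ∘ ℕ.suc-injective)))
  (ℤ.+-identityˡ (f (suc m)))

∑<-remove : ∀ n m (f g : ℕ → ℤ) → m < n → g m ≡ ℤ.0ℤ → (∀ i → i ≢ m → f i ≡ g i) → ∑< n f ≡ ∑< n g ℤ.+ f m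
∑<-remove n m f g m<n gm≡0 h = begin
  ∑< n f                                          ≡⟨ ∑<-cong n (λ i _ → add-sub (f i) (g i)) ⟩
  ∑< n (λ i → g i ℤ.+ (f i ℤ.- g i))              ≡⟨ ∑<-+ n g (λ i → f i ℤ.- g i) ⟩
  ∑< n g ℤ.+ ∑< n (λ i → f i ℤ.- g i)             ≡⟨ cong (λ x → ∑< n g ℤ.+ x) (∑<-single n m (λ i → f i ℤ.- g i) m<n λ i _ i≢m →
                                                       ≡.trans (cong (λ x → x ℤ.- g i) (h i i≢m)) (ℤ.+-inverseʳ (g i))) ⟩
  ∑< n g ℤ.+ (f m ℤ.- g m)                        ≡⟨ cong (λ x → ∑< n g ℤ.+ (f m ℤ.- x)) gm≡0 ⟩
  ∑< n g ℤ.+ (f m ℤ.- ℤ.0ℤ)                       ≡⟨ cong (λ x → ∑< n g ℤ.+ x) (ℤ.+-identityʳ (f m)) ⟩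
  ∑< n g ℤ.+ f m                                  ∎
  where
  open ≡-Reasoning
  add-sub : ∀ x y → x ≡ y ℤ.+ (x ℤ.- y)
  add-sub = ℤ-Solver.solve-∀

-- A double sum with terms vanishing off the curve i ↦ (φ i , ψ i) reduces to a sum along the curve.
-- Each n carries at most one of its points because φ is injective, so the induction on `I` may set
-- the entire row n = φ I to zero. Points from `I` on contribute nothing, hence `M` has to exceed φ
-- only below `I`.
∑<-curve : ∀ (h : ℕ → ℕ → ℤ) (b φ ψ : ℕ → ℕ) M I →
  (∀ {i i′} → φ i ≡ φ i′ → i ≡ i′) → (∀ i → ψ i < b (φ i)) →
  (∀ n j → j < b n → (∃ λ i → n ≡ φ i × j ≡ ψ i) ⊎ h n j ≡ ℤ.0ℤ) →
  (∀ i → i < I → φ i < M) → (∀ i → I ≤ i → h (φ i) (ψ i) ≡ ℤ.0ℤ) →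
  ∑< M (λ n → ∑< (b n) (h n)) ≡ ∑< I (λ i → h (φ i) (ψ i))
∑<-curve h b φ ψ M zero    inj ψ<b support φ<M tail = ∑<-zero M λ n _ → ∑<-zero (b n) λ j j<b → vanishes n j (support n j j<b)
  where
  vanishes : ∀ n j → (∃ λ i → n ≡ φ i × j ≡ ψ i) ⊎ h n j ≡ ℤ.0ℤ → h n j ≡ ℤ.0ℤ
  vanishes n j (inj₁ (i , refl , refl)) = tail i z≤n
  vanishes n j (inj₂ hnj≡0)             = hnj≡0
∑<-curve h b φ ψ M (suc I) inj ψ<b support φ<M tail = begin
  ∑< M (λ n → ∑< (b n) (h n))
    ≡⟨ ∑<-remove M (φ I) (λ n → ∑< (b n) (h n)) (λ n → ∑< (b n) (h′ n)) (φ<M I ℕ.≤-refl)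
         (∑<-zero (b (φ I)) λ j _ → h′-hit j) (λ n n≢ → ∑<-cong (b n) λ j _ → ≡.sym (h′-miss n j n≢)) ⟩
  ∑< M (λ n → ∑< (b n) (h′ n)) ℤ.+ ∑< (b (φ I)) (h (φ I))
    ≡⟨ cong₂ ℤ._+_
         (∑<-curve h′ b φ ψ M I inj ψ<b support′ (λ i i<I → φ<M i (ℕ.m≤n⇒m≤1+n i<I)) tail′)
         (∑<-single (b (φ I)) (ψ I) (h (φ I)) (ψ<b I) (λ j j<b j≢ → off-curve j j≢ (support (φ I) j j<b))) ⟩
  ∑< I (λ i → h′ (φ i) (ψ i)) ℤ.+ h (φ I) (ψ I)
    ≡⟨ cong (λ x → x ℤ.+ h (φ I) (ψ I)) (∑<-cong I λ i i<I → h′-miss (φ i) (ψ i) (λ eq → ℕ.<-irrefl (inj eq) i<I)) ⟩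
  ∑< I (λ i → h (φ i) (ψ i)) ℤ.+ h (φ I) (ψ I)
    ≡⟨ ∑<-suc I (λ i → h (φ i) (ψ i)) ⟨
  ∑< (suc I) (λ i → h (φ i) (ψ i)) ∎
  where
  open ≡-Reasoning
  h′ : ℕ → ℕ → ℤ
  h′ n j = if does (n ℕ.≟ φ I) then ℤ.0ℤ else h n j
  h′-hit : ∀ j → h′ (φ I) j ≡ ℤ.0ℤ
  h′-hit j = cong (λ b → if b then ℤ.0ℤ else h (φ I) j) (dec-true (φ I ℕ.≟ φ I) refl)
  h′-miss : ∀ n j → n ≢ φ I → h′ n j ≡ h n j
  h′-miss n j n≢ = cong (λ b → if b then ℤ.0ℤ else h n j) (dec-false (n ℕ.≟ φ I) n≢)
  h′-0 : ∀ n j → h n j ≡ ℤ.0ℤ → h′ n j ≡ ℤ.0ℤ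
  h′-0 n j eq with does (n ℕ.≟ φ I)
  ... | true  = refl
  ... | false = eq
  support′ : ∀ n j → j < b n → (∃ λ i → n ≡ φ i × j ≡ ψ i) ⊎ h′ n j ≡ ℤ.0ℤ
  support′ n j j<b with support n j j<b
  ... | inj₁ on-curve = inj₁ on-curve
  ... | inj₂ hnj≡0    = inj₂ (h′-0 n j hnj≡0)
  off-curve : ∀ j → j ≢ ψ I → (∃ λ i → φ I ≡ φ i × j ≡ ψ i) ⊎ h (φ I) j ≡ ℤ.0ℤ → h (φ I) j ≡ ℤ.0ℤ
  off-curve j j≢ (inj₁ (i , eq , refl)) = ⊥-elim (j≢ (cong ψ (≡.sym (inj eq))))
  off-curve j j≢ (inj₂ eq)              = eq
  tail′ : ∀ i → I ≤ i → h′ (φ i) (ψ i) ≡ ℤ.0ℤ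
  tail′ i I≤i with ℕ.m≤n⇒m<n∨m≡n I≤i
  ... | inj₁ I<i  = h′-0 (φ i) (ψ i) (tail i I<i)
  ... | inj₂ refl = h′-hit (ψ I)

cf-partialSum : ∀ f n k N → cf (partialSum f n) k N ≡ ∑< n (λ i → cf (f i) k N)
cf-partialSum f zero    k N = cf-0 k N
cf-partialSum f (suc n) k N = ≡.trans (cf-+ (f 0) (partialSum (f ∘ suc) n) k N) (cong (λ x → cf (f 0) k N ℤ.+ x) (cf-partialSum (f ∘ suc) n k N))

-- Solving the recurrences

-- Each step of the recurrence raises the power of q, so the coefficient of q^N is settled after N steps.
recurrence-unique : ∀ (f : ℕ → ℤ → ℤ) (E : ℕ → ℕ → ℤ → ℤ) (φ ε : ℕ → ℕ) (σ : ℤ → ℤ) (h : ℕ → ℤ → ℤ) →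
  (∀ k {N} → N ℤ.< ℤ.0ℤ → f k N ≡ ℤ.0ℤ) → (∀ k N → E 0 k N ≡ ℤ.0ℤ) →
  (∀ k N → f k N ≡ σ (f (φ k) (N ℤ.- + suc (ε k))) ℤ.+ h k N) →
  (∀ I k N → E (suc I) k N ≡ σ (E I (φ k) (N ℤ.- + suc (ε k))) ℤ.+ h k N) →
  ∀ I k N → N ℤ.< + I → f k N ≡ E I k N
recurrence-unique f E φ ε σ h f<0 E0 f-rec E-rec zero    k N N<I = ≡.trans (f<0 k N<I) (≡.sym (E0 k N))
recurrence-unique f E φ ε σ h f<0 E0 f-rec E-rec (suc I) k N N<I = ≡.trans (f-rec k N) (≡.trans
  (cong (λ x → σ x ℤ.+ h k N) (recurrence-unique f E φ ε σ h f<0 E0 f-rec E-rec I (φ k) (N ℤ.- + suc (ε k)) N′<I))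
  (≡.sym (E-rec I k N)))
  where
  N′<I : N ℤ.- + suc (ε k) ℤ.< + I
  N′<I = ℤ.<-≤-trans (ℤ.+-monoˡ-< (ℤ.- + suc (ε k)) N<I)
    (≡.subst (ℤ._≤ + I) (≡.sym (ℤ.[1+m]⊖[1+n]≡m⊖n I (ε k))) (ℤ.m⊖n≤m I (ε k)))

-- The exponents in the z^k-coefficients of the three left-hand sides (of z^{k+1} for H), found by
-- iterating the recurrences.

e₁ e₁′ a e₄ : ℕ → ℕ → ℕ
e₁ k i = 3 ℕ.* (i ℕ.* i) ℕ.+ 3 ℕ.* (i ℕ.* k) ℕ.+ i ℕ.+ tri k
e₁′ k i = 3 ℕ.* (i ℕ.* i) ℕ.+ 3 ℕ.* (i ℕ.* k) ℕ.+ 5 ℕ.* i ℕ.+ (suc k ℕ.+ tri (suc k))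
a k i = i ℕ.* i ℕ.+ 2 ℕ.* (i ℕ.* k) ℕ.+ i ℕ.+ tri k
e₄ k i = tri i ℕ.+ 2 ℕ.* (i ℕ.* k) ℕ.+ 2 ℕ.* tri k

-- The i-th summand is the boundary term met at the i-th step, where k has become k + 2i for R and k
-- + i for H and K, times the power of q collected on the way. For H the second exponent of a step
-- is the first exponent of the next; for K all exponents are consecutive values of `e₄ k`, with
-- alternating signs.
solution₁ solution₂ solution₄ : ℕ → ℕ → ℤ → ℤ
solution₁ I k N = ∑< I (λ i → mono k (e₁ k i) N ℤ.- mono k (e₁′ k i) N)
solution₂ I k N = ∑< I (λ i → mono (i ℕ.+ k) (a k i) N ℤ.- mono (i ℕ.+ k) (a k (suc i)) N)
solution₄ I k N = ∑< I (λ i → mono k (e₄ k (i ℕ.* 2)) N ℤ.- mono k (e₄ k (suc (i ℕ.* 2))) N)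

R-rows : ∀ I k N → N ℤ.< + I → cf R-function.F (+ k) N ≡ solution₁ I k N
R-rows = recurrence-unique (λ k → cf R-function.F (+ k)) solution₁ (suc ∘ suc) (λ k → k) (λ x → x) boundary
  (λ k → cf-<0 R-function.F (+ k)) (λ k N → refl) R-function.recurrence step
  where
  step : ∀ I k N → solution₁ (suc I) k N ≡ solution₁ I (suc (suc k)) (N ℤ.- + suc k) ℤ.+ boundary k N
  step I k N = ≡.trans (ℤ.+-comm (boundary k N) _) (cong (λ x → x ℤ.+ boundary k N) (∑<-cong I λ i _ → cong₂ (λ x y → x ℤ.- y)
    (shift (e₁ k (suc i)) (e₁ (suc (suc k)) i) (exponent k i (tri k)))
    (shift (e₁′ k (suc i)) (e₁′ (suc (suc k)) i) (exponent′ k i (tri k)))))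
    where
    shift : ∀ e e′ → e ≡ suc k ℕ.+ e′ → mono k e N ≡ mono (suc (suc k)) e′ (N ℤ.- + suc k)
    shift e e′ refl = ≡.trans (mono-shift k (suc k) e′ N) (≡.sym (mono-2+ k e′ (N ℤ.- + suc k)))
    exponent : ∀ k i t → 3 ℕ.* (suc i ℕ.* suc i) ℕ.+ 3 ℕ.* (suc i ℕ.* k) ℕ.+ suc i ℕ.+ t
      ≡ suc k ℕ.+ (3 ℕ.* (i ℕ.* i) ℕ.+ 3 ℕ.* (i ℕ.* suc (suc k)) ℕ.+ i ℕ.+ (suc (suc k) ℕ.+ (suc k ℕ.+ t)))
    exponent = ℕ-Solver.solve-∀
    exponent′ : ∀ k i t → 3 ℕ.* (suc i ℕ.* suc i) ℕ.+ 3 ℕ.* (suc i ℕ.* k) ℕ.+ 5 ℕ.* suc i ℕ.+ (suc k ℕ.+ (suc k ℕ.+ t))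
      ≡ suc k ℕ.+ (3 ℕ.* (i ℕ.* i) ℕ.+ 3 ℕ.* (i ℕ.* suc (suc k)) ℕ.+ 5 ℕ.* i ℕ.+ (suc (suc (suc k)) ℕ.+ (suc (suc (suc k)) ℕ.+ (suc (suc k) ℕ.+ (suc k ℕ.+ t)))))
    exponent′ = ℕ-Solver.solve-∀

H-rows : ∀ I k N → N ℤ.< + I → cf H-function.F (+ suc k) N ≡ solution₂ I k N
H-rows = recurrence-unique (λ k → cf H-function.F (+ suc k)) solution₂ suc (λ k → k) (λ x → x) boundary
  (λ k → cf-<0 H-function.F (+ suc k)) (λ k N → refl) H-function.recurrence step
  where
  step : ∀ I k N → solution₂ (suc I) k N ≡ solution₂ I (suc k) (N ℤ.- + suc k) ℤ.+ boundary k N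
  step I k N = ≡.trans (ℤ.+-comm (mono k (a k 0) N ℤ.- mono k (a k 1) N) _) (cong₂ ℤ._+_
    (∑<-cong I λ i _ → cong₂ (λ x y → x ℤ.- y)
      (shift i (a k (suc i)) (a (suc k) i) (exponent k i (tri k)))
      (shift i (a k (suc (suc i))) (a (suc k) (suc i)) (exponent k (suc i) (tri k))))
    (cong (λ e → mono k (tri k) N ℤ.- mono k e N) (first k (tri k))))
    where
    shift : ∀ i e e′ → e ≡ suc k ℕ.+ e′ → mono (suc i ℕ.+ k) e N ≡ mono (i ℕ.+ suc k) e′ (N ℤ.- + suc k)
    shift i e e′ refl = ≡.trans (mono-shift (suc i ℕ.+ k) (suc k) e′ N) (cong (λ s → mono s e′ (N ℤ.- + suc k)) (≡.sym (ℕ.+-suc i k)))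
    exponent : ∀ k i t → suc i ℕ.* suc i ℕ.+ 2 ℕ.* (suc i ℕ.* k) ℕ.+ suc i ℕ.+ t
      ≡ suc k ℕ.+ (i ℕ.* i ℕ.+ 2 ℕ.* (i ℕ.* suc k) ℕ.+ i ℕ.+ (suc k ℕ.+ t))
    exponent = ℕ-Solver.solve-∀
    first : ∀ k t → 1 ℕ.* 1 ℕ.+ 2 ℕ.* (1 ℕ.* k) ℕ.+ 1 ℕ.+ t ≡ suc k ℕ.+ (suc k ℕ.+ t)
    first = ℕ-Solver.solve-∀

K-rows : ∀ I k N → N ℤ.< + I → cf K-function.F (+ k) N ≡ solution₄ I k N
K-rows = recurrence-unique (λ k → cf K-function.F (+ k)) solution₄ suc (λ k → 2 ℕ.* k) ℤ.-_ boundary₂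
  (λ k → cf-<0 K-function.F (+ k)) (λ k N → refl) K-function.recurrence step
  where
  step : ∀ I k N → solution₄ (suc I) k N ≡ ℤ.- solution₄ I (suc k) (N ℤ.- + suc (2 ℕ.* k)) ℤ.+ boundary₂ k N
  step I k N = ≡.trans (ℤ.+-comm (mono k (e₄ k 0) N ℤ.- mono k (e₄ k 1) N) _) (cong₂ ℤ._+_
    (≡.trans (∑<-cong I λ i _ → ≡.trans (cong₂ (λ x y → x ℤ.- y)
        (shift (e₄ k (suc (suc (i ℕ.* 2)))) (e₄ (suc k) (i ℕ.* 2)) (exponent k (i ℕ.* 2) (tri k) (tri (i ℕ.* 2))))
        (shift (e₄ k (suc (suc (suc (i ℕ.* 2))))) (e₄ (suc k) (suc (i ℕ.* 2))) (exponent k (suc (i ℕ.* 2)) (tri k) (tri (suc (i ℕ.* 2))))))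
        (≡.sym (ℤ.neg-distrib-+ (mono (suc k) (e₄ (suc k) (i ℕ.* 2)) N′) (ℤ.- mono (suc k) (e₄ (suc k) (suc (i ℕ.* 2))) N′))))
      (∑<-neg I (λ i → mono (suc k) (e₄ (suc k) (i ℕ.* 2)) N′ ℤ.- mono (suc k) (e₄ (suc k) (suc (i ℕ.* 2))) N′)))
    (cong (λ e → mono k (2 ℕ.* tri k) N ℤ.- mono k e N) (first k (tri k))))
    where
    N′ : ℤ
    N′ = N ℤ.- + suc (2 ℕ.* k)
    shift : ∀ e e′ → e ≡ suc (2 ℕ.* k) ℕ.+ e′ → mono k e N ≡ ℤ.- mono (suc k) e′ N′
    shift e e′ refl = ≡.trans (mono-shift k (suc (2 ℕ.* k)) e′ N)
      (≡.sym (≡.trans (cong ℤ.-_ (mono-suc k e′ N′)) (ℤ.neg-involutive (mono k e′ N′))))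
    exponent : ∀ k m t u → suc (suc m) ℕ.+ (suc m ℕ.+ u) ℕ.+ 2 ℕ.* (suc (suc m) ℕ.* k) ℕ.+ 2 ℕ.* t
      ≡ suc (2 ℕ.* k) ℕ.+ (u ℕ.+ 2 ℕ.* (m ℕ.* suc k) ℕ.+ 2 ℕ.* (suc k ℕ.+ t))
    exponent = ℕ-Solver.solve-∀
    first : ∀ k t → 1 ℕ.+ 2 ℕ.* (1 ℕ.* k) ℕ.+ 2 ℕ.* t ≡ suc (2 ℕ.* k) ℕ.+ 2 ℕ.* t
    first = ℕ-Solver.solve-∀

-- Coefficients of the Hecke-type double sums

cf-lim-cong : ∀ {s t f g} k k′ N → s ⟶ f → t ⟶ g → (∀ n → cf (s n) k N ≡ cf (t n) k′ N) → cf f k N ≡ cf g k′ N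
cf-lim-cong {s} {t} {f} {g} k k′ N s⟶f t⟶g h with cf-lim {t} {g} t⟶g k′ N
... | M , h′ = cf-lim-unique {s} {f} {k} {N} M s⟶f λ n M≤n → ≡.trans (h n) (h′ n M≤n)

zfree-signed : ∀ s e → ZFree (-1^ s * q ^ e)
zfree-signed s e = zfree-* (zfree--1^ s) (zfree-q^ e)

cf-signed-≢ : ∀ s e {k} N → k ≢ ℤ.0ℤ → cf (-1^ s * q ^ e) k N ≡ ℤ.0ℤ
cf-signed-≢ s e {k} N = zfree-row-≢0 (zfree-signed s e) k N

cf-signed-neg : ∀ s e k N → cf (-1^ s * q ^ e) (ℤ.- k) N ≡ cf (-1^ s * q ^ e) k N
cf-signed-neg s e k N with k ℤ.≟ ℤ.0ℤ
... | yes refl = refl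
... | no  k≢0  = ≡.trans (cf-signed-≢ s e N λ -k≡0 → k≢0 (≡.trans (≡.sym (ℤ.neg-involutive k)) (cong ℤ.-_ -k≡0)))
  (≡.sym (cf-signed-≢ s e N k≢0))

cf-single : ∀ s x e k N → cf (-1^ s * z^ x * q ^ e) k N ≡ cf (-1^ s * q ^ e) (k ℤ.- x) N
cf-single s x e k N = ≡.trans
  (cf-cong (solve 3 (λ s x e → s ⊛ x ⊛ e := x ⊛ (s ⊛ e)) S.refl (-1^ s) (z^ x) (q ^ e)) k N)
  (cf-z x (-1^ s * q ^ e) k N)

cf-pair : ∀ s x y e k N → cf (-1^ s * (z^ x + z^ y) * q ^ e) k N ≡ cf (-1^ s * q ^ e) (k ℤ.- x) N ℤ.+ cf (-1^ s * q ^ e) (k ℤ.- y) N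
cf-pair s x y e k N = ≡.trans
  (cf-cong (solve 4 (λ s x y e → s ⊛ (x ⊕ y) ⊛ e := s ⊛ x ⊛ e ⊕ s ⊛ y ⊛ e) S.refl (-1^ s) (z^ x) (z^ y) (q ^ e)) k N)
  (≡.trans (cf-+ (-1^ s * z^ x * q ^ e) (-1^ s * z^ y * q ^ e) k N) (cong₂ ℤ._+_ (cf-single s x e k N) (cf-single s y e k N)))

-- Each Hecke-type sum is cut into such sums, one for every monomial z^x in its terms; `s`, `e` and
-- `x` are the exponents of -1, q and z, and z^x appears as a shift of the row.
∑∑ : (s e : ℕ → ℕ → ℕ) (x : ℕ → ℕ → ℤ) (b : ℕ → ℕ) (k N : ℤ) → ℕ → ℤ
∑∑ s e x b k N M = ∑< M λ n → ∑< (b n) λ j → cf (-1^ s n j * q ^ e n j) (k ℤ.- x n j) N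

cf-singles : ∀ s e x b k N M → cf (partialSum (λ n → partialSum (λ j → -1^ s n j * z^ x n j * q ^ e n j) (b n)) M) k N ≡ ∑∑ s e x b k N M
cf-singles s e x b k N M = ≡.trans (cf-partialSum _ M k N) (∑<-cong M λ n _ →
  ≡.trans (cf-partialSum _ (b n) k N) (∑<-cong (b n) λ j _ → cf-single (s n j) (x n j) (e n j) k N))

cf-pairs : ∀ s e x y b k N M → cf (partialSum (λ n → partialSum (λ j → -1^ s n j * (z^ x n j + z^ y n j) * q ^ e n j) (b n)) M) k N
  ≡ ∑∑ s e x b k N M ℤ.+ ∑∑ s e y b k N M
cf-pairs s e x y b k N M = ≡.trans (cf-partialSum _ M k N) (≡.trans (∑<-cong M λ n _ →
    ≡.trans (cf-partialSum _ (b n) k N) (≡.trans (∑<-cong (b n) λ j _ → cf-pair (s n j) (x n j) (y n j) (e n j) k N)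
      (∑<-+ (b n) (λ j → cf (-1^ s n j * q ^ e n j) (k ℤ.- x n j) N) (λ j → cf (-1^ s n j * q ^ e n j) (k ℤ.- y n j) N))))
  (∑<-+ M (λ n → ∑< (b n) λ j → cf (-1^ s n j * q ^ e n j) (k ℤ.- x n j) N) (λ n → ∑< (b n) λ j → cf (-1^ s n j * q ^ e n j) (k ℤ.- y n j) N)))

partialSum-+ : ∀ f g n → partialSum (λ i → f i + g i) n ≈ partialSum f n + partialSum g n
partialSum-+ f g zero    = S.sym (S.+-identityˡ 0#)
partialSum-+ f g (suc n) = S.trans (S.+-congˡ {f 0 + g 0} (partialSum-+ (f ∘ suc) (g ∘ suc) n))
  (solve 4 (λ a b c d → a ⊕ b ⊕ (c ⊕ d) := a ⊕ c ⊕ (b ⊕ d)) S.refl (f 0) (g 0) (partialSum (f ∘ suc) n) (partialSum (g ∘ suc) n))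

∑∑-flip : ∀ s e x y b k k′ N M → (∀ n j → k ℤ.- x n j ≡ ℤ.- (k′ ℤ.- y n j)) → ∑∑ s e x b k N M ≡ ∑∑ s e y b k′ N M
∑∑-flip s e x y b k k′ N M h = ∑<-cong M λ n _ → ∑<-cong (b n) λ j _ →
  ≡.trans (cong (λ x → cf (-1^ s n j * q ^ e n j) x N) (h n j)) (cf-signed-neg (s n j) (e n j) (k′ ℤ.- y n j) N)

∑∑-empty : ∀ s e x b {k} N M → (∀ n j → j < b n → x n j ≢ k) → ∑∑ s e x b k N M ≡ ℤ.0ℤ
∑∑-empty s e x b N M h = ∑<-zero M λ n _ → ∑<-zero (b n) λ j j<b →
  cf-signed-≢ (s n j) (e n j) N λ k-x≡0 → h n j j<b (≡.sym (ℤ.i-j≡0⇒i≡j _ _ k-x≡0))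

-- The terms with z^k lie on the line n = (c + 1) i + o, j = ψ i, where sign and exponent of q are
-- given by `σ i` and `ε i`. For i ≥ I we have N < I ≤ i ≤ ε i, so these terms do not reach q^N and
-- the value no longer depends on `M`.
∑∑-curve : ∀ s e x b {k} N M I c o (ψ σ ε : ℕ → ℕ) → let φ = λ i → suc c ℕ.* i ℕ.+ o in
  N ℤ.< + I → suc c ℕ.* I ℕ.+ o ≤ M → (∀ i → ψ i < b (φ i)) →
  (∀ n j → j < b n → x n j ≡ k → ∃ λ i → n ≡ φ i × j ≡ ψ i) →
  (∀ i → x (φ i) (ψ i) ≡ k) → (∀ i → ∃ λ m → s (φ i) (ψ i) ≡ m ℕ.* 2 ℕ.+ σ i) →
  (∀ i → e (φ i) (ψ i) ≡ ε i) → (∀ i → i ≤ ε i) →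
  ∑∑ s e x b k N M ≡ ∑< I (λ i → mono (σ i) (ε i) N)
∑∑-curve s e x b {k} N M I c o ψ σ ε N<I φI≤M ψ<b support hit parity exponent i≤ε = ≡.trans
  (∑<-curve (λ n j → cf (-1^ s n j * q ^ e n j) (k ℤ.- x n j) N) b φ ψ M I φ-injective ψ<b support′
    (λ i i<I → ℕ.<-≤-trans (ℕ.+-monoˡ-< o (ℕ.*-monoʳ-< (suc c) i<I)) φI≤M)
    (λ i I≤i → ≡.trans (value i) (mono-< (σ i) (ε i) (ℤ.<-≤-trans N<I (ℤ.+≤+ (ℕ.≤-trans I≤i (i≤ε i)))))))
  (∑<-cong I λ i _ → value i)
  where
  φ : ℕ → ℕ
  φ i = suc c ℕ.* i ℕ.+ o
  φ-injective : ∀ {i i′} → φ i ≡ φ i′ → i ≡ i′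
  φ-injective {i} {i′} eq = ℕ.*-cancelˡ-≡ i i′ (suc c) (ℕ.+-cancelʳ-≡ o (suc c ℕ.* i) (suc c ℕ.* i′) eq)
  support′ : ∀ n j → j < b n → (∃ λ i → n ≡ φ i × j ≡ ψ i) ⊎ cf (-1^ s n j * q ^ e n j) (k ℤ.- x n j) N ≡ ℤ.0ℤ
  support′ n j j<b with x n j ℤ.≟ k
  ... | yes x≡k = inj₁ (support n j j<b x≡k)
  ... | no  x≢k = inj₂ (cf-signed-≢ (s n j) (e n j) N λ k-x≡0 → x≢k (≡.sym (ℤ.i-j≡0⇒i≡j _ _ k-x≡0)))
  value : ∀ i → cf (-1^ s (φ i) (ψ i) * q ^ e (φ i) (ψ i)) (k ℤ.- x (φ i) (ψ i)) N ≡ mono (σ i) (ε i) N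
  value i with parity i
  ... | m , parity≡ = begin
    cf (-1^ s (φ i) (ψ i) * q ^ e (φ i) (ψ i)) (k ℤ.- x (φ i) (ψ i)) N
      ≡⟨ cong (λ y → cf (-1^ s (φ i) (ψ i) * q ^ e (φ i) (ψ i)) y N) (ℤ.i≡j⇒i-j≡0 (≡.sym (hit i))) ⟩
    mono (s (φ i) (ψ i)) (e (φ i) (ψ i)) N
      ≡⟨ cong₂ (λ t u → mono t u N) parity≡ (exponent i) ⟩
    mono (m ℕ.* 2 ℕ.+ σ i) (ε i) N
      ≡⟨ mono-even m (σ i) (ε i) N ⟩
    mono (σ i) (ε i) N ∎
    where open ≡-Reasoning

diff⇒ : ∀ m n {p} → + m ℤ.- + n ≡ + p → m ≡ p ℕ.+ n
diff⇒ m n {p} eq = ℤ.+-injective (≡.trans (add (+ m) (+ n)) (cong (λ x → x ℤ.+ + n) eq))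
  where
  add : ∀ m n → m ≡ m ℤ.- n ℤ.+ n
  add = ℤ-Solver.solve-∀

⇒diff : ∀ {m} n p → m ≡ p ℕ.+ n → + m ℤ.- + n ≡ + p
⇒diff n p refl = cancel (+ p) (+ n)
  where
  cancel : ∀ p n → p ℤ.+ n ℤ.- n ≡ p
  cancel = ℤ-Solver.solve-∀

≤-by : ∀ {m n} r → n ≡ m ℕ.+ r → m ≤ n
≤-by {m} r refl = ℕ.m≤m+n m r

*≤⇒≤/ : ∀ {j n} d .{{_ : NonZero d}} → j ℕ.* d ≤ n → j ≤ n / d
*≤⇒≤/ {j} {n} d le = ≡.subst (_≤ n / d) (m*n/n≡m j d) (/-monoˡ-≤ d le)

≤/⇒*≤ : ∀ {j} n d .{{_ : NonZero d}} → j ≤ n / d → j ℕ.* d ≤ n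
≤/⇒*≤ n d le = ℕ.≤-trans (ℕ.*-monoˡ-≤ d le) (m/n*n≤m n d)

-- Exponents (A - B + C) / 2, where the subtraction and the division are exact.
half-exponent : ∀ {A B C E} x P k → A ≡ x ℕ.+ B → x ℕ.+ C ≡ P ℕ.* 2 ℕ.+ k ℕ.* suc k → E ≡ P ℕ.+ tri k → (A ∸ B ℕ.+ C) / 2 ≡ E
half-exponent {_} {B} {C} {E} x P k refl x+C≡ E≡ = begin
  (x ℕ.+ B ∸ B ℕ.+ C) / 2            ≡⟨ cong (λ t → (t ℕ.+ C) / 2) (ℕ.m+n∸n≡m x B) ⟩
  (x ℕ.+ C) / 2                      ≡⟨ cong (_/ 2) x+C≡ ⟩
  (P ℕ.* 2 ℕ.+ k ℕ.* suc k) / 2      ≡⟨ cong (λ t → (P ℕ.* 2 ℕ.+ t) / 2) (tri-*2 k) ⟨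
  (P ℕ.* 2 ℕ.+ tri k ℕ.* 2) / 2      ≡⟨ cong (_/ 2) (ℕ.*-distribʳ-+ 2 P (tri k)) ⟨
  (P ℕ.+ tri k) ℕ.* 2 / 2            ≡⟨ m*n/n≡m (P ℕ.+ tri k) 2 ⟩
  P ℕ.+ tri k                        ≡⟨ E≡ ⟨
  E                                  ∎
  where open ≡-Reasoning

∸-by : ∀ {m n} r → m ≡ r ℕ.+ n → m ∸ n ≡ r
∸-by {n = n} r refl = ℕ.m+n∸n≡m r n

-- The double sum for R

module Hecke₁ where

  private
    -- The primed data belong to the second inner sum, whose index starts at 1 and is therefore
    -- written `suc j`.
    s e s′ e′ : ℕ → ℕ → ℕ
    s n j = n ℕ.+ j
    e n j = ((n ℕ.* n ∸ 3 ℕ.* (j ℕ.* j)) ℕ.+ (n ∸ j)) / 2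
    s′ n j = n ℕ.+ suc j
    e′ n j = ((n ℕ.* n ∸ 3 ℕ.* (suc j ℕ.* suc j)) ℕ.+ (n ℕ.+ suc j)) / 2

    x y x′ y′ : ℕ → ℕ → ℤ
    x n j = + n ℤ.- + (3 ℕ.* j)
    y n j = + (3 ℕ.* j) ℤ.- + n
    x′ n j = + n ℤ.- + (3 ℕ.* suc j) ℤ.+ + 1
    y′ n j = + (3 ℕ.* suc j) ℤ.- + n ℤ.- + 1

    b b′ : ℕ → ℕ
    b n = suc (n / 2)
    b′ n = n / 2

    cf-hecke₁ : ∀ k N M → cf (partialSum hecke₁ M) k N
      ≡ (∑∑ s e x b k N M ℤ.+ ∑∑ s e y b k N M) ℤ.+ (∑∑ s′ e′ x′ b′ k N M ℤ.+ ∑∑ s′ e′ y′ b′ k N M)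
    cf-hecke₁ k N M = ≡.trans (cf-cong (partialSum-+ (λ n → ∑[ j ∈ 0 ⋯ n / 2 ] t₁ n j) (λ n → ∑[ j ∈ 1 ⋯ n / 2 ] u₁ n j) M) k N)
      (≡.trans (cf-+ (partialSum (λ n → ∑[ j ∈ 0 ⋯ n / 2 ] t₁ n j) M) (partialSum (λ n → ∑[ j ∈ 1 ⋯ n / 2 ] u₁ n j) M) k N)
        (cong₂ ℤ._+_ (cf-pairs s e x y b k N M) (cf-pairs s′ e′ x′ y′ b′ k N M)))

  -- In every term the two exponents of z are opposite, so inverting z exchanges them.
  symmetric : ∀ k N → cf (∑∞ hecke₁ hecke₁-summable) (ℤ.- k) N ≡ cf (∑∞ hecke₁ hecke₁-summable) k N
  symmetric k N = cf-lim-cong {partialSum hecke₁} {partialSum hecke₁} {∑∞ hecke₁ hecke₁-summable} {∑∞ hecke₁ hecke₁-summable}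
    (ℤ.- k) k N (proj₂ hecke₁-summable) (proj₂ hecke₁-summable) λ M → begin
    cf (partialSum hecke₁ M) (ℤ.- k) N
      ≡⟨ cf-hecke₁ (ℤ.- k) N M ⟩
    (∑∑ s e x b (ℤ.- k) N M ℤ.+ ∑∑ s e y b (ℤ.- k) N M) ℤ.+ (∑∑ s′ e′ x′ b′ (ℤ.- k) N M ℤ.+ ∑∑ s′ e′ y′ b′ (ℤ.- k) N M)
      ≡⟨ cong₂ ℤ._+_
           (cong₂ ℤ._+_ (∑∑-flip s e x y b (ℤ.- k) k N M λ n j → flip k (+ n) (+ (3 ℕ.* j))) (∑∑-flip s e y x b (ℤ.- k) k N M λ n j → flip k (+ (3 ℕ.* j)) (+ n)))
           (cong₂ ℤ._+_ (∑∑-flip s′ e′ x′ y′ b′ (ℤ.- k) k N M λ n j → flip′ k (+ n) (+ (3 ℕ.* suc j))) (∑∑-flip s′ e′ y′ x′ b′ (ℤ.- k) k N M λ n j → flip″ k (+ n) (+ (3 ℕ.* suc j)))) ⟩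
    (∑∑ s e y b k N M ℤ.+ ∑∑ s e x b k N M) ℤ.+ (∑∑ s′ e′ y′ b′ k N M ℤ.+ ∑∑ s′ e′ x′ b′ k N M)
      ≡⟨ cong₂ ℤ._+_ (ℤ.+-comm (∑∑ s e y b k N M) (∑∑ s e x b k N M)) (ℤ.+-comm (∑∑ s′ e′ y′ b′ k N M) (∑∑ s′ e′ x′ b′ k N M)) ⟩
    (∑∑ s e x b k N M ℤ.+ ∑∑ s e y b k N M) ℤ.+ (∑∑ s′ e′ x′ b′ k N M ℤ.+ ∑∑ s′ e′ y′ b′ k N M)
      ≡⟨ cf-hecke₁ k N M ⟨
    cf (partialSum hecke₁ M) k N ∎
    where
    open ≡-Reasoning
    flip : ∀ k n m → ℤ.- k ℤ.- (n ℤ.- m) ≡ ℤ.- (k ℤ.- (m ℤ.- n))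
    flip = ℤ-Solver.solve-∀
    flip′ : ∀ k n m → ℤ.- k ℤ.- (n ℤ.- m ℤ.+ + 1) ≡ ℤ.- (k ℤ.- (m ℤ.- n ℤ.- + 1))
    flip′ = ℤ-Solver.solve-∀
    flip″ : ∀ k n m → ℤ.- k ℤ.- (m ℤ.- n ℤ.- + 1) ≡ ℤ.- (k ℤ.- (n ℤ.- m ℤ.+ + 1))
    flip″ = ℤ-Solver.solve-∀

  module _ (k : ℕ) (N : ℤ) (M I : ℕ) (N<I : N ℤ.< + I) (M-large : 3 ℕ.* I ℕ.+ (2 ℕ.* k ℕ.+ 2) ≤ M) where

    private
      -- The four lines below have the offsets k, 2k, k + 2 and 2k + 2, of which the last is the
      -- largest.
      large : ∀ o r → 2 ℕ.* k ℕ.+ 2 ≡ o ℕ.+ r → 3 ℕ.* I ℕ.+ o ≤ M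
      large o r eq = ℕ.≤-trans (ℕ.+-monoʳ-≤ (3 ℕ.* I) (≤-by r eq)) M-large

      i≤e₁ : ∀ i → i ≤ e₁ k i
      i≤e₁ i = ≤-by (3 ℕ.* (i ℕ.* i) ℕ.+ 3 ℕ.* (i ℕ.* k) ℕ.+ tri k) (regroup (3 ℕ.* (i ℕ.* i) ℕ.+ 3 ℕ.* (i ℕ.* k)) i (tri k))
        where
        regroup : ∀ p i t → p ℕ.+ i ℕ.+ t ≡ i ℕ.+ (p ℕ.+ t)
        regroup = ℕ-Solver.solve-∀

      i≤e₁′ : ∀ i → i ≤ e₁′ k i
      i≤e₁′ i = ≤-by (3 ℕ.* (i ℕ.* i) ℕ.+ 3 ℕ.* (i ℕ.* k) ℕ.+ 4 ℕ.* i ℕ.+ (suc k ℕ.+ tri (suc k)))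
        (regroup (3 ℕ.* (i ℕ.* i) ℕ.+ 3 ℕ.* (i ℕ.* k)) i (suc k ℕ.+ tri (suc k)))
        where
        regroup : ∀ p i t → p ℕ.+ 5 ℕ.* i ℕ.+ t ≡ i ℕ.+ (p ℕ.+ 4 ℕ.* i ℕ.+ t)
        regroup = ℕ-Solver.solve-∀

      e₁′≡ : ∀ i → e₁′ k i ≡ 3 ℕ.* (i ℕ.* i) ℕ.+ 3 ℕ.* (i ℕ.* k) ℕ.+ 5 ℕ.* i ℕ.+ 2 ℕ.* suc k ℕ.+ tri k
      e₁′≡ i = regroup (3 ℕ.* (i ℕ.* i) ℕ.+ 3 ℕ.* (i ℕ.* k) ℕ.+ 5 ℕ.* i) k (tri k)
        where
        regroup : ∀ p k t → p ℕ.+ (suc k ℕ.+ (suc k ℕ.+ t)) ≡ p ℕ.+ 2 ℕ.* suc k ℕ.+ t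
        regroup = ℕ-Solver.solve-∀

      sum-x : ∑∑ s e x b (+ k) N M ≡ ∑< I (λ i → mono k (e₁ k i) N)
      sum-x = ∑∑-curve s e x b N M I 2 k (λ i → i) (λ _ → k) (e₁ k) N<I (large k (k ℕ.+ 2) (size k))
        (λ i → s≤s (*≤⇒≤/ 2 (≤-by (i ℕ.+ k) (range i k))))
        (λ n j _ eq → j , ≡.trans (diff⇒ n (3 ℕ.* j) eq) (ℕ.+-comm k (3 ℕ.* j)) , refl)
        (λ i → ⇒diff (3 ℕ.* i) k (ℕ.+-comm (3 ℕ.* i) k))
        (λ i → 2 ℕ.* i , parity i k)
        (λ i → half-exponent (6 ℕ.* (i ℕ.* i) ℕ.+ 6 ℕ.* (i ℕ.* k) ℕ.+ k ℕ.* k) (3 ℕ.* (i ℕ.* i) ℕ.+ 3 ℕ.* (i ℕ.* k) ℕ.+ i) k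
          (square i k) (≡.trans (cong (λ t → 6 ℕ.* (i ℕ.* i) ℕ.+ 6 ℕ.* (i ℕ.* k) ℕ.+ k ℕ.* k ℕ.+ t) (∸-by (2 ℕ.* i ℕ.+ k) (linear i k))) (total i k)) refl)
        i≤e₁
        where
        size : ∀ k → 2 ℕ.* k ℕ.+ 2 ≡ k ℕ.+ (k ℕ.+ 2)
        size = ℕ-Solver.solve-∀
        range : ∀ i k → 3 ℕ.* i ℕ.+ k ≡ i ℕ.* 2 ℕ.+ (i ℕ.+ k)
        range = ℕ-Solver.solve-∀
        parity : ∀ i k → 3 ℕ.* i ℕ.+ k ℕ.+ i ≡ 2 ℕ.* i ℕ.* 2 ℕ.+ k
        parity = ℕ-Solver.solve-∀
        square : ∀ i k → (3 ℕ.* i ℕ.+ k) ℕ.* (3 ℕ.* i ℕ.+ k) ≡ 6 ℕ.* (i ℕ.* i) ℕ.+ 6 ℕ.* (i ℕ.* k) ℕ.+ k ℕ.* k ℕ.+ 3 ℕ.* (i ℕ.* i)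
        square = ℕ-Solver.solve-∀
        linear : ∀ i k → 3 ℕ.* i ℕ.+ k ≡ 2 ℕ.* i ℕ.+ k ℕ.+ i
        linear = ℕ-Solver.solve-∀
        total : ∀ i k → 6 ℕ.* (i ℕ.* i) ℕ.+ 6 ℕ.* (i ℕ.* k) ℕ.+ k ℕ.* k ℕ.+ (2 ℕ.* i ℕ.+ k) ≡ (3 ℕ.* (i ℕ.* i) ℕ.+ 3 ℕ.* (i ℕ.* k) ℕ.+ i) ℕ.* 2 ℕ.+ k ℕ.* suc k
        total = ℕ-Solver.solve-∀

      -- From 3j = k + n and 2j ≤ n follows j ≥ k, and j = i + k gives n = 3i + 2k. The map (n , j)
      -- ↦ (2n - 3j , n - 2j) preserves n² - 3j², n - j and the parity of n + j and carries the line
      -- of `sum-x` to this one. Hence every exponent occurs twice, which accounts for the factor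
      -- 1/2 in (1).
      sum-y : ∑∑ s e y b (+ k) N M ≡ ∑< I (λ i → mono k (e₁ k i) N)
      sum-y = ∑∑-curve s e y b N M I 2 (2 ℕ.* k) (λ i → i ℕ.+ k) (λ _ → k) (e₁ k) N<I (large (2 ℕ.* k) 2 refl)
        (λ i → s≤s (*≤⇒≤/ 2 (≤-by i (range i k))))
        support
        (λ i → ⇒diff (3 ℕ.* i ℕ.+ 2 ℕ.* k) k (position i k))
        (λ i → 2 ℕ.* i ℕ.+ k , parity i k)
        (λ i → half-exponent (6 ℕ.* (i ℕ.* i) ℕ.+ 6 ℕ.* (i ℕ.* k) ℕ.+ k ℕ.* k) (3 ℕ.* (i ℕ.* i) ℕ.+ 3 ℕ.* (i ℕ.* k) ℕ.+ i) k
          (square i k) (≡.trans (cong (λ t → 6 ℕ.* (i ℕ.* i) ℕ.+ 6 ℕ.* (i ℕ.* k) ℕ.+ k ℕ.* k ℕ.+ t) (∸-by (2 ℕ.* i ℕ.+ k) (linear i k))) (total i k)) refl)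
        i≤e₁
        where
        range : ∀ i k → 3 ℕ.* i ℕ.+ 2 ℕ.* k ≡ (i ℕ.+ k) ℕ.* 2 ℕ.+ i
        range = ℕ-Solver.solve-∀
        position : ∀ i k → 3 ℕ.* (i ℕ.+ k) ≡ k ℕ.+ (3 ℕ.* i ℕ.+ 2 ℕ.* k)
        position = ℕ-Solver.solve-∀
        parity : ∀ i k → 3 ℕ.* i ℕ.+ 2 ℕ.* k ℕ.+ (i ℕ.+ k) ≡ (2 ℕ.* i ℕ.+ k) ℕ.* 2 ℕ.+ k
        parity = ℕ-Solver.solve-∀
        square : ∀ i k → (3 ℕ.* i ℕ.+ 2 ℕ.* k) ℕ.* (3 ℕ.* i ℕ.+ 2 ℕ.* k)
          ≡ 6 ℕ.* (i ℕ.* i) ℕ.+ 6 ℕ.* (i ℕ.* k) ℕ.+ k ℕ.* k ℕ.+ 3 ℕ.* ((i ℕ.+ k) ℕ.* (i ℕ.+ k))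
        square = ℕ-Solver.solve-∀
        linear : ∀ i k → 3 ℕ.* i ℕ.+ 2 ℕ.* k ≡ 2 ℕ.* i ℕ.+ k ℕ.+ (i ℕ.+ k)
        linear = ℕ-Solver.solve-∀
        total : ∀ i k → 6 ℕ.* (i ℕ.* i) ℕ.+ 6 ℕ.* (i ℕ.* k) ℕ.+ k ℕ.* k ℕ.+ (2 ℕ.* i ℕ.+ k) ≡ (3 ℕ.* (i ℕ.* i) ℕ.+ 3 ℕ.* (i ℕ.* k) ℕ.+ i) ℕ.* 2 ℕ.+ k ℕ.* suc k
        total = ℕ-Solver.solve-∀
        support : ∀ n j → j < b n → y n j ≡ + k → ∃ λ i → n ≡ 3 ℕ.* i ℕ.+ 2 ℕ.* k × j ≡ i ℕ.+ k
        support n j (s≤s j≤n/2) eq = j ∸ k , ℕ.+-cancelˡ-≡ k n _ (begin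
            k ℕ.+ n                                   ≡⟨ 3j≡k+n ⟨
            3 ℕ.* j                                   ≡⟨ cong (3 ℕ.*_) (ℕ.m∸n+n≡m k≤j) ⟨
            3 ℕ.* (j ∸ k ℕ.+ k)                       ≡⟨ position (j ∸ k) k ⟩
            k ℕ.+ (3 ℕ.* (j ∸ k) ℕ.+ 2 ℕ.* k)         ∎) , ≡.sym (ℕ.m∸n+n≡m k≤j)
          where
          open ≡-Reasoning
          3j≡k+n : 3 ℕ.* j ≡ k ℕ.+ n
          3j≡k+n = diff⇒ (3 ℕ.* j) n eq
          triple : ∀ j → 3 ℕ.* j ≡ j ℕ.+ j ℕ.* 2
          triple = ℕ-Solver.solve-∀
          k≤j : k ≤ j
          k≤j = ℕ.+-cancelʳ-≤ (j ℕ.* 2) k j (ℕ.≤-trans (ℕ.+-monoʳ-≤ k (≤/⇒*≤ n 2 j≤n/2))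
            (ℕ.≤-reflexive (≡.trans (≡.sym 3j≡k+n) (triple j))))

      plus-one : ∀ n m → n ℤ.- m ℤ.+ + 1 ≡ + 1 ℤ.+ n ℤ.- m
      plus-one = ℤ-Solver.solve-∀

      minus-one : ∀ n m → m ℤ.- n ℤ.- + 1 ≡ m ℤ.- (+ 1 ℤ.+ n)
      minus-one = ℤ-Solver.solve-∀

      -- On the lines of the second inner sum the sign is (-1)^(k+1): they supply the negative terms
      -- of `solution₁`.
      sum-x′ : ∑∑ s′ e′ x′ b′ (+ k) N M ≡ ∑< I (λ i → mono (suc k) (e₁′ k i) N)
      sum-x′ = ∑∑-curve s′ e′ x′ b′ N M I 2 (k ℕ.+ 2) (λ i → i) (λ _ → suc k) (e₁′ k) N<I (large (k ℕ.+ 2) k (size k))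
        (λ i → *≤⇒≤/ 2 (≤-by (i ℕ.+ k) (range i k)))
        (λ n j _ eq → j , ℕ.suc-injective (≡.trans (diff⇒ (suc n) (3 ℕ.* suc j) (≡.trans (≡.sym (plus-one (+ n) (+ (3 ℕ.* suc j)))) eq)) (position j k)) , refl)
        (λ i → ≡.trans (plus-one (+ (3 ℕ.* i ℕ.+ (k ℕ.+ 2))) (+ (3 ℕ.* suc i))) (⇒diff (3 ℕ.* suc i) k (≡.sym (position i k))))
        (λ i → 2 ℕ.* i ℕ.+ 1 , parity i k)
        (λ i → half-exponent (6 ℕ.* (i ℕ.* i) ℕ.+ 6 ℕ.* (i ℕ.* k) ℕ.+ 6 ℕ.* i ℕ.+ k ℕ.* k ℕ.+ 4 ℕ.* k ℕ.+ 1)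
          (3 ℕ.* (i ℕ.* i) ℕ.+ 3 ℕ.* (i ℕ.* k) ℕ.+ 5 ℕ.* i ℕ.+ 2 ℕ.* suc k) k (square i k) (total i k) (e₁′≡ i))
        i≤e₁′
        where
        size : ∀ k → 2 ℕ.* k ℕ.+ 2 ≡ k ℕ.+ 2 ℕ.+ k
        size = ℕ-Solver.solve-∀
        range : ∀ i k → 3 ℕ.* i ℕ.+ (k ℕ.+ 2) ≡ suc i ℕ.* 2 ℕ.+ (i ℕ.+ k)
        range = ℕ-Solver.solve-∀
        position : ∀ i k → k ℕ.+ 3 ℕ.* suc i ≡ suc (3 ℕ.* i ℕ.+ (k ℕ.+ 2))
        position = ℕ-Solver.solve-∀
        parity : ∀ i k → 3 ℕ.* i ℕ.+ (k ℕ.+ 2) ℕ.+ suc i ≡ (2 ℕ.* i ℕ.+ 1) ℕ.* 2 ℕ.+ suc k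
        parity = ℕ-Solver.solve-∀
        square : ∀ i k → (3 ℕ.* i ℕ.+ (k ℕ.+ 2)) ℕ.* (3 ℕ.* i ℕ.+ (k ℕ.+ 2))
          ≡ 6 ℕ.* (i ℕ.* i) ℕ.+ 6 ℕ.* (i ℕ.* k) ℕ.+ 6 ℕ.* i ℕ.+ k ℕ.* k ℕ.+ 4 ℕ.* k ℕ.+ 1 ℕ.+ 3 ℕ.* (suc i ℕ.* suc i)
        square = ℕ-Solver.solve-∀
        total : ∀ i k → 6 ℕ.* (i ℕ.* i) ℕ.+ 6 ℕ.* (i ℕ.* k) ℕ.+ 6 ℕ.* i ℕ.+ k ℕ.* k ℕ.+ 4 ℕ.* k ℕ.+ 1 ℕ.+ (3 ℕ.* i ℕ.+ (k ℕ.+ 2) ℕ.+ suc i)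
          ≡ (3 ℕ.* (i ℕ.* i) ℕ.+ 3 ℕ.* (i ℕ.* k) ℕ.+ 5 ℕ.* i ℕ.+ 2 ℕ.* suc k) ℕ.* 2 ℕ.+ k ℕ.* suc k
        total = ℕ-Solver.solve-∀

      sum-y′ : ∑∑ s′ e′ y′ b′ (+ k) N M ≡ ∑< I (λ i → mono (suc k) (e₁′ k i) N)
      sum-y′ = ∑∑-curve s′ e′ y′ b′ N M I 2 (2 ℕ.* k ℕ.+ 2) (λ i → i ℕ.+ k) (λ _ → suc k) (e₁′ k) N<I M-large
        (λ i → *≤⇒≤/ 2 (≤-by i (range i k)))
        support
        (λ i → ≡.trans (minus-one (+ (3 ℕ.* i ℕ.+ (2 ℕ.* k ℕ.+ 2))) (+ (3 ℕ.* suc (i ℕ.+ k)))) (⇒diff (suc (3 ℕ.* i ℕ.+ (2 ℕ.* k ℕ.+ 2))) k (position i k)))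
        (λ i → 2 ℕ.* i ℕ.+ k ℕ.+ 1 , parity i k)
        (λ i → half-exponent (6 ℕ.* (i ℕ.* i) ℕ.+ 6 ℕ.* (i ℕ.* k) ℕ.+ 6 ℕ.* i ℕ.+ k ℕ.* k ℕ.+ 2 ℕ.* k ℕ.+ 1)
          (3 ℕ.* (i ℕ.* i) ℕ.+ 3 ℕ.* (i ℕ.* k) ℕ.+ 5 ℕ.* i ℕ.+ 2 ℕ.* suc k) k (square i k) (total i k) (e₁′≡ i))
        i≤e₁′
        where
        range : ∀ i k → 3 ℕ.* i ℕ.+ (2 ℕ.* k ℕ.+ 2) ≡ suc (i ℕ.+ k) ℕ.* 2 ℕ.+ i
        range = ℕ-Solver.solve-∀
        position : ∀ i k → 3 ℕ.* suc (i ℕ.+ k) ≡ k ℕ.+ suc (3 ℕ.* i ℕ.+ (2 ℕ.* k ℕ.+ 2))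
        position = ℕ-Solver.solve-∀
        parity : ∀ i k → 3 ℕ.* i ℕ.+ (2 ℕ.* k ℕ.+ 2) ℕ.+ suc (i ℕ.+ k) ≡ (2 ℕ.* i ℕ.+ k ℕ.+ 1) ℕ.* 2 ℕ.+ suc k
        parity = ℕ-Solver.solve-∀
        square : ∀ i k → (3 ℕ.* i ℕ.+ (2 ℕ.* k ℕ.+ 2)) ℕ.* (3 ℕ.* i ℕ.+ (2 ℕ.* k ℕ.+ 2))
          ≡ 6 ℕ.* (i ℕ.* i) ℕ.+ 6 ℕ.* (i ℕ.* k) ℕ.+ 6 ℕ.* i ℕ.+ k ℕ.* k ℕ.+ 2 ℕ.* k ℕ.+ 1 ℕ.+ 3 ℕ.* (suc (i ℕ.+ k) ℕ.* suc (i ℕ.+ k))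
        square = ℕ-Solver.solve-∀
        total : ∀ i k → 6 ℕ.* (i ℕ.* i) ℕ.+ 6 ℕ.* (i ℕ.* k) ℕ.+ 6 ℕ.* i ℕ.+ k ℕ.* k ℕ.+ 2 ℕ.* k ℕ.+ 1 ℕ.+ (3 ℕ.* i ℕ.+ (2 ℕ.* k ℕ.+ 2) ℕ.+ suc (i ℕ.+ k))
          ≡ (3 ℕ.* (i ℕ.* i) ℕ.+ 3 ℕ.* (i ℕ.* k) ℕ.+ 5 ℕ.* i ℕ.+ 2 ℕ.* suc k) ℕ.* 2 ℕ.+ k ℕ.* suc k
        total = ℕ-Solver.solve-∀
        support : ∀ n j → j < b′ n → y′ n j ≡ + k → ∃ λ i → n ≡ 3 ℕ.* i ℕ.+ (2 ℕ.* k ℕ.+ 2) × j ≡ i ℕ.+ k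
        support n j j<n/2 eq = j ∸ k , ℕ.suc-injective (ℕ.+-cancelˡ-≡ k (suc n) _ (begin
            k ℕ.+ suc n                                        ≡⟨ 3j≡ ⟨
            3 ℕ.* suc j                                        ≡⟨ cong (λ j → 3 ℕ.* suc j) (ℕ.m∸n+n≡m k≤j) ⟨
            3 ℕ.* suc (j ∸ k ℕ.+ k)                            ≡⟨ position (j ∸ k) k ⟩
            k ℕ.+ suc (3 ℕ.* (j ∸ k) ℕ.+ (2 ℕ.* k ℕ.+ 2))      ∎)) , ≡.sym (ℕ.m∸n+n≡m k≤j)
          where
          open ≡-Reasoning
          3j≡ : 3 ℕ.* suc j ≡ k ℕ.+ suc n
          3j≡ = diff⇒ (3 ℕ.* suc j) (suc n) (≡.trans (≡.sym (minus-one (+ n) (+ (3 ℕ.* suc j)))) eq)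
          triple : ∀ j → 3 ℕ.* suc j ≡ suc (j ℕ.+ suc j ℕ.* 2)
          triple = ℕ-Solver.solve-∀
          k≤j : k ≤ j
          k≤j = ℕ.+-cancelʳ-≤ (suc j ℕ.* 2) k j (ℕ.≤-trans (ℕ.+-monoʳ-≤ k (≤/⇒*≤ n 2 j<n/2))
            (ℕ.≤-reflexive (ℕ.suc-injective (≡.trans (≡.sym (ℕ.+-suc k n)) (≡.trans (≡.sym 3j≡) (triple j))))))

    partial-rows : cf (partialSum hecke₁ M) (+ k) N ≡ solution₁ I k N ℤ.+ solution₁ I k N
    partial-rows = begin
      cf (partialSum hecke₁ M) (+ k) N
        ≡⟨ cf-hecke₁ (+ k) N M ⟩
      (∑∑ s e x b (+ k) N M ℤ.+ ∑∑ s e y b (+ k) N M) ℤ.+ (∑∑ s′ e′ x′ b′ (+ k) N M ℤ.+ ∑∑ s′ e′ y′ b′ (+ k) N M)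
        ≡⟨ cong₂ ℤ._+_ (cong₂ ℤ._+_ sum-x sum-y) (cong₂ ℤ._+_ sum-x′ sum-y′) ⟩
      (X ℤ.+ X) ℤ.+ (Y ℤ.+ Y)
        ≡⟨ interchange X Y ⟩
      (X ℤ.+ Y) ℤ.+ (X ℤ.+ Y)
        ≡⟨ cong (λ x → x ℤ.+ x) X+Y ⟩
      solution₁ I k N ℤ.+ solution₁ I k N ∎
      where
      open ≡-Reasoning
      X Y : ℤ
      X = ∑< I (λ i → mono k (e₁ k i) N)
      Y = ∑< I (λ i → mono (suc k) (e₁′ k i) N)
      interchange : ∀ x y → (x ℤ.+ x) ℤ.+ (y ℤ.+ y) ≡ (x ℤ.+ y) ℤ.+ (x ℤ.+ y)
      interchange = ℤ-Solver.solve-∀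
      X+Y : X ℤ.+ Y ≡ solution₁ I k N
      X+Y = ≡.trans (≡.sym (∑<-+ I (λ i → mono k (e₁ k i) N) (λ i → mono (suc k) (e₁′ k i) N)))
        (∑<-cong I λ i _ → cong (λ x → mono k (e₁ k i) N ℤ.+ x) (mono-suc k (e₁′ k i) N))

  rows : ∀ k n → cf (∑∞ hecke₁ hecke₁-summable) (+ k) (+ n) ≡ solution₁ (suc n) k (+ n) ℤ.+ solution₁ (suc n) k (+ n)
  rows k n = cf-lim-unique {partialSum hecke₁} {∑∞ hecke₁ hecke₁-summable} {+ k} {+ n} (3 ℕ.* suc n ℕ.+ (2 ℕ.* k ℕ.+ 2)) (proj₂ hecke₁-summable)
    λ M M-large → partial-rows k (+ n) M (suc n) (ℤ.+<+ ℕ.≤-refl) M-large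

-- Sums over a symmetric range

∑<-symmetric : ∀ b (g : ℤ → ℤ) → (∀ j → g (ℤ.- + j) ≡ g (+ j)) →
  ∑< (suc (2 ℕ.* b)) (λ i → g (+ i ℤ.- + b)) ≡ ∑< (suc b) (λ j → g (+ j)) ℤ.+ ∑< b (λ j → g (+ suc j))
∑<-symmetric b g even = begin
  ∑< (suc (2 ℕ.* b)) (λ i → g (+ i ℤ.- + b))
    ≡⟨ cong (λ n → ∑< n (λ i → g (+ i ℤ.- + b))) (length b) ⟩
  ∑< (b ℕ.+ suc b) (λ i → g (+ i ℤ.- + b))
    ≡⟨ ∑<-split b (suc b) (λ i → g (+ i ℤ.- + b)) ⟩
  ∑< b (λ i → g (+ i ℤ.- + b)) ℤ.+ ∑< (suc b) (λ i → g (+ (b ℕ.+ i) ℤ.- + b))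
    ≡⟨ cong₂ ℤ._+_ (∑<-cong b λ i i<b → ≡.trans (cong g (negative i i<b)) (even (b ∸ i))) (∑<-cong (suc b) λ i _ → cong g (cancel (+ b) (+ i))) ⟩
  ∑< b (λ i → g (+ (b ∸ i))) ℤ.+ ∑< (suc b) (λ j → g (+ j))
    ≡⟨ cong (λ x → x ℤ.+ ∑< (suc b) (λ j → g (+ j))) (∑<-reverse b (λ j → g (+ j))) ⟩
  ∑< b (λ j → g (+ suc j)) ℤ.+ ∑< (suc b) (λ j → g (+ j))
    ≡⟨ ℤ.+-comm (∑< b (λ j → g (+ suc j))) (∑< (suc b) (λ j → g (+ j))) ⟩
  ∑< (suc b) (λ j → g (+ j)) ℤ.+ ∑< b (λ j → g (+ suc j)) ∎
  where
  open ≡-Reasoning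
  length : ∀ b → suc (2 ℕ.* b) ≡ b ℕ.+ suc b
  length = ℕ-Solver.solve-∀
  cancel : ∀ b i → b ℤ.+ i ℤ.- b ≡ i
  cancel = ℤ-Solver.solve-∀
  negate : ∀ r i → i ℤ.- (r ℤ.+ i) ≡ ℤ.- r
  negate = ℤ-Solver.solve-∀
  negative : ∀ i → i < b → + i ℤ.- + b ≡ ℤ.- + (b ∸ i)
  negative i i<b = ≡.trans (cong (λ n → + i ℤ.- + n) (≡.sym (ℕ.m∸n+n≡m (ℕ.<⇒≤ i<b)))) (negate (+ (b ∸ i)) (+ i))

-- Folding |m| ≤ b onto 0, ..., b and 1, ..., b makes the index a natural number, as `∑∑` requires.
-- In the applications the primed data describe the second range.
cf-symmetric : ∀ (t : ℕ → ℤ → Series) (b : ℕ → ℕ) → (∀ n j → t n (ℤ.- + j) ≈ t n (+ j)) → ∀ k N M →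
  cf (partialSum (λ n → ∑-symmetric (b n) (t n)) M) k N
    ≡ cf (partialSum (λ n → partialSum (λ j → t n (+ j)) (suc (b n))) M) k N
      ℤ.+ cf (partialSum (λ n → partialSum (λ j → t n (+ suc j)) (b n)) M) k N
cf-symmetric t b even k N M = begin
  cf (partialSum (λ n → ∑-symmetric (b n) (t n)) M) k N
    ≡⟨ cf-partialSum _ M k N ⟩
  ∑< M (λ n → cf (∑-symmetric (b n) (t n)) k N)
    ≡⟨ ∑<-cong M (λ n _ → ≡.trans (cf-partialSum (λ i → t n (+ i ℤ.- + b n)) (suc (2 ℕ.* b n)) k N)
         (≡.trans (∑<-symmetric (b n) (λ m → cf (t n m) k N) λ j → cf-cong (even n j) k N)
           (≡.sym (cong₂ ℤ._+_ (cf-partialSum (λ j → t n (+ j)) (suc (b n)) k N) (cf-partialSum (λ j → t n (+ suc j)) (b n) k N))))) ⟩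
  ∑< M (λ n → cf (partialSum (λ j → t n (+ j)) (suc (b n))) k N ℤ.+ cf (partialSum (λ j → t n (+ suc j)) (b n)) k N)
    ≡⟨ ∑<-+ M _ _ ⟩
  ∑< M (λ n → cf (partialSum (λ j → t n (+ j)) (suc (b n))) k N) ℤ.+ ∑< M (λ n → cf (partialSum (λ j → t n (+ suc j)) (b n)) k N)
    ≡⟨ cong₂ ℤ._+_ (cf-partialSum _ M k N) (cf-partialSum _ M k N) ⟨
  cf (partialSum (λ n → partialSum (λ j → t n (+ j)) (suc (b n))) M) k N
    ℤ.+ cf (partialSum (λ n → partialSum (λ j → t n (+ suc j)) (b n)) M) k N ∎
  where open ≡-Reasoning

-- The numbers |n - j| and n + j have the same parity. The first is the form in which the sign of
-- `t₂` appears for negative m.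
-1^∣⊖∣ : ∀ n j → -1^ ∣ n ℤ.⊖ j ∣ ≈ -1^ (n ℕ.+ j)
-1^∣⊖∣ n       zero    = S.reflexive (cong -1^_ (≡.sym (ℕ.+-identityʳ n)))
-1^∣⊖∣ zero    (suc j) = S.refl
-1^∣⊖∣ (suc n) (suc j) = begin
  -1^ ∣ suc n ℤ.⊖ suc j ∣                ≡⟨ cong (λ m → -1^ ∣ m ∣) (ℤ.[1+m]⊖[1+n]≡m⊖n n j) ⟩
  -1^ ∣ n ℤ.⊖ j ∣                        ≈⟨ -1^∣⊖∣ n j ⟩
  -1^ (n ℕ.+ j)                          ≈⟨ solve 1 (λ x → x := (⊝ con (+ 1)) ⊛ ((⊝ con (+ 1)) ⊛ x)) S.refl (-1^ (n ℕ.+ j)) ⟩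
  -1^ suc (suc (n ℕ.+ j))                ≡⟨ cong (λ m → -1^ suc m) (ℕ.+-suc n j) ⟨
  -1^ (suc n ℕ.+ suc j)                  ∎
  where open ≈-Reasoning

private
  plus-one : ∀ n m → n ℤ.- m ℤ.+ + 1 ≡ + 1 ℤ.+ n ℤ.- m
  plus-one = ℤ-Solver.solve-∀

  too-large : ∀ {m n k} → m ≤ n → m ≢ suc k ℕ.+ n
  too-large {k = k} m≤n refl = ℕ.<-irrefl refl (ℕ.≤-trans (s≤s (ℕ.m≤n+m _ k)) m≤n)

  n<2+2n : ∀ n → + n ℤ.< + (suc n ℕ.* 2)
  n<2+2n n = ℤ.+<+ (ℕ.m≤m*n (suc n) 2)

  2*≤ : ∀ {j n} → j ≤ n / 2 → 2 ℕ.* j ≤ n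
  2*≤ {j} {n} j≤ = ≡.subst (_≤ n) (ℕ.*-comm j 2) (≤/⇒*≤ n 2 j≤)

  i≤a : ∀ k i → i ≤ a k i
  i≤a k i = ≤-by (i ℕ.* i ℕ.+ 2 ℕ.* (i ℕ.* k) ℕ.+ tri k) (regroup (i ℕ.* i ℕ.+ 2 ℕ.* (i ℕ.* k)) i (tri k))
    where
    regroup : ∀ p i t → p ℕ.+ i ℕ.+ t ≡ i ℕ.+ (p ℕ.+ t)
    regroup = ℕ-Solver.solve-∀

-- The first double sum for H

module Hecke₂ where

  private
    s e s′ e′ : ℕ → ℕ → ℕ
    s n j = n ℕ.+ j
    e n j = ((n ℕ.* n ∸ 2 ℕ.* (j ℕ.* j)) ℕ.+ n) / 2
    s′ n j = s n (suc j)
    e′ n j = e n (suc j)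

    x y x′ y′ : ℕ → ℕ → ℤ
    x n j = + n ℤ.- + (2 ℕ.* j) ℤ.+ + 1
    y n j = + (2 ℕ.* j) ℤ.- + n
    x′ n j = x n (suc j)
    y′ n j = y n (suc j)

    b b′ : ℕ → ℕ
    b n = suc (n / 2)
    b′ n = n / 2

    t₂-even : ∀ n j → t₂ n (ℤ.- + j) ≈ t₂ n (+ j)
    t₂-even n zero    = S.refl
    t₂-even n (suc j) = S.*-congʳ {q ^ e′ n j} (S.*-congʳ {z^ (x′ n j) + z^ (y′ n j)} (-1^∣⊖∣ n (suc j)))

    cf-hecke₂ : ∀ k N M → cf (partialSum hecke₂ M) k N
      ≡ (∑∑ s e x b k N M ℤ.+ ∑∑ s e y b k N M) ℤ.+ (∑∑ s′ e′ x′ b′ k N M ℤ.+ ∑∑ s′ e′ y′ b′ k N M)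
    cf-hecke₂ k N M = ≡.trans (cf-symmetric t₂ (_/ 2) t₂-even k N M)
      (cong₂ ℤ._+_ (cf-pairs s e x y b k N M) (cf-pairs s′ e′ x′ y′ b′ k N M))

  -- In every term the two exponents of z add up to 1.
  symmetric : ∀ k N → cf (∑∞ hecke₂ hecke₂-summable) (+ 1 ℤ.- k) N ≡ cf (∑∞ hecke₂ hecke₂-summable) k N
  symmetric k N = cf-lim-cong {partialSum hecke₂} {partialSum hecke₂} {∑∞ hecke₂ hecke₂-summable} {∑∞ hecke₂ hecke₂-summable}
    (+ 1 ℤ.- k) k N (proj₂ hecke₂-summable) (proj₂ hecke₂-summable) λ M → begin
    cf (partialSum hecke₂ M) k′ N
      ≡⟨ cf-hecke₂ k′ N M ⟩
    (∑∑ s e x b k′ N M ℤ.+ ∑∑ s e y b k′ N M) ℤ.+ (∑∑ s′ e′ x′ b′ k′ N M ℤ.+ ∑∑ s′ e′ y′ b′ k′ N M)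
      ≡⟨ cong₂ ℤ._+_
           (cong₂ ℤ._+_ (∑∑-flip s e x y b k′ k N M λ n j → flip k (+ n) (+ (2 ℕ.* j))) (∑∑-flip s e y x b k′ k N M λ n j → flip′ k (+ n) (+ (2 ℕ.* j))))
           (cong₂ ℤ._+_ (∑∑-flip s′ e′ x′ y′ b′ k′ k N M λ n j → flip k (+ n) (+ (2 ℕ.* suc j))) (∑∑-flip s′ e′ y′ x′ b′ k′ k N M λ n j → flip′ k (+ n) (+ (2 ℕ.* suc j)))) ⟩
    (∑∑ s e y b k N M ℤ.+ ∑∑ s e x b k N M) ℤ.+ (∑∑ s′ e′ y′ b′ k N M ℤ.+ ∑∑ s′ e′ x′ b′ k N M)
      ≡⟨ cong₂ ℤ._+_ (ℤ.+-comm (∑∑ s e y b k N M) (∑∑ s e x b k N M)) (ℤ.+-comm (∑∑ s′ e′ y′ b′ k N M) (∑∑ s′ e′ x′ b′ k N M)) ⟩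
    (∑∑ s e x b k N M ℤ.+ ∑∑ s e y b k N M) ℤ.+ (∑∑ s′ e′ x′ b′ k N M ℤ.+ ∑∑ s′ e′ y′ b′ k N M)
      ≡⟨ cf-hecke₂ k N M ⟨
    cf (partialSum hecke₂ M) k N ∎
    where
    open ≡-Reasoning
    k′ : ℤ
    k′ = + 1 ℤ.- k
    flip : ∀ k n m → + 1 ℤ.- k ℤ.- (n ℤ.- m ℤ.+ + 1) ≡ ℤ.- (k ℤ.- (m ℤ.- n))
    flip = ℤ-Solver.solve-∀
    flip′ : ∀ k n m → + 1 ℤ.- k ℤ.- (m ℤ.- n) ≡ ℤ.- (k ℤ.- (n ℤ.- m ℤ.+ + 1))
    flip′ = ℤ-Solver.solve-∀

  module _ (k : ℕ) (N : ℤ) (M I : ℕ) (N<I : N ℤ.< + I) (M-large : 2 ℕ.* I ℕ.+ (k ℕ.+ 2) ≤ M) where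

    private
      -- The terms with z^(k+1) satisfy n = 2 |m| + k. Nonnegative m yield the exponents `a k i`,
      -- and the second copy of the positive ones, in `sum-x′`, yields `a k (suc i)` with the
      -- opposite sign: the two parts of `solution₂`.
      sum-x : ∑∑ s e x b (+ suc k) N M ≡ ∑< I (λ i → mono (i ℕ.+ k) (a k i) N)
      sum-x = ∑∑-curve s e x b N M I 1 k (λ i → i) (λ i → i ℕ.+ k) (a k) N<I
        (ℕ.≤-trans (ℕ.+-monoʳ-≤ (2 ℕ.* I) (ℕ.m≤m+n k 2)) M-large)
        (λ i → s≤s (*≤⇒≤/ 2 (≤-by k (cong (λ t → t ℕ.+ k) (ℕ.*-comm 2 i)))))
        (λ n j _ eq → j , ≡.trans (ℕ.suc-injective (diff⇒ (suc n) (2 ℕ.* j) (≡.trans (≡.sym (plus-one (+ n) (+ (2 ℕ.* j)))) eq))) (ℕ.+-comm k (2 ℕ.* j)) , refl)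
        (λ i → ≡.trans (plus-one (+ (2 ℕ.* i ℕ.+ k)) (+ (2 ℕ.* i))) (⇒diff (2 ℕ.* i) (suc k) (cong suc (ℕ.+-comm (2 ℕ.* i) k))))
        (λ i → i , parity i k)
        (λ i → half-exponent (2 ℕ.* (i ℕ.* i) ℕ.+ 4 ℕ.* (i ℕ.* k) ℕ.+ k ℕ.* k) (i ℕ.* i ℕ.+ 2 ℕ.* (i ℕ.* k) ℕ.+ i) k (square i k) (total i k) refl)
        (i≤a k)
        where
        parity : ∀ i k → 2 ℕ.* i ℕ.+ k ℕ.+ i ≡ i ℕ.* 2 ℕ.+ (i ℕ.+ k)
        parity = ℕ-Solver.solve-∀
        square : ∀ i k → (2 ℕ.* i ℕ.+ k) ℕ.* (2 ℕ.* i ℕ.+ k) ≡ 2 ℕ.* (i ℕ.* i) ℕ.+ 4 ℕ.* (i ℕ.* k) ℕ.+ k ℕ.* k ℕ.+ 2 ℕ.* (i ℕ.* i)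
        square = ℕ-Solver.solve-∀
        total : ∀ i k → 2 ℕ.* (i ℕ.* i) ℕ.+ 4 ℕ.* (i ℕ.* k) ℕ.+ k ℕ.* k ℕ.+ (2 ℕ.* i ℕ.+ k) ≡ (i ℕ.* i ℕ.+ 2 ℕ.* (i ℕ.* k) ℕ.+ i) ℕ.* 2 ℕ.+ k ℕ.* suc k
        total = ℕ-Solver.solve-∀

      sum-x′ : ∑∑ s′ e′ x′ b′ (+ suc k) N M ≡ ∑< I (λ i → mono (suc i ℕ.+ k) (a k (suc i)) N)
      sum-x′ = ∑∑-curve s′ e′ x′ b′ N M I 1 (k ℕ.+ 2) (λ i → i) (λ i → suc i ℕ.+ k) (λ i → a k (suc i)) N<I M-large
        (λ i → *≤⇒≤/ 2 (≤-by k (range i k)))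
        (λ n j _ eq → j , ℕ.suc-injective (≡.trans (diff⇒ (suc n) (2 ℕ.* suc j) (≡.trans (≡.sym (plus-one (+ n) (+ (2 ℕ.* suc j)))) eq)) (position j k)) , refl)
        (λ i → ≡.trans (plus-one (+ (2 ℕ.* i ℕ.+ (k ℕ.+ 2))) (+ (2 ℕ.* suc i))) (⇒diff (2 ℕ.* suc i) (suc k) (≡.sym (position i k))))
        (λ i → suc i , parity i k)
        (λ i → half-exponent (2 ℕ.* (suc i ℕ.* suc i) ℕ.+ 4 ℕ.* (suc i ℕ.* k) ℕ.+ k ℕ.* k) (suc i ℕ.* suc i ℕ.+ 2 ℕ.* (suc i ℕ.* k) ℕ.+ suc i) k
          (square i k) (total i k) refl)
        (λ i → ℕ.≤-trans (ℕ.n≤1+n i) (i≤a k (suc i)))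
        where
        range : ∀ i k → 2 ℕ.* i ℕ.+ (k ℕ.+ 2) ≡ suc i ℕ.* 2 ℕ.+ k
        range = ℕ-Solver.solve-∀
        position : ∀ i k → suc k ℕ.+ 2 ℕ.* suc i ≡ suc (2 ℕ.* i ℕ.+ (k ℕ.+ 2))
        position = ℕ-Solver.solve-∀
        parity : ∀ i k → 2 ℕ.* i ℕ.+ (k ℕ.+ 2) ℕ.+ suc i ≡ suc i ℕ.* 2 ℕ.+ (suc i ℕ.+ k)
        parity = ℕ-Solver.solve-∀
        square : ∀ i k → (2 ℕ.* i ℕ.+ (k ℕ.+ 2)) ℕ.* (2 ℕ.* i ℕ.+ (k ℕ.+ 2))
          ≡ 2 ℕ.* (suc i ℕ.* suc i) ℕ.+ 4 ℕ.* (suc i ℕ.* k) ℕ.+ k ℕ.* k ℕ.+ 2 ℕ.* (suc i ℕ.* suc i)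
        square = ℕ-Solver.solve-∀
        total : ∀ i k → 2 ℕ.* (suc i ℕ.* suc i) ℕ.+ 4 ℕ.* (suc i ℕ.* k) ℕ.+ k ℕ.* k ℕ.+ (2 ℕ.* i ℕ.+ (k ℕ.+ 2))
          ≡ (suc i ℕ.* suc i ℕ.+ 2 ℕ.* (suc i ℕ.* k) ℕ.+ suc i) ℕ.* 2 ℕ.+ k ℕ.* suc k
        total = ℕ-Solver.solve-∀

      -- Because of 2j ≤ n the exponent 2j - n is never positive.
      sum-y : ∑∑ s e y b (+ suc k) N M ≡ ℤ.0ℤ
      sum-y = ∑∑-empty s e y b N M λ { n j (s≤s j≤n/2) eq → too-large {k = k} (2*≤ {j} {n} j≤n/2) (diff⇒ (2 ℕ.* j) n eq) }

      sum-y′ : ∑∑ s′ e′ y′ b′ (+ suc k) N M ≡ ℤ.0ℤ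
      sum-y′ = ∑∑-empty s′ e′ y′ b′ N M λ n j j<n/2 eq → too-large {k = k} (2*≤ {suc j} {n} j<n/2) (diff⇒ (2 ℕ.* suc j) n eq)

    partial-rows : cf (partialSum hecke₂ M) (+ suc k) N ≡ solution₂ I k N
    partial-rows = begin
      cf (partialSum hecke₂ M) (+ suc k) N
        ≡⟨ cf-hecke₂ (+ suc k) N M ⟩
      (∑∑ s e x b (+ suc k) N M ℤ.+ ∑∑ s e y b (+ suc k) N M) ℤ.+ (∑∑ s′ e′ x′ b′ (+ suc k) N M ℤ.+ ∑∑ s′ e′ y′ b′ (+ suc k) N M)
        ≡⟨ cong₂ ℤ._+_ (≡.trans (cong₂ ℤ._+_ sum-x sum-y) (ℤ.+-identityʳ X)) (≡.trans (cong₂ ℤ._+_ sum-x′ sum-y′) (ℤ.+-identityʳ X′)) ⟩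
      X ℤ.+ X′
        ≡⟨ ∑<-+ I (λ i → mono (i ℕ.+ k) (a k i) N) (λ i → mono (suc i ℕ.+ k) (a k (suc i)) N) ⟨
      ∑< I (λ i → mono (i ℕ.+ k) (a k i) N ℤ.+ mono (suc i ℕ.+ k) (a k (suc i)) N)
        ≡⟨ ∑<-cong I (λ i _ → cong (λ x → mono (i ℕ.+ k) (a k i) N ℤ.+ x) (mono-suc (i ℕ.+ k) (a k (suc i)) N)) ⟩
      solution₂ I k N ∎
      where
      open ≡-Reasoning
      X X′ : ℤ
      X = ∑< I (λ i → mono (i ℕ.+ k) (a k i) N)
      X′ = ∑< I (λ i → mono (suc i ℕ.+ k) (a k (suc i)) N)

  rows : ∀ k n → cf (∑∞ hecke₂ hecke₂-summable) (+ suc k) (+ n) ≡ solution₂ (suc n) k (+ n)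
  rows k n = cf-lim-unique {partialSum hecke₂} {∑∞ hecke₂ hecke₂-summable} {+ suc k} {+ n} (2 ℕ.* suc n ℕ.+ (k ℕ.+ 2)) (proj₂ hecke₂-summable)
    λ M M-large → partial-rows k (+ n) M (suc n) (ℤ.+<+ ℕ.≤-refl) M-large

-- The second double sum for H

module Hecke₃ where

  private
    s e s′ e′ : ℕ → ℕ → ℕ
    s n j = n
    e n j = ((n ℕ.* n ∸ 8 ℕ.* (j ℕ.* j)) ℕ.+ n) / 2
    s′ n j = n
    e′ n j = e n (suc j)

    x y x′ y′ : ℕ → ℕ → ℤ
    x n j = + n ℤ.+ + 1 ℤ.- + (4 ℕ.* j)
    y n j = + (4 ℕ.* j) ℤ.- + n
    x′ n j = x n (suc j)
    y′ n j = y n (suc j)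

    b b′ : ℕ → ℕ
    b n = suc (n / 3)
    b′ n = n / 3

    t₃-even : ∀ n j → t₃ n (ℤ.- + j) ≈ t₃ n (+ j)
    t₃-even n zero    = S.refl
    t₃-even n (suc j) = S.refl

    cf-hecke₃ : ∀ k N M → cf (partialSum hecke₃ M) k N
      ≡ (∑∑ s e x b k N M ℤ.+ ∑∑ s e y b k N M) ℤ.+ (∑∑ s′ e′ x′ b′ k N M ℤ.+ ∑∑ s′ e′ y′ b′ k N M)
    cf-hecke₃ k N M = ≡.trans (cf-symmetric t₃ (_/ 3) t₃-even k N M)
      (cong₂ ℤ._+_ (cf-pairs s e x y b k N M) (cf-pairs s′ e′ x′ y′ b′ k N M))

  symmetric : ∀ k N → cf (∑∞ hecke₃ hecke₃-summable) (+ 1 ℤ.- k) N ≡ cf (∑∞ hecke₃ hecke₃-summable) k N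
  symmetric k N = cf-lim-cong {partialSum hecke₃} {partialSum hecke₃} {∑∞ hecke₃ hecke₃-summable} {∑∞ hecke₃ hecke₃-summable}
    (+ 1 ℤ.- k) k N (proj₂ hecke₃-summable) (proj₂ hecke₃-summable) λ M → begin
    cf (partialSum hecke₃ M) k′ N
      ≡⟨ cf-hecke₃ k′ N M ⟩
    (∑∑ s e x b k′ N M ℤ.+ ∑∑ s e y b k′ N M) ℤ.+ (∑∑ s′ e′ x′ b′ k′ N M ℤ.+ ∑∑ s′ e′ y′ b′ k′ N M)
      ≡⟨ cong₂ ℤ._+_
           (cong₂ ℤ._+_ (∑∑-flip s e x y b k′ k N M λ n j → flip k (+ n) (+ (4 ℕ.* j))) (∑∑-flip s e y x b k′ k N M λ n j → flip′ k (+ n) (+ (4 ℕ.* j))))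
           (cong₂ ℤ._+_ (∑∑-flip s′ e′ x′ y′ b′ k′ k N M λ n j → flip k (+ n) (+ (4 ℕ.* suc j))) (∑∑-flip s′ e′ y′ x′ b′ k′ k N M λ n j → flip′ k (+ n) (+ (4 ℕ.* suc j)))) ⟩
    (∑∑ s e y b k N M ℤ.+ ∑∑ s e x b k N M) ℤ.+ (∑∑ s′ e′ y′ b′ k N M ℤ.+ ∑∑ s′ e′ x′ b′ k N M)
      ≡⟨ cong₂ ℤ._+_ (ℤ.+-comm (∑∑ s e y b k N M) (∑∑ s e x b k N M)) (ℤ.+-comm (∑∑ s′ e′ y′ b′ k N M) (∑∑ s′ e′ x′ b′ k N M)) ⟩
    (∑∑ s e x b k N M ℤ.+ ∑∑ s e y b k N M) ℤ.+ (∑∑ s′ e′ x′ b′ k N M ℤ.+ ∑∑ s′ e′ y′ b′ k N M)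
      ≡⟨ cf-hecke₃ k N M ⟨
    cf (partialSum hecke₃ M) k N ∎
    where
    open ≡-Reasoning
    k′ : ℤ
    k′ = + 1 ℤ.- k
    flip : ∀ k n m → + 1 ℤ.- k ℤ.- (n ℤ.+ + 1 ℤ.- m) ≡ ℤ.- (k ℤ.- (m ℤ.- n))
    flip = ℤ-Solver.solve-∀
    flip′ : ∀ k n m → + 1 ℤ.- k ℤ.- (m ℤ.- n) ≡ ℤ.- (k ℤ.- (n ℤ.+ + 1 ℤ.- m))
    flip′ = ℤ-Solver.solve-∀

  module _ (k : ℕ) (N : ℤ) (M I : ℕ) (N<I : N ℤ.< + I) (M-large : 4 ℕ.* I ℕ.+ (3 ℕ.* k ℕ.+ 4) ≤ M) where

    private
      -- The number 3k + 4 dominates the offsets k, k + 4 and 3 (k + 1) of the lines below.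
      large : ∀ o r → 3 ℕ.* k ℕ.+ 4 ≡ o ℕ.+ r → 4 ℕ.* I ℕ.+ o ≤ M
      large o r eq = ℕ.≤-trans (ℕ.+-monoʳ-≤ (4 ℕ.* I) (≤-by r eq)) M-large

      i≤i*2 : ∀ i → i ≤ i ℕ.* 2
      i≤i*2 i = ℕ.m≤m*n i 2

      suc-n : ∀ n m → n ℤ.+ + 1 ℤ.- m ≡ + 1 ℤ.+ n ℤ.- m
      suc-n = ℤ-Solver.solve-∀

      -- Along n = 4i + k the sign is constant and only every second exponent of `solution₂` is met,
      -- the even-indexed ones.
      sum-x : ∑∑ s e x b (+ suc k) N M ≡ ∑< I (λ i → mono k (a k (i ℕ.* 2)) N)
      sum-x = ∑∑-curve s e x b N M I 3 k (λ i → i) (λ _ → k) (λ i → a k (i ℕ.* 2)) N<I (large k (2 ℕ.* k ℕ.+ 4) (size k))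
        (λ i → s≤s (*≤⇒≤/ 3 (≤-by (i ℕ.+ k) (range i k))))
        (λ n j _ eq → j , ≡.trans (ℕ.suc-injective (diff⇒ (suc n) (4 ℕ.* j) (≡.trans (≡.sym (suc-n (+ n) (+ (4 ℕ.* j)))) eq))) (ℕ.+-comm k (4 ℕ.* j)) , refl)
        (λ i → ≡.trans (suc-n (+ (4 ℕ.* i ℕ.+ k)) (+ (4 ℕ.* i))) (⇒diff (4 ℕ.* i) (suc k) (cong suc (ℕ.+-comm (4 ℕ.* i) k))))
        (λ i → 2 ℕ.* i , parity i k)
        (λ i → half-exponent (8 ℕ.* (i ℕ.* i) ℕ.+ 8 ℕ.* (i ℕ.* k) ℕ.+ k ℕ.* k) (i ℕ.* 2 ℕ.* (i ℕ.* 2) ℕ.+ 2 ℕ.* (i ℕ.* 2 ℕ.* k) ℕ.+ i ℕ.* 2) k (square i k) (total i k) refl)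
        (λ i → ℕ.≤-trans (i≤i*2 i) (i≤a k (i ℕ.* 2)))
        where
        size : ∀ k → 3 ℕ.* k ℕ.+ 4 ≡ k ℕ.+ (2 ℕ.* k ℕ.+ 4)
        size = ℕ-Solver.solve-∀
        range : ∀ i k → 4 ℕ.* i ℕ.+ k ≡ i ℕ.* 3 ℕ.+ (i ℕ.+ k)
        range = ℕ-Solver.solve-∀
        parity : ∀ i k → 4 ℕ.* i ℕ.+ k ≡ 2 ℕ.* i ℕ.* 2 ℕ.+ k
        parity = ℕ-Solver.solve-∀
        square : ∀ i k → (4 ℕ.* i ℕ.+ k) ℕ.* (4 ℕ.* i ℕ.+ k) ≡ 8 ℕ.* (i ℕ.* i) ℕ.+ 8 ℕ.* (i ℕ.* k) ℕ.+ k ℕ.* k ℕ.+ 8 ℕ.* (i ℕ.* i)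
        square = ℕ-Solver.solve-∀
        total : ∀ i k → 8 ℕ.* (i ℕ.* i) ℕ.+ 8 ℕ.* (i ℕ.* k) ℕ.+ k ℕ.* k ℕ.+ (4 ℕ.* i ℕ.+ k)
          ≡ (i ℕ.* 2 ℕ.* (i ℕ.* 2) ℕ.+ 2 ℕ.* (i ℕ.* 2 ℕ.* k) ℕ.+ i ℕ.* 2) ℕ.* 2 ℕ.+ k ℕ.* suc k
        total = ℕ-Solver.solve-∀

      sum-x′ : ∑∑ s′ e′ x′ b′ (+ suc k) N M ≡ ∑< I (λ i → mono k (a k (suc i ℕ.* 2)) N)
      sum-x′ = ∑∑-curve s′ e′ x′ b′ N M I 3 (k ℕ.+ 4) (λ i → i) (λ _ → k) (λ i → a k (suc i ℕ.* 2)) N<I (large (k ℕ.+ 4) (2 ℕ.* k) (size k))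
        (λ i → *≤⇒≤/ 3 (≤-by (i ℕ.+ k ℕ.+ 1) (range i k)))
        (λ n j _ eq → j , ℕ.suc-injective (≡.trans (diff⇒ (suc n) (4 ℕ.* suc j) (≡.trans (≡.sym (suc-n (+ n) (+ (4 ℕ.* suc j)))) eq)) (position j k)) , refl)
        (λ i → ≡.trans (suc-n (+ (4 ℕ.* i ℕ.+ (k ℕ.+ 4))) (+ (4 ℕ.* suc i))) (⇒diff (4 ℕ.* suc i) (suc k) (≡.sym (position i k))))
        (λ i → 2 ℕ.* suc i , parity i k)
        (λ i → half-exponent (8 ℕ.* (suc i ℕ.* suc i) ℕ.+ 8 ℕ.* (suc i ℕ.* k) ℕ.+ k ℕ.* k)
          (suc i ℕ.* 2 ℕ.* (suc i ℕ.* 2) ℕ.+ 2 ℕ.* (suc i ℕ.* 2 ℕ.* k) ℕ.+ suc i ℕ.* 2) k (square i k) (total i k) refl)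
        (λ i → ℕ.≤-trans (ℕ.≤-trans (ℕ.n≤1+n i) (i≤i*2 (suc i))) (i≤a k (suc i ℕ.* 2)))
        where
        size : ∀ k → 3 ℕ.* k ℕ.+ 4 ≡ k ℕ.+ 4 ℕ.+ 2 ℕ.* k
        size = ℕ-Solver.solve-∀
        range : ∀ i k → 4 ℕ.* i ℕ.+ (k ℕ.+ 4) ≡ suc i ℕ.* 3 ℕ.+ (i ℕ.+ k ℕ.+ 1)
        range = ℕ-Solver.solve-∀
        position : ∀ i k → suc k ℕ.+ 4 ℕ.* suc i ≡ suc (4 ℕ.* i ℕ.+ (k ℕ.+ 4))
        position = ℕ-Solver.solve-∀
        parity : ∀ i k → 4 ℕ.* i ℕ.+ (k ℕ.+ 4) ≡ 2 ℕ.* suc i ℕ.* 2 ℕ.+ k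
        parity = ℕ-Solver.solve-∀
        square : ∀ i k → (4 ℕ.* i ℕ.+ (k ℕ.+ 4)) ℕ.* (4 ℕ.* i ℕ.+ (k ℕ.+ 4))
          ≡ 8 ℕ.* (suc i ℕ.* suc i) ℕ.+ 8 ℕ.* (suc i ℕ.* k) ℕ.+ k ℕ.* k ℕ.+ 8 ℕ.* (suc i ℕ.* suc i)
        square = ℕ-Solver.solve-∀
        total : ∀ i k → 8 ℕ.* (suc i ℕ.* suc i) ℕ.+ 8 ℕ.* (suc i ℕ.* k) ℕ.+ k ℕ.* k ℕ.+ (4 ℕ.* i ℕ.+ (k ℕ.+ 4))
          ≡ (suc i ℕ.* 2 ℕ.* (suc i ℕ.* 2) ℕ.+ 2 ℕ.* (suc i ℕ.* 2 ℕ.* k) ℕ.+ suc i ℕ.* 2) ℕ.* 2 ℕ.+ k ℕ.* suc k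
        total = ℕ-Solver.solve-∀

      -- The terms with z^{4|m|-n} supply the odd-indexed exponents a k (2i+1) of solution₂.
      position-y : ∀ i k → 4 ℕ.* (i ℕ.+ suc k) ≡ suc k ℕ.+ (4 ℕ.* i ℕ.+ 3 ℕ.* suc k)
      position-y = ℕ-Solver.solve-∀

      size-y : ∀ k → 3 ℕ.* k ℕ.+ 4 ≡ 3 ℕ.* suc k ℕ.+ 1
      size-y = ℕ-Solver.solve-∀

      range-y : ∀ i k → 4 ℕ.* i ℕ.+ 3 ℕ.* suc k ≡ (i ℕ.+ suc k) ℕ.* 3 ℕ.+ i
      range-y = ℕ-Solver.solve-∀

      parity-y : ∀ i k → 4 ℕ.* i ℕ.+ 3 ℕ.* suc k ≡ (2 ℕ.* i ℕ.+ suc k) ℕ.* 2 ℕ.+ suc k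
      parity-y = ℕ-Solver.solve-∀

      exponent-y : ∀ i → e (4 ℕ.* i ℕ.+ 3 ℕ.* suc k) (i ℕ.+ suc k) ≡ a k (suc (i ℕ.* 2))
      exponent-y i = half-exponent (8 ℕ.* (i ℕ.* i) ℕ.+ 8 ℕ.* (i ℕ.* suc k) ℕ.+ suc k ℕ.* suc k)
        (suc (i ℕ.* 2) ℕ.* suc (i ℕ.* 2) ℕ.+ 2 ℕ.* (suc (i ℕ.* 2) ℕ.* k) ℕ.+ suc (i ℕ.* 2)) k (square i k) (total i k) refl
        where
        square : ∀ i k → (4 ℕ.* i ℕ.+ 3 ℕ.* suc k) ℕ.* (4 ℕ.* i ℕ.+ 3 ℕ.* suc k)
          ≡ 8 ℕ.* (i ℕ.* i) ℕ.+ 8 ℕ.* (i ℕ.* suc k) ℕ.+ suc k ℕ.* suc k ℕ.+ 8 ℕ.* ((i ℕ.+ suc k) ℕ.* (i ℕ.+ suc k))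
        square = ℕ-Solver.solve-∀
        total : ∀ i k → 8 ℕ.* (i ℕ.* i) ℕ.+ 8 ℕ.* (i ℕ.* suc k) ℕ.+ suc k ℕ.* suc k ℕ.+ (4 ℕ.* i ℕ.+ 3 ℕ.* suc k)
          ≡ (suc (i ℕ.* 2) ℕ.* suc (i ℕ.* 2) ℕ.+ 2 ℕ.* (suc (i ℕ.* 2) ℕ.* k) ℕ.+ suc (i ℕ.* 2)) ℕ.* 2 ℕ.+ k ℕ.* suc k
        total = ℕ-Solver.solve-∀

      i≤a-odd : ∀ i → i ≤ a k (suc (i ℕ.* 2))
      i≤a-odd i = ℕ.≤-trans (ℕ.m≤n⇒m≤1+n (i≤i*2 i)) (i≤a k (suc (i ℕ.* 2)))

      support-y : ∀ n j → j ≤ n / 3 → y n j ≡ + suc k → ∃ λ i → n ≡ 4 ℕ.* i ℕ.+ 3 ℕ.* suc k × j ≡ i ℕ.+ suc k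
      support-y n j j≤n/3 eq = j ∸ suc k , ℕ.+-cancelˡ-≡ (suc k) n _ (begin
          suc k ℕ.+ n                                           ≡⟨ 4j≡ ⟨
          4 ℕ.* j                                               ≡⟨ cong (4 ℕ.*_) (ℕ.m∸n+n≡m 1+k≤j) ⟨
          4 ℕ.* (j ∸ suc k ℕ.+ suc k)                           ≡⟨ position-y (j ∸ suc k) k ⟩
          suc k ℕ.+ (4 ℕ.* (j ∸ suc k) ℕ.+ 3 ℕ.* suc k)         ∎) , ≡.sym (ℕ.m∸n+n≡m 1+k≤j)
        where
        open ≡-Reasoning
        4j≡ : 4 ℕ.* j ≡ suc k ℕ.+ n
        4j≡ = diff⇒ (4 ℕ.* j) n eq
        quadruple : ∀ j → 4 ℕ.* j ≡ j ℕ.+ j ℕ.* 3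
        quadruple = ℕ-Solver.solve-∀
        1+k≤j : suc k ≤ j
        1+k≤j = ℕ.+-cancelʳ-≤ (j ℕ.* 3) (suc k) j (ℕ.≤-trans (ℕ.+-monoʳ-≤ (suc k) (≤/⇒*≤ n 3 j≤n/3))
          (ℕ.≤-reflexive (≡.trans (≡.sym 4j≡) (quadruple j))))

      sum-y : ∑∑ s e y b (+ suc k) N M ≡ ∑< I (λ i → mono (suc k) (a k (suc (i ℕ.* 2))) N)
      sum-y = ∑∑-curve s e y b N M I 3 (3 ℕ.* suc k) (λ i → i ℕ.+ suc k) (λ _ → suc k) (λ i → a k (suc (i ℕ.* 2))) N<I
        (large (3 ℕ.* suc k) 1 (size-y k))
        (λ i → s≤s (*≤⇒≤/ 3 (≤-by i (range-y i k))))
        (λ { n j (s≤s j≤n/3) eq → support-y n j j≤n/3 eq })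
        (λ i → ⇒diff (4 ℕ.* i ℕ.+ 3 ℕ.* suc k) (suc k) (position-y i k))
        (λ i → 2 ℕ.* i ℕ.+ suc k , parity-y i k) exponent-y i≤a-odd

      -- On this line |m| ≥ k + 1, so leaving out m = 0 does not affect the value found in `sum-y`.
      -- Thus each odd-indexed exponent is counted twice.
      sum-y′ : ∑∑ s′ e′ y′ b′ (+ suc k) N M ≡ ∑< I (λ i → mono (suc k) (a k (suc (i ℕ.* 2))) N)
      sum-y′ = ∑∑-curve s′ e′ y′ b′ N M I 3 (3 ℕ.* suc k) (λ i → i ℕ.+ k) (λ _ → suc k) (λ i → a k (suc (i ℕ.* 2))) N<I
        (large (3 ℕ.* suc k) 1 (size-y k))
        (λ i → ≡.subst (_≤ (4 ℕ.* i ℕ.+ 3 ℕ.* suc k) / 3) (ℕ.+-suc i k) (*≤⇒≤/ 3 (≤-by i (range-y i k))))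
        support
        (λ i → ≡.trans (cong (y (4 ℕ.* i ℕ.+ 3 ℕ.* suc k)) (≡.sym (ℕ.+-suc i k))) (⇒diff (4 ℕ.* i ℕ.+ 3 ℕ.* suc k) (suc k) (position-y i k)))
        (λ i → 2 ℕ.* i ℕ.+ suc k , parity-y i k)
        (λ i → ≡.trans (cong (e (4 ℕ.* i ℕ.+ 3 ℕ.* suc k)) (≡.sym (ℕ.+-suc i k))) (exponent-y i)) i≤a-odd
        where
        support : ∀ n j → j < b′ n → y′ n j ≡ + suc k → ∃ λ i → n ≡ 4 ℕ.* i ℕ.+ 3 ℕ.* suc k × j ≡ i ℕ.+ k
        support n j j<n/3 eq with support-y n (suc j) j<n/3 eq
        ... | i , n≡ , 1+j≡ = i , n≡ , ℕ.suc-injective (≡.trans 1+j≡ (ℕ.+-suc i k))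

    -- Up to the sign (-1)^k, the terms 2i and 2i + 1 of `solution₂` together contribute the
    -- exponents with indices 2i and 2i + 2 once and that with index 2i + 1 twice, the latter
    -- negatively. This matches the four sums.
    partial-rows : cf (partialSum hecke₃ M) (+ suc k) N ≡ solution₂ (I ℕ.* 2) k N
    partial-rows = begin
      cf (partialSum hecke₃ M) (+ suc k) N
        ≡⟨ cf-hecke₃ (+ suc k) N M ⟩
      (∑∑ s e x b (+ suc k) N M ℤ.+ ∑∑ s e y b (+ suc k) N M) ℤ.+ (∑∑ s′ e′ x′ b′ (+ suc k) N M ℤ.+ ∑∑ s′ e′ y′ b′ (+ suc k) N M)
        ≡⟨ cong₂ ℤ._+_ (cong₂ ℤ._+_ sum-x sum-y) (cong₂ ℤ._+_ sum-x′ sum-y′) ⟩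
      (∑< I X ℤ.+ ∑< I Y) ℤ.+ (∑< I X′ ℤ.+ ∑< I Y)
        ≡⟨ cong₂ ℤ._+_ (∑<-+ I X Y) (∑<-+ I X′ Y) ⟨
      ∑< I (λ i → X i ℤ.+ Y i) ℤ.+ ∑< I (λ i → X′ i ℤ.+ Y i)
        ≡⟨ ∑<-+ I (λ i → X i ℤ.+ Y i) (λ i → X′ i ℤ.+ Y i) ⟨
      ∑< I (λ i → X i ℤ.+ Y i ℤ.+ (X′ i ℤ.+ Y i))
        ≡⟨ ∑<-cong I (λ i _ → pair i) ⟩
      ∑< I (λ i → f (i ℕ.* 2) ℤ.+ f (suc (i ℕ.* 2)))
        ≡⟨ ∑<-pairs I f ⟨
      solution₂ (I ℕ.* 2) k N ∎
      where
      open ≡-Reasoning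
      X X′ Y f : ℕ → ℤ
      X i = mono k (a k (i ℕ.* 2)) N
      X′ i = mono k (a k (suc i ℕ.* 2)) N
      Y i = mono (suc k) (a k (suc (i ℕ.* 2))) N
      f i = mono (i ℕ.+ k) (a k i) N ℤ.- mono (i ℕ.+ k) (a k (suc i)) N
      regroup : ∀ u v w → u ℤ.+ ℤ.- v ℤ.+ (w ℤ.+ ℤ.- v) ≡ u ℤ.- v ℤ.+ (ℤ.- v ℤ.- ℤ.- w)
      regroup = ℤ-Solver.solve-∀
      odd : ∀ i E → ℤ.- mono k E N ≡ mono (suc (i ℕ.* 2) ℕ.+ k) E N
      odd i E = ≡.sym (≡.trans (mono-suc (i ℕ.* 2 ℕ.+ k) E N) (cong ℤ.-_ (mono-even i k E N)))
      pair : ∀ i → X i ℤ.+ Y i ℤ.+ (X′ i ℤ.+ Y i) ≡ f (i ℕ.* 2) ℤ.+ f (suc (i ℕ.* 2))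
      pair i = begin
        X i ℤ.+ Y i ℤ.+ (X′ i ℤ.+ Y i)
          ≡⟨ cong (λ v → X i ℤ.+ v ℤ.+ (X′ i ℤ.+ v)) (mono-suc k (a k (suc (i ℕ.* 2))) N) ⟩
        X i ℤ.+ ℤ.- V ℤ.+ (X′ i ℤ.+ ℤ.- V)
          ≡⟨ regroup (X i) V (X′ i) ⟩
        X i ℤ.- V ℤ.+ (ℤ.- V ℤ.- ℤ.- X′ i)
          ≡⟨ cong₂ ℤ._+_
               (cong₂ ℤ._-_ (≡.sym (mono-even i k (a k (i ℕ.* 2)) N)) (≡.sym (mono-even i k (a k (suc (i ℕ.* 2))) N)))
               (cong₂ ℤ._-_ (odd i (a k (suc (i ℕ.* 2)))) (odd i (a k (suc i ℕ.* 2)))) ⟩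
        f (i ℕ.* 2) ℤ.+ f (suc (i ℕ.* 2)) ∎
        where
        V : ℤ
        V = mono k (a k (suc (i ℕ.* 2))) N

  rows : ∀ k n → cf (∑∞ hecke₃ hecke₃-summable) (+ suc k) (+ n) ≡ solution₂ (suc n ℕ.* 2) k (+ n)
  rows k n = cf-lim-unique {partialSum hecke₃} {∑∞ hecke₃ hecke₃-summable} {+ suc k} {+ n} (4 ℕ.* suc n ℕ.+ (3 ℕ.* k ℕ.+ 4)) (proj₂ hecke₃-summable)
    λ M M-large → partial-rows k (+ n) M (suc n) (ℤ.+<+ ℕ.≤-refl) M-large

-- The double sum for K

module Hecke₄ where

  private
    s e e′ : ℕ → ℕ → ℕ
    s n m = n
    e n m = ((2 ℕ.* (n ℕ.* n) ∸ m ℕ.* m) ℕ.+ (2 ℕ.* n ∸ m)) / 2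
    e′ n m = ((2 ℕ.* (n ℕ.* n) ∸ suc m ℕ.* suc m) ℕ.+ (2 ℕ.* n ℕ.+ suc m)) / 2

    x x′ : ℕ → ℕ → ℤ
    x n m = + m ℤ.- + n
    x′ n m = + n ℤ.- + suc m ℤ.+ + 1

    b b′ : ℕ → ℕ
    b n = suc n
    b′ n = n

    cf-hecke₄ : ∀ k N M → cf (partialSum hecke₄ M) k N ≡ ∑∑ s e x b k N M ℤ.+ ∑∑ s e′ x′ b′ k N M
    cf-hecke₄ k N M = ≡.trans (cf-cong (partialSum-+ (λ n → ∑[ m ∈ 0 ⋯ n ] t₄ n m) (λ n → ∑[ m ∈ 1 ⋯ n ] u₄ n m) M) k N)
      (≡.trans (cf-+ (partialSum (λ n → ∑[ m ∈ 0 ⋯ n ] t₄ n m) M) (partialSum (λ n → ∑[ m ∈ 1 ⋯ n ] u₄ n m) M) k N)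
        (cong₂ ℤ._+_ (cf-singles s e x b k N M) (cf-singles s e′ x′ b′ k N M)))

    reverse : ∀ {m n k} → m ℤ.- n ≡ ℤ.- k → n ℤ.- m ≡ k
    reverse {m} {n} {k} eq = ≡.trans (swap m n) (≡.trans (cong ℤ.-_ eq) (ℤ.neg-involutive k))
      where
      swap : ∀ m n → n ℤ.- m ≡ ℤ.- (m ℤ.- n)
      swap = ℤ-Solver.solve-∀

    i≤e₄ : ∀ k i → i ≤ e₄ k i
    i≤e₄ k i = ℕ.≤-trans (n≤tri i) (ℕ.≤-trans (ℕ.m≤m+n (tri i) (2 ℕ.* (i ℕ.* k))) (ℕ.m≤m+n _ (2 ℕ.* tri k)))

    e₄≡ : ∀ k i → e₄ k i ≡ 2 ℕ.* (i ℕ.* k) ℕ.+ k ℕ.* suc k ℕ.+ tri i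
    e₄≡ k i = ≡.trans (cong (λ t → tri i ℕ.+ 2 ℕ.* (i ℕ.* k) ℕ.+ t) (≡.trans (ℕ.*-comm 2 (tri k)) (tri-*2 k)))
      (regroup (tri i) (2 ℕ.* (i ℕ.* k)) (k ℕ.* suc k))
      where
      regroup : ∀ u v w → u ℕ.+ v ℕ.+ w ≡ v ℕ.+ w ℕ.+ u
      regroup = ℕ-Solver.solve-∀

    -- Along a line the sign alternates with i, whereas one step of the recurrence produces two
    -- consecutive terms; this is also the reason for the bound `I * 2` below.
    pairs : ∀ I k N → ∑< (I ℕ.* 2) (λ i → mono (i ℕ.+ k) (e₄ k i) N) ≡ solution₄ I k N
    pairs I k N = ≡.trans (∑<-pairs I (λ i → mono (i ℕ.+ k) (e₄ k i) N)) (∑<-cong I λ i _ → cong₂ ℤ._+_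
      (mono-even i k (e₄ k (i ℕ.* 2)) N)
      (≡.trans (mono-suc (i ℕ.* 2 ℕ.+ k) (e₄ k (suc (i ℕ.* 2))) N) (cong ℤ.-_ (mono-even i k (e₄ k (suc (i ℕ.* 2))) N))))

  module _ (k : ℕ) (N : ℤ) (M I : ℕ) (N<I : N ℤ.< + (I ℕ.* 2)) (M-large : 1 ℕ.* (I ℕ.* 2) ℕ.+ suc k ≤ M) where

    private
      -- The first inner sum contains only powers z^(m-n) with m ≤ n and the second only z^(n-m+1)
      -- with m ≤ n. The nonpositive and the positive rows therefore come from different sums and
      -- are treated separately.
      sum-x : ∑∑ s e x b (ℤ.- + k) N M ≡ ∑< (I ℕ.* 2) (λ i → mono (i ℕ.+ k) (e₄ k i) N)
      sum-x = ∑∑-curve s e x b N M (I ℕ.* 2) 0 k (λ i → i) (λ i → i ℕ.+ k) (e₄ k) N<I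
        (ℕ.≤-trans (ℕ.+-monoʳ-≤ (1 ℕ.* (I ℕ.* 2)) (ℕ.n≤1+n k)) M-large)
        (λ i → s≤s (≤-by k (cong (λ t → t ℕ.+ k) (ℕ.*-identityˡ i))))
        (λ n j _ eq → j , ≡.trans (diff⇒ n j (reverse {+ j} {+ n} {+ k} eq)) (position k j) , refl)
        (λ i → reverse {+ (1 ℕ.* i ℕ.+ k)} {+ i} (≡.trans (⇒diff i k (≡.sym (position k i))) (≡.sym (ℤ.neg-involutive (+ k)))))
        (λ i → 0 , cong (λ t → t ℕ.+ k) (ℕ.*-identityˡ i))
        (λ i → half-exponent (i ℕ.* i ℕ.+ 4 ℕ.* (i ℕ.* k) ℕ.+ 2 ℕ.* (k ℕ.* k)) (2 ℕ.* (i ℕ.* k) ℕ.+ k ℕ.* suc k) i (square i k)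
          (≡.trans (cong (λ t → i ℕ.* i ℕ.+ 4 ℕ.* (i ℕ.* k) ℕ.+ 2 ℕ.* (k ℕ.* k) ℕ.+ t) (∸-by (i ℕ.+ 2 ℕ.* k) (linear i k))) (total i k)) (e₄≡ k i))
        (i≤e₄ k)
        where
        position : ∀ k j → k ℕ.+ j ≡ 1 ℕ.* j ℕ.+ k
        position = ℕ-Solver.solve-∀
        square : ∀ i k → 2 ℕ.* ((1 ℕ.* i ℕ.+ k) ℕ.* (1 ℕ.* i ℕ.+ k)) ≡ i ℕ.* i ℕ.+ 4 ℕ.* (i ℕ.* k) ℕ.+ 2 ℕ.* (k ℕ.* k) ℕ.+ i ℕ.* i
        square = ℕ-Solver.solve-∀
        linear : ∀ i k → 2 ℕ.* (1 ℕ.* i ℕ.+ k) ≡ i ℕ.+ 2 ℕ.* k ℕ.+ i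
        linear = ℕ-Solver.solve-∀
        total : ∀ i k → i ℕ.* i ℕ.+ 4 ℕ.* (i ℕ.* k) ℕ.+ 2 ℕ.* (k ℕ.* k) ℕ.+ (i ℕ.+ 2 ℕ.* k) ≡ (2 ℕ.* (i ℕ.* k) ℕ.+ k ℕ.* suc k) ℕ.* 2 ℕ.+ i ℕ.* suc i
        total = ℕ-Solver.solve-∀

      sum-x-empty : ∑∑ s e x b (+ suc k) N M ≡ ℤ.0ℤ
      sum-x-empty = ∑∑-empty s e x b N M λ { n m (s≤s m≤n) eq → too-large m≤n (diff⇒ m n eq) }

      sum-x′ : ∑∑ s e′ x′ b′ (+ suc k) N M ≡ ∑< (I ℕ.* 2) (λ i → mono (i ℕ.+ suc k) (e₄ (suc k) i) N)
      sum-x′ = ∑∑-curve s e′ x′ b′ N M (I ℕ.* 2) 0 (suc k) (λ i → i) (λ i → i ℕ.+ suc k) (e₄ (suc k)) N<I M-large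
        (λ i → ≤-by k (range i k))
        (λ n j _ eq → j , ℕ.suc-injective (≡.trans (diff⇒ (suc n) (suc j) (≡.trans (≡.sym (plus-one (+ n) (+ suc j))) eq)) (position k j)) , refl)
        (λ i → ≡.trans (plus-one (+ (1 ℕ.* i ℕ.+ suc k)) (+ suc i)) (⇒diff (suc i) (suc k) (≡.sym (position k i))))
        (λ i → 0 , cong (λ t → t ℕ.+ suc k) (ℕ.*-identityˡ i))
        (λ i → half-exponent (i ℕ.* i ℕ.+ 4 ℕ.* (i ℕ.* k) ℕ.+ 2 ℕ.* i ℕ.+ 2 ℕ.* (k ℕ.* k) ℕ.+ 4 ℕ.* k ℕ.+ 1)
          (2 ℕ.* (i ℕ.* suc k) ℕ.+ suc k ℕ.* suc (suc k)) i (square i k) (total i k) (e₄≡ (suc k) i))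
        (i≤e₄ (suc k))
        where
        range : ∀ i k → 1 ℕ.* i ℕ.+ suc k ≡ suc i ℕ.+ k
        range = ℕ-Solver.solve-∀
        position : ∀ k j → suc k ℕ.+ suc j ≡ suc (1 ℕ.* j ℕ.+ suc k)
        position = ℕ-Solver.solve-∀
        square : ∀ i k → 2 ℕ.* ((1 ℕ.* i ℕ.+ suc k) ℕ.* (1 ℕ.* i ℕ.+ suc k))
          ≡ i ℕ.* i ℕ.+ 4 ℕ.* (i ℕ.* k) ℕ.+ 2 ℕ.* i ℕ.+ 2 ℕ.* (k ℕ.* k) ℕ.+ 4 ℕ.* k ℕ.+ 1 ℕ.+ suc i ℕ.* suc i
        square = ℕ-Solver.solve-∀
        total : ∀ i k → i ℕ.* i ℕ.+ 4 ℕ.* (i ℕ.* k) ℕ.+ 2 ℕ.* i ℕ.+ 2 ℕ.* (k ℕ.* k) ℕ.+ 4 ℕ.* k ℕ.+ 1 ℕ.+ (2 ℕ.* (1 ℕ.* i ℕ.+ suc k) ℕ.+ suc i)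
          ≡ (2 ℕ.* (i ℕ.* suc k) ℕ.+ suc k ℕ.* suc (suc k)) ℕ.* 2 ℕ.+ i ℕ.* suc i
        total = ℕ-Solver.solve-∀

      sum-x′-empty : ∑∑ s e′ x′ b′ (ℤ.- + k) N M ≡ ℤ.0ℤ
      sum-x′-empty = ∑∑-empty s e′ x′ b′ {ℤ.- + k} N M λ n j j<n eq →
        too-large (s≤s j<n) (cong suc (diff⇒ (suc j) (suc n) {k} (reverse {+ suc n} {+ suc j} {+ k} (≡.trans (≡.sym (plus-one (+ n) (+ suc j))) eq))))

    partial-rows-≤0 : cf (partialSum hecke₄ M) (ℤ.- + k) N ≡ solution₄ I k N
    partial-rows-≤0 = ≡.trans (cf-hecke₄ (ℤ.- + k) N M) (≡.trans (cong₂ ℤ._+_ sum-x sum-x′-empty) (≡.trans (ℤ.+-identityʳ _) (pairs I k N)))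

    partial-rows->0 : cf (partialSum hecke₄ M) (+ suc k) N ≡ solution₄ I (suc k) N
    partial-rows->0 = ≡.trans (cf-hecke₄ (+ suc k) N M) (≡.trans (cong₂ ℤ._+_ sum-x-empty sum-x′) (≡.trans (ℤ.+-identityˡ _) (pairs I (suc k) N)))

  rows-≤0 : ∀ k n → cf (∑∞ hecke₄ hecke₄-summable) (ℤ.- + k) (+ n) ≡ solution₄ (suc n) k (+ n)
  rows-≤0 k n = cf-lim-unique {partialSum hecke₄} {∑∞ hecke₄ hecke₄-summable} {ℤ.- + k} {+ n} (1 ℕ.* (suc n ℕ.* 2) ℕ.+ suc k) (proj₂ hecke₄-summable)
    λ M M-large → partial-rows-≤0 k (+ n) M (suc n) (n<2+2n n) M-large

  rows->0 : ∀ k n → cf (∑∞ hecke₄ hecke₄-summable) (+ suc k) (+ n) ≡ solution₄ (suc n) (suc k) (+ n)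
  rows->0 k n = cf-lim-unique {partialSum hecke₄} {∑∞ hecke₄ hecke₄-summable} {+ suc k} {+ n} (1 ℕ.* (suc n ℕ.* 2) ℕ.+ suc k) (proj₂ hecke₄-summable)
    λ M M-large → partial-rows->0 k (+ n) M (suc n) (n<2+2n n) M-large

-- The four identities

private
  z^*q≈ : ∀ j → z^ j * q ≈ z^ j * q ^ 1
  z^*q≈ j = S.*-congˡ {z^ j} (S.sym (S.*-identityʳ q))

  q^1-products : ⟨ z^ (+ 1) * q ⨾q^ 1 ⟩∞ * ⟨ z^ -[1+ 0 ] * q ⨾q^ 1 ⟩∞ * ⟨ q ⨾q^ 1 ⟩∞
    ≈ ⟨ z^ (+ 1) * q ^ 1 ⨾q^ 1 ⟩∞ * ⟨ z^ -[1+ 0 ] * q ^ 1 ⨾q^ 1 ⟩∞ * ⟨ q ^ 1 ⨾q^ 1 ⟩∞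
  q^1-products = S.*-cong (S.*-cong (∞-cong 1 (z^*q≈ (+ 1))) (∞-cong 1 (z^*q≈ -[1+ 0 ]))) (∞-cong 1 (S.sym (S.*-identityʳ q)))

  -- The factor 1/2 of (1) is moved to this side as 2, since 2 is not invertible among integer
  -- coefficients.
  R-side : (1# + 1#) * (⟨ z^ (+ 1) * q ⨾q^ 1 ⟩∞ * ⟨ z^ -[1+ 0 ] * q ⨾q^ 1 ⟩∞ * ⟨ q ⨾q^ 1 ⟩∞ * R) ≈ R-function.F + R-function.F
  R-side = S.trans (S.*-congˡ {1# + 1#} (S.trans (S.*-congʳ {R} q^1-products) (R-function.product≈F R-summable)))
    (solve 1 (λ f → (con (+ 1) ⊕ con (+ 1)) ⊛ f := f ⊕ f) S.refl R-function.F)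

  H-side : (1# + z^ (+ 1)) * ⟨ z^ (+ 1) * q ⨾q^ 1 ⟩∞ * ⟨ z^ -[1+ 0 ] * q ⨾q^ 1 ⟩∞ * ⟨ q ⨾q^ 1 ⟩∞ * H ≈ H-function.F
  H-side = S.trans
    (solve 5 (λ u a b c h → u ⊛ a ⊛ b ⊛ c ⊛ h := u ⊛ (a ⊛ b ⊛ c ⊛ h)) S.refl
      (1# + z^ (+ 1)) ⟨ z^ (+ 1) * q ⨾q^ 1 ⟩∞ ⟨ z^ -[1+ 0 ] * q ⨾q^ 1 ⟩∞ ⟨ q ⨾q^ 1 ⟩∞ H)
    (S.*-congˡ {1# + z^ (+ 1)} (S.trans (S.*-congʳ {H} q^1-products) (H-function.product≈F H-summable)))

  n<1+n : ∀ n → + n ℤ.< + suc n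
  n<1+n n = ℤ.+<+ ℕ.≤-refl

  -- The reflection k ↦ 1 - k exchanges positive and nonpositive exponents, so the rows of z, z²,
  -- ... determine the series.
  reflect : ∀ {f g} → (∀ k N → cf f (+ 1 ℤ.- k) N ≡ cf f k N) → (∀ k N → cf g (+ 1 ℤ.- k) N ≡ cf g k N) →
    (∀ k n → cf f (+ suc k) (+ n) ≡ cf g (+ suc k) (+ n)) → f ≈ g
  reflect {f} {g} f-symmetric g-symmetric h = cf-ext rows
    where
    rows : ∀ k n → cf f k (+ n) ≡ cf g k (+ n)
    rows (+ suc k) n = h k n
    rows (+ zero)  n = ≡.trans (f-symmetric (+ 1) (+ n)) (≡.trans (h 0 n) (≡.sym (g-symmetric (+ 1) (+ n))))
    rows -[1+ k ]  n = ≡.trans (f-symmetric (+ suc (suc k)) (+ n)) (≡.trans (h (suc k) n) (≡.sym (g-symmetric (+ suc (suc k)) (+ n))))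

  identity₁ : R-function.F + R-function.F ≈ ∑∞ hecke₁ hecke₁-summable
  identity₁ = cf-ext rows
    where
    F : Series
    F = R-function.F
    nonnegative : ∀ k n → cf (F + F) (+ k) (+ n) ≡ cf (∑∞ hecke₁ hecke₁-summable) (+ k) (+ n)
    nonnegative k n = ≡.trans (cf-+ F F (+ k) (+ n))
      (≡.trans (cong (λ x → x ℤ.+ x) (R-rows (suc n) k (+ n) (n<1+n n))) (≡.sym (Hecke₁.rows k n)))
    rows : ∀ k n → cf (F + F) k (+ n) ≡ cf (∑∞ hecke₁ hecke₁-summable) k (+ n)
    rows (+ k)    n = nonnegative k n
    rows -[1+ k ] n = ≡.trans (cf-+ F F -[1+ k ] (+ n)) (≡.trans
      (cong (λ x → x ℤ.+ x) (R-function.F-symmetric (+ suc k) (+ n)))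
      (≡.trans (≡.sym (cf-+ F F (+ suc k) (+ n))) (≡.trans (nonnegative (suc k) n) (≡.sym (Hecke₁.symmetric (+ suc k) (+ n))))))

  identity₂ : H-function.F ≈ ∑∞ hecke₂ hecke₂-summable
  identity₂ = reflect H-function.F-symmetric Hecke₂.symmetric λ k n →
    ≡.trans (H-rows (suc n) k (+ n) (n<1+n n)) (≡.sym (Hecke₂.rows k n))

  identity₃ : H-function.F ≈ ∑∞ hecke₃ hecke₃-summable
  identity₃ = reflect H-function.F-symmetric Hecke₃.symmetric λ k n →
    -- The lines of `Hecke₃` collect the terms of `solution₂` in pairs, hence the doubled number of
    -- steps.
    ≡.trans (H-rows (suc n ℕ.* 2) k (+ n) (n<2+2n n)) (≡.sym (Hecke₃.rows k n))

  identity₄ : K-function.F ≈ ∑∞ hecke₄ hecke₄-summable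
  identity₄ = cf-ext rows
    where
    rows : ∀ k n → cf K-function.F k (+ n) ≡ cf (∑∞ hecke₄ hecke₄-summable) k (+ n)
    rows (+ zero)  n = ≡.trans (K-rows (suc n) 0 (+ n) (n<1+n n)) (≡.sym (Hecke₄.rows-≤0 0 n))
    rows (+ suc k) n = ≡.trans (K-rows (suc n) (suc k) (+ n) (n<1+n n)) (≡.sym (Hecke₄.rows->0 k n))
    rows -[1+ k ]  n = ≡.trans (K-function.F-symmetric (+ suc k) (+ n))
      (≡.trans (K-rows (suc n) (suc k) (+ n) (n<1+n n)) (≡.sym (Hecke₄.rows-≤0 (suc k) n)))

theorem1p1 : ( (1# + 1#) * (⟨ z^ (+ 1) * q ⨾q^ 1 ⟩∞ * ⟨ z^ -[1+ 0 ] * q ⨾q^ 1 ⟩∞ * ⟨ q ⨾q^ 1 ⟩∞ * R)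
    ≈ ∑∞ hecke₁ hecke₁-summable )
    × ( (1# + z^ (+ 1)) * ⟨ z^ (+ 1) * q ⨾q^ 1 ⟩∞ * ⟨ z^ -[1+ 0 ] * q ⨾q^ 1 ⟩∞ * ⟨ q ⨾q^ 1 ⟩∞ * H
    ≈ ∑∞ hecke₂ hecke₂-summable )
    × ( (1# + z^ (+ 1)) * ⟨ z^ (+ 1) * q ⨾q^ 1 ⟩∞ * ⟨ z^ -[1+ 0 ] * q ⨾q^ 1 ⟩∞ * ⟨ q ⨾q^ 1 ⟩∞ * H
    ≈ ∑∞ hecke₃ hecke₃-summable )
    × ( ⟨ z^ (+ 1) * q ^ 2 ⨾q^ 2 ⟩∞ * ⟨ z^ -[1+ 0 ] * q ^ 2 ⨾q^ 2 ⟩∞ * ⟨ q ^ 2 ⨾q^ 2 ⟩∞ * K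
    ≈ ∑∞ hecke₄ hecke₄-summable )
theorem1p1 =
    S.trans R-side identity₁
  , S.trans H-side identity₂
  , S.trans H-side identity₃
  , S.trans (K-function.product≈F K-summable) identity₄
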